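{- There is an absolute constant $c>0$ such that the following holds. For every finite field $\mathbb F$ and every non-negative integer $k$, every $\mathbb F$-representable excluded minor $M$ for the class of matroids of path-width at most $k$ satisfies $|E(M)|\le 2^{|\mathbb F|^{c(k+1)^2}}$. (That is, the number of elements is $2^{|\mathbb F|^{O(k^2)}}$.)
   Context: For a matroid $M$ with rank function $r_M$, the connectivity function is $\lambda_M(X)=r_M(X)+r_M(E(M)-X)-r_M(E(M))$ for $X\subseteq E(M)$. A path-decomposition (linear layout) of $M$ is an ordering $e_1,\dots,e_n$ of $E(M)$; its width is $\max_{1\le i<n}\lambda_M(\{e_1,\dots,e_i\})$ (taken to be $0$ if $n\le 1$). The path-width of $M$ is the minimum width over all path-decompositions. A minor of $M$ is a matroid $M/C\setminus D$ for disjoint $C,D\subseteq E(M)$; it is proper if $C\cup D\neq\emptyset$. An excluded minor for a class $\mathcal C$ is a matroid not in $\mathcal C$ all of whose proper minors are in $\mathcal C$. -}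

module Defs where

open import Level using (0ℓ)
open import Data.Nat using (ℕ; zero; suc; _+_; _∸_; _≤_; _<_; _<ᵇ_; _⊔_)
open import Data.Fin as Fin using (Fin; toℕ)
open import Data.Fin.Subset using (Subset; _∈_; _∉_; _⊆_; _∪_; _∩_; ∁; ⊥; ⊤; ∣_∣; Nonempty)
open import Data.Fin.Permutation using (Permutation′; _⟨$⟩ˡ_)
open import Data.Vec using (tabulate; lookup)
open import Data.Bool using (if_then_else_)
open import Data.Product using (Σ; ∃; _×_)
open import Relation.Nullary using (¬_)
open import Relation.Binary.PropositionalEquality using (_≡_)
open import Algebra.Bundles using (CommutativeRing)
open import Function.Definitions using (Injective)

record Matroid (n : ℕ) : Set where
  field
    r          : Subset n → ℕ
    r-bounded  : ∀ X → r X ≤ ∣ X ∣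
    r-mono     : ∀ {X Y} → X ⊆ Y → r X ≤ r Y
    r-submod   : ∀ X Y → r (X ∪ Y) + r (X ∩ Y) ≤ r X + r Y

open Matroid public

conn : ∀ {n} → Matroid n → Subset n → ℕ
conn M X = r M X + r M (∁ X) ∸ r M ⊤

-- Path-width.  A path-decomposition is an ordering e_1,…,e_n of E,
-- encoded as a permutation π with e_i = π ⟨$⟩ʳ (i-1).

prefix : ∀ {n} → Permutation′ n → ℕ → Subset n
prefix π i = tabulate (λ e → toℕ (π ⟨$⟩ˡ e) <ᵇ i)

maxUpTo : (ℕ → ℕ) → ℕ → ℕ
maxUpTo f zero    = 0
maxUpTo f (suc j) = maxUpTo f j ⊔ f (suc j)

width : ∀ {n} → Matroid n → Permutation′ n → ℕ
width {n} M π = maxUpTo (λ i → conn M (prefix π i)) (n ∸ 1)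

PathWidth≤ : ∀ {n} → Matroid n → ℕ → Set
PathWidth≤ M k = ∃ λ (π : Permutation′ _) → width M π ≤ k

-- Minors.  N (on Fin n′) is (isomorphic to) the minor M / C \ D, where
-- φ : Fin n′ → Fin n is a bijection onto E(M) - (C ∪ D), and
-- r_N(φ⁻¹ Z) = r_M(Z ∪ C) - r_M(C) for Z ⊆ E(M) - (C ∪ D).

preimage : ∀ {n n′} → (Fin n′ → Fin n) → Subset n → Subset n′
preimage φ Z = tabulate (λ y → lookup Z (φ y))

record MinorVia {n n′} (M : Matroid n) (N : Matroid n′)
                (C D : Subset n) (φ : Fin n′ → Fin n) : Set where
  field
    disjoint  : ∀ x → x ∈ C → x ∉ D
    φ-inj     : Injective _≡_ _≡_ φ
    φ-avoidsC : ∀ y → φ y ∉ C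
    φ-avoidsD : ∀ y → φ y ∉ D
    φ-onto    : ∀ x → x ∉ C → x ∉ D → ∃ λ y → φ y ≡ x
    rank-eq   : ∀ Z → Z ⊆ ∁ (C ∪ D) →
                r N (preimage φ Z) ≡ r M (Z ∪ C) ∸ r M C

ProperMinor : ∀ {n n′} → Matroid n′ → Matroid n → Set
ProperMinor {n} {n′} N M =
  Σ (Subset n) λ C → Σ (Subset n) λ D → Σ (Fin n′ → Fin n) λ φ →
    MinorVia M N C D φ × Nonempty (C ∪ D)

ExcludedMinorPW : ∀ {n} → Matroid n → ℕ → Set
ExcludedMinorPW M k =
  ¬ PathWidth≤ M k ×
  (∀ n′ (N : Matroid n′) → ProperMinor N M → PathWidth≤ N k)

record FiniteField (q : ℕ) : Set₁ where
  field
    commRing : CommutativeRing 0ℓ 0ℓ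
  open CommutativeRing commRing public
  field
    0≉1    : ¬ (0# ≈ 1#)
    inv    : ∀ x → ¬ (x ≈ 0#) → ∃ λ y → x * y ≈ 1#
    enc    : Carrier → Fin q
    enc-cong : ∀ {x y} → x ≈ y → enc x ≡ enc y
    enc-inj  : ∀ {x y} → enc x ≡ enc y → x ≈ y
    enc-onto : ∀ i → ∃ λ x → enc x ≡ i

module _ {q : ℕ} (F : FiniteField q) where
  open FiniteField F using (Carrier; _≈_; 0#) renaming (_+_ to _+F_; _*_ to _*F_)

  sumF : ∀ {n} → (Fin n → Carrier) → Carrier
  sumF {zero}  f = 0#
  sumF {suc n} f = f Fin.zero +F sumF (λ j → f (Fin.suc j))

  IndependentCols : ∀ {m n} → (Fin m → Fin n → Carrier) → Subset n → Set
  IndependentCols A Y =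
    ∀ (a : Fin _ → Carrier) →
      (∀ i → sumF (λ j → if lookup Y j then a j *F A i j else 0#) ≈ 0#) →
      ∀ j → j ∈ Y → a j ≈ 0#

  IsColRank : ∀ {m n} → (Fin m → Fin n → Carrier) → Subset n → ℕ → Set
  IsColRank A X ρ =
    (∃ λ Y → Y ⊆ X × IndependentCols A Y × ∣ Y ∣ ≡ ρ) ×
    (∀ Y → Y ⊆ X → IndependentCols A Y → ∣ Y ∣ ≤ ρ)

  Representable : ∀ {n} → Matroid n → Set
  Representable {n} M =
    ∃ λ m → ∃ λ (A : Fin m → Fin n → Carrier) →
      ∀ X → IsColRank A X (r M X)

{-# OPTIONS --safe #-}
module Submission where

-- Deleting one element of an excluded minor M leaves a layout of width at most k, hence M has a layout of width
-- at most k + 1.  If M is large, uncrossing the prefixes of that layout produces a long chain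
-- A 0 ⊂ A 1 ⊂ … of sets of the same connectivity t ≤ k + 1 such that no set between two of them has smaller
-- connectivity.  By Tutte's linking theorem the left side A i and the right side B j = E ∖ A j (i ≤ j) are
-- joined in a minor of M along a common boundary space with |F| ^ t points.  The interaction of a set
-- Y ⊆ B j with the left side depends only on the traces on the boundary of the spans of Y and of B j ∖ Y and
-- on the connectivity of Y in B j.  A layout of B j thus becomes a word of such letters, and words can be
-- compressed, like the typical sequences of Bodlaender and Kloks, to a length that does not depend on M.
-- For each i the proper minor joining A i and B (i + 1) has a layout of width at most k, and this yields a
-- compressed word.  If i < j give the same word, then the layout of A j restricted to the minor A (i + 1) merges
-- with the layout of B (i + 1) to a layout of M of width at most k, a contradiction.  So the chain is at
-- most as long as the number of words.

import Data.Empty as Empty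
open import Data.Fin.Subset
open import Data.Fin.Subset.Properties
open import Data.List using (List; []; _∷_)
open import Data.List.Relation.Unary.All using (All; []; _∷_)
open import Data.Product using (_×_; _,_; proj₁; proj₂; ∃)
open import Data.Sum using (_⊎_; inj₁; inj₂; [_,_]′)
open import Data.Vec using ([]; _∷_; here; there)
open import Defs
open import Relation.Nullary

-- The obstacle is that two different minors have to be compared. The boundaries of `A i` and `A j`
-- lie in different places, so traces on them mean nothing to each other until both are read in
-- common coordinates. For this reason one set is contracted for the whole chain, and boundary
-- points are identified modulo its span. The identification is unambiguous because the contracted
-- set is skew to either side: otherwise contracting it would lower a connectivity that already
-- equals `t`. The left part taken from the minor at j is shrunk to `A (suc i)` before it meets
-- `∁ (A (suc i))`, and only then does M itself appear. A word obtained against one left side is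
-- thus used against another one, so equivalence of words must be tested against all left sides at
-- once. The finiteness of the field enters through counting: behind `SpanSystem`, dimensions occur
-- only as exponents of `q` in sizes of spans, and a boundary has finitely many possible traces.

module Solvers where

  open import Data.Bool using (Bool; true; false; _∧_; _∨_; not; T)
  open import Data.Bool.Properties using (T-∧)
  open import Data.Fin using (Fin; zero; suc)
  open import Data.List.Relation.Unary.All as All using (All; []; _∷_)
  open import Data.Nat
  open import Data.Nat.Properties
  open import Data.Unit using (tt)
  open import Data.Vec as Vec using (Vec; []; _∷_; lookup; replicate; zipWith)
  open import Data.Vec.Properties using (lookup-zipWith; lookup-map; lookup-replicate; lookup⇒[]=; []=⇒lookup)
  open import Function using (_∘_; Equivalence)
  open import Relation.Binary.PropositionalEquality

  -- Reflective decision procedure: inclusions between set expressions are checked on all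
  -- Boolean assignments of the variables.
  module SetSolver where

    infixr 7 _∪ₑ_
    infixr 8 _∩ₑ_
    infix 6 _⊆ₑ_

    data Expr (m : ℕ) : Set where
      var       : Fin m → Expr m
      _∪ₑ_ _∩ₑ_ : Expr m → Expr m → Expr m
      ∁ₑ        : Expr m → Expr m
      ⊥ₑ ⊤ₑ     : Expr m

    ⟦_⟧ : ∀ {m n} → Expr m → Vec (Subset n) m → Subset n
    ⟦ var i ⟧ ρ = lookup ρ i
    ⟦ a ∪ₑ b ⟧ ρ = ⟦ a ⟧ ρ ∪ ⟦ b ⟧ ρ
    ⟦ a ∩ₑ b ⟧ ρ = ⟦ a ⟧ ρ ∩ ⟦ b ⟧ ρ
    ⟦ ∁ₑ a ⟧ ρ = ∁ (⟦ a ⟧ ρ)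
    ⟦ ⊥ₑ ⟧ ρ = ⊥
    ⟦ ⊤ₑ ⟧ ρ = ⊤

    ⟦_⟧ᵇ : ∀ {m} → Expr m → Vec Bool m → Bool
    ⟦ var i ⟧ᵇ ρ = lookup ρ i
    ⟦ a ∪ₑ b ⟧ᵇ ρ = ⟦ a ⟧ᵇ ρ ∨ ⟦ b ⟧ᵇ ρ
    ⟦ a ∩ₑ b ⟧ᵇ ρ = ⟦ a ⟧ᵇ ρ ∧ ⟦ b ⟧ᵇ ρ
    ⟦ ∁ₑ a ⟧ᵇ ρ = not (⟦ a ⟧ᵇ ρ)
    ⟦ ⊥ₑ ⟧ᵇ ρ = false
    ⟦ ⊤ₑ ⟧ᵇ ρ = true

    at : ∀ {m n} → Fin n → Vec (Subset n) m → Vec Bool m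
    at x = Vec.map (λ X → lookup X x)

    lookup-⟦⟧ : ∀ {m n} (e : Expr m) (ρ : Vec (Subset n) m) x → lookup (⟦ e ⟧ ρ) x ≡ ⟦ e ⟧ᵇ (at x ρ)
    lookup-⟦⟧ (var i) ρ x = sym (lookup-map i (λ X → lookup X x) ρ)
    lookup-⟦⟧ (a ∪ₑ b) ρ x = trans (lookup-zipWith _∨_ x (⟦ a ⟧ ρ) (⟦ b ⟧ ρ))
      (cong₂ _∨_ (lookup-⟦⟧ a ρ x) (lookup-⟦⟧ b ρ x))
    lookup-⟦⟧ (a ∩ₑ b) ρ x = trans (lookup-zipWith _∧_ x (⟦ a ⟧ ρ) (⟦ b ⟧ ρ))
      (cong₂ _∧_ (lookup-⟦⟧ a ρ x) (lookup-⟦⟧ b ρ x))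
    lookup-⟦⟧ (∁ₑ a) ρ x = trans (lookup-map x not (⟦ a ⟧ ρ)) (cong not (lookup-⟦⟧ a ρ x))
    lookup-⟦⟧ ⊥ₑ ρ x = lookup-replicate x false
    lookup-⟦⟧ ⊤ₑ ρ x = lookup-replicate x true

    data Ineq (m : ℕ) : Set where
      _⊆ₑ_ : Expr m → Expr m → Ineq m

    Holds : ∀ {m n} → Vec (Subset n) m → Ineq m → Set
    Holds ρ (a ⊆ₑ b) = ⟦ a ⟧ ρ ⊆ ⟦ b ⟧ ρ

    _⇒ᵇ_ : Bool → Bool → Bool
    true  ⇒ᵇ b = b
    false ⇒ᵇ b = true

    holdsᵇ : ∀ {m} → Vec Bool m → Ineq m → Bool
    holdsᵇ ρ (a ⊆ₑ b) = ⟦ a ⟧ᵇ ρ ⇒ᵇ ⟦ b ⟧ᵇ ρ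

    Problem : ℕ → Set
    Problem m = List (Ineq m) × Ineq m

    implied : ∀ {m} → Problem m → Vec Bool m → Bool
    implied ([] , g) ρ = holdsᵇ ρ g
    implied (h ∷ hs , g) ρ = holdsᵇ ρ h ⇒ᵇ implied (hs , g) ρ

    allᵇ : ∀ m → (Vec Bool m → Bool) → Bool
    allᵇ zero f = f []
    allᵇ (suc m) f = allᵇ m (f ∘ (true ∷_)) ∧ allᵇ m (f ∘ (false ∷_))

    allᵇ-sound : ∀ m f → T (allᵇ m f) → ∀ ρ → T (f ρ)
    allᵇ-sound zero f p [] = p
    allᵇ-sound (suc m) f p (true ∷ ρ) = allᵇ-sound m _ (proj₁ (Equivalence.to T-∧ p)) ρ
    allᵇ-sound (suc m) f p (false ∷ ρ) = allᵇ-sound m _ (proj₂ (Equivalence.to (T-∧ {allᵇ m (f ∘ (true ∷_))}) p)) ρ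

    holds⇒holdsᵇ : ∀ {m n} (ρ : Vec (Subset n) m) i → Holds ρ i → ∀ x → T (holdsᵇ (at x ρ) i)
    holds⇒holdsᵇ ρ (a ⊆ₑ b) h x with ⟦ a ⟧ᵇ (at x ρ) in eqa | ⟦ b ⟧ᵇ (at x ρ) in eqb
    ... | false | _ = tt
    ... | true | true = tt
    ... | true | false with () ← trans (sym ([]=⇒lookup (h (lookup⇒[]= x _ (trans (lookup-⟦⟧ a ρ x) eqa)))))
      (trans (lookup-⟦⟧ b ρ x) eqb)

    holdsᵇ⇒holds : ∀ {m n} (ρ : Vec (Subset n) m) i → (∀ x → T (holdsᵇ (at x ρ) i)) → Holds ρ i
    holdsᵇ⇒holds ρ (a ⊆ₑ b) h {x} x∈a with h x | trans (sym (lookup-⟦⟧ a ρ x)) ([]=⇒lookup x∈a)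
    ... | hx | eq rewrite eq with ⟦ b ⟧ᵇ (at x ρ) in eqb
    ... | true = lookup⇒[]= x _ (trans (lookup-⟦⟧ b ρ x) eqb)

    modus : ∀ a {b} → T (a ⇒ᵇ b) → T a → T b
    modus true p _ = p

    implied-sound : ∀ {m n} (ρ : Vec (Subset n) m) hs g → (∀ x → T (implied (hs , g) (at x ρ))) → All (Holds ρ) hs →
      ∀ x → T (holdsᵇ (at x ρ) g)
    implied-sound ρ [] g p [] x = p x
    implied-sound ρ (h ∷ hs) g p (q ∷ qs) x =
      implied-sound ρ hs g (λ y → modus (holdsᵇ (at y ρ) h) (p y) (holds⇒holdsᵇ ρ h q y)) qs x

    vars : ∀ m → Vec (Expr m) m
    vars m = Vec.map var (Vec.allFin m)

    decide-⊆ : ∀ {m n} (ρ : Vec (Subset n) m) (f : Vec (Expr m) m → Problem m) →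
               let (hs , g) = f (vars m) in
               {T (allᵇ m (implied (hs , g)))} → All (Holds ρ) hs → Holds ρ g
    decide-⊆ {m} ρ f {p} qs with f (vars m)
    ... | hs , g = holdsᵇ⇒holds ρ g (implied-sound ρ hs g (λ x → allᵇ-sound m _ p (at x ρ)) qs)

    decide-⊆-under : ∀ {m n} (ρ : Vec (Subset n) m) (hs : Vec (Expr m) m → List (Ineq m)) → All (Holds ρ)
      (hs (vars m)) →
                     (g : Vec (Expr m) m → Ineq m) → {T (allᵇ m (implied (hs (vars m) , g (vars m))))} → Holds ρ
                       (g (vars m))
    decide-⊆-under ρ hs qs g {p} = decide-⊆ ρ (λ xs → hs xs , g xs) {p} qs

  -- Linear inequalities over ℕ: the goal is checked to be a combination of the hypotheses
  -- with the given multiplicities.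
  module LinearSolver where

    infixl 7 _+ₑ_
    infix 6 _≤ₑ_

    data Expr (m : ℕ) : Set where
      var  : Fin m → Expr m
      con  : ℕ → Expr m
      _+ₑ_ : Expr m → Expr m → Expr m

    ⟦_⟧ : ∀ {m} → Expr m → Vec ℕ m → ℕ
    ⟦ var i ⟧ ρ = lookup ρ i
    ⟦ con c ⟧ ρ = c
    ⟦ a +ₑ b ⟧ ρ = ⟦ a ⟧ ρ + ⟦ b ⟧ ρ

    Form : ℕ → Set
    Form m = Vec ℕ (suc m)

    unit : ∀ {m} → Fin m → Vec ℕ m
    unit zero = 1 ∷ replicate _ 0
    unit (suc i) = 0 ∷ unit i

    form : ∀ {m} → Expr m → Form m
    form (var i) = 0 ∷ unit i
    form (con c) = c ∷ replicate _ 0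
    form (a +ₑ b) = zipWith _+_ (form a) (form b)

    dot : ∀ {m} → Vec ℕ m → Vec ℕ m → ℕ
    dot [] [] = 0
    dot (c ∷ cs) (x ∷ xs) = c * x + dot cs xs

    dot-0 : ∀ {m} (ρ : Vec ℕ m) → dot (replicate _ 0) ρ ≡ 0
    dot-0 [] = refl
    dot-0 (x ∷ ρ) = dot-0 ρ

    dot-unit : ∀ {m} i (ρ : Vec ℕ m) → dot (unit i) ρ ≡ lookup ρ i
    dot-unit zero (x ∷ ρ) = trans (cong₂ _+_ (*-identityˡ x) (dot-0 ρ)) (+-identityʳ x)
    dot-unit (suc i) (x ∷ ρ) = dot-unit i ρ

    +-interchange : ∀ a b c d → (a + b) + (c + d) ≡ (a + c) + (b + d)
    +-interchange a b c d = begin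
      (a + b) + (c + d) ≡⟨ +-assoc a b (c + d) ⟩
      a + (b + (c + d)) ≡⟨ cong (a +_) (sym (+-assoc b c d)) ⟩
      a + ((b + c) + d) ≡⟨ cong (λ z → a + (z + d)) (+-comm b c) ⟩
      a + ((c + b) + d) ≡⟨ cong (a +_) (+-assoc c b d) ⟩
      a + (c + (b + d)) ≡⟨ sym (+-assoc a c (b + d)) ⟩
      (a + c) + (b + d) ∎
      where open ≡-Reasoning

    dot-+ : ∀ {m} (cs ds ρ : Vec ℕ m) → dot (zipWith _+_ cs ds) ρ ≡ dot cs ρ + dot ds ρ
    dot-+ [] [] [] = refl
    dot-+ (c ∷ cs) (d ∷ ds) (x ∷ ρ) =
      trans (cong₂ _+_ (*-distribʳ-+ x c d) (dot-+ cs ds ρ)) (+-interchange (c * x) (d * x) _ _)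

    dot-* : ∀ {m} k (cs ρ : Vec ℕ m) → dot (Vec.map (k *_) cs) ρ ≡ k * dot cs ρ
    dot-* k [] [] = sym (*-zeroʳ k)
    dot-* k (c ∷ cs) (x ∷ ρ) = trans (cong₂ _+_ (*-assoc k c x) (dot-* k cs ρ)) (sym (*-distribˡ-+ k (c * x) _))

    value : ∀ {m} → Form m → Vec ℕ m → ℕ
    value cs ρ = dot cs (1 ∷ ρ)

    value-form : ∀ {m} (e : Expr m) ρ → value (form e) ρ ≡ ⟦ e ⟧ ρ
    value-form (var i) ρ = dot-unit i ρ
    value-form (con c) ρ = trans (cong₂ _+_ (*-identityʳ c) (dot-0 ρ)) (+-identityʳ c)
    value-form (a +ₑ b) ρ = trans (dot-+ (form a) (form b) (1 ∷ ρ)) (cong₂ _+_ (value-form a ρ) (value-form b ρ))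

    data Ineq (m : ℕ) : Set where
      _≤ₑ_ : Expr m → Expr m → Ineq m

    Holds : ∀ {m} → Vec ℕ m → Ineq m → Set
    Holds ρ (a ≤ₑ b) = ⟦ a ⟧ ρ ≤ ⟦ b ⟧ ρ

    leqᵇ : ∀ {m} → Vec ℕ m → Vec ℕ m → Bool
    leqᵇ [] [] = true
    leqᵇ (c ∷ cs) (d ∷ ds) = (c ≤ᵇ d) ∧ leqᵇ cs ds

    leqᵇ-sound : ∀ {m} (cs ds ρ : Vec ℕ m) → T (leqᵇ cs ds) → dot cs ρ ≤ dot ds ρ
    leqᵇ-sound [] [] [] _ = z≤n
    leqᵇ-sound (c ∷ cs) (d ∷ ds) (x ∷ ρ) p with p₁ , p₂ ← Equivalence.to (T-∧ {c ≤ᵇ d}) p =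
      +-mono-≤ (*-monoˡ-≤ x (≤ᵇ⇒≤ c d p₁)) (leqᵇ-sound cs ds ρ p₂)

    Hyps : ℕ → Set
    Hyps m = List (ℕ × Ineq m)

    lhs rhs : ∀ {m} → Hyps m → Form m
    lhs [] = replicate _ 0
    lhs ((k , (a ≤ₑ b)) ∷ hs) = zipWith _+_ (Vec.map (k *_) (form a)) (lhs hs)
    rhs [] = replicate _ 0
    rhs ((k , (a ≤ₑ b)) ∷ hs) = zipWith _+_ (Vec.map (k *_) (form b)) (rhs hs)

    combine : ∀ {m} (ρ : Vec ℕ m) hs → All (Holds ρ ∘ proj₂) hs → value (lhs hs) ρ ≤ value (rhs hs) ρ
    combine ρ [] [] = ≤-refl
    combine ρ ((k , (a ≤ₑ b)) ∷ hs) (h ∷ qs) = begin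
      value (lhs ((k , (a ≤ₑ b)) ∷ hs)) ρ ≡⟨ expand a (lhs hs) ⟩
      k * ⟦ a ⟧ ρ + value (lhs hs) ρ ≤⟨ +-mono-≤ (*-monoʳ-≤ k h) (combine ρ hs qs) ⟩
      k * ⟦ b ⟧ ρ + value (rhs hs) ρ ≡⟨ sym (expand b (rhs hs)) ⟩
      value (rhs ((k , (a ≤ₑ b)) ∷ hs)) ρ ∎
      where
      open ≤-Reasoning
      expand : ∀ e f → value (zipWith _+_ (Vec.map (k *_) (form e)) f) ρ ≡ k * ⟦ e ⟧ ρ + value f ρ
      expand e f = trans (dot-+ (Vec.map (k *_) (form e)) f (1 ∷ ρ))
        (cong (_+ value f ρ) (trans (dot-* k (form e) (1 ∷ ρ)) (cong (k *_) (value-form e ρ))))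

    Problem : ℕ → Set
    Problem m = Hyps m × Ineq m

    -- The weighted hypotheses add up to `lhs hs ≤ rhs hs`. Since ℕ has no subtraction, the goal is
    -- compared with them crosswise, and `rhs hs` is cancelled afterwards.
    certifies : ∀ {m} → Problem m → Bool
    certifies (hs , (a ≤ₑ b)) = leqᵇ (zipWith _+_ (form a) (rhs hs)) (zipWith _+_ (form b) (lhs hs))

    certifies-sound : ∀ {m} (ρ : Vec ℕ m) hs g → T (certifies (hs , g)) → All (Holds ρ ∘ proj₂) hs → Holds ρ g
    certifies-sound ρ hs (a ≤ₑ b) p qs = +-cancelʳ-≤ (value (rhs hs) ρ) _ _ (begin
      ⟦ a ⟧ ρ + value (rhs hs) ρ ≡⟨ cong (_+ value (rhs hs) ρ) (value-form a ρ) ⟨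
      value (form a) ρ + value (rhs hs) ρ ≡⟨ dot-+ (form a) (rhs hs) (1 ∷ ρ) ⟨
      value (zipWith _+_ (form a) (rhs hs)) ρ ≤⟨ leqᵇ-sound (zipWith _+_ (form a) (rhs hs))
        (zipWith _+_ (form b) (lhs hs)) (1 ∷ ρ) p ⟩
      value (zipWith _+_ (form b) (lhs hs)) ρ ≡⟨ dot-+ (form b) (lhs hs) (1 ∷ ρ) ⟩
      value (form b) ρ + value (lhs hs) ρ ≤⟨ +-mono-≤ (≤-reflexive (value-form b ρ)) (combine ρ hs qs) ⟩
      ⟦ b ⟧ ρ + value (rhs hs) ρ ∎)
      where open ≤-Reasoning

    vars : ∀ m → Vec (Expr m) m
    vars m = Vec.map var (Vec.allFin m)

    linear : ∀ {m} (ρ : Vec ℕ m) (f : Vec (Expr m) m → Problem m) →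
             let (hs , g) = f (vars m) in
             {T (certifies (hs , g))} → All (Holds ρ ∘ proj₂) hs → Holds ρ g
    linear {m} ρ f {p} qs with f (vars m)
    ... | hs , g = certifies-sound ρ hs g p qs

  open SetSolver using (decide-⊆; decide-⊆-under; _⊆ₑ_; _∪ₑ_; _∩ₑ_; ∁ₑ; ⊥ₑ; ⊤ₑ) public
  open LinearSolver using (linear; _≤ₑ_; _+ₑ_; con) public

-- Rank functions, connectivity and linking

module RankFunctions where

  open Solvers
  open import Data.Fin using (Fin; zero; suc)
  open import Data.Nat
  open import Data.Nat.Properties
  open import Relation.Binary.PropositionalEquality

  x∈⇒⁅x⁆⊆ : ∀ {n} {x : Fin n} {X} → x ∈ X → ⁅ x ⁆ ⊆ X
  x∈⇒⁅x⁆⊆ {x = x} x∈X y∈ rewrite x∈⁅y⁆⇒x≡y x y∈ = x∈X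

  remove-smaller : ∀ {n} {x : Fin n} {R f} → x ∈ R → ∣ R ∣ ≤ suc f → ∣ R ∩ ∁ ⁅ x ⁆ ∣ ≤ f
  remove-smaller {x = x} {R} x∈R ∣R∣≤ =
    ≤-pred (≤-trans (p⊂q⇒∣p∣<∣q∣ (p∩q⊆p R _ , x , x∈R , λ x∈ → x∈∁p⇒x∉p (p∩q⊆q R _ x∈) (x∈⁅x⁆ x))) ∣R∣≤)

  module Rank {n} (M : Matroid n) where

    rk : Subset n → ℕ
    rk = r M

    submod : ∀ X Y U I → U ⊆ X ∪ Y → I ⊆ X ∩ Y → rk U + rk I ≤ rk X + rk Y
    submod X Y U I p q = ≤-trans (+-mono-≤ (r-mono M p) (r-mono M q)) (r-submod M X Y)

    rk-⊥ : rk ⊥ ≡ 0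
    rk-⊥ = n≤0⇒n≡0 (≤-trans (r-bounded M ⊥) (≤-reflexive (∣⊥∣≡0 n)))

    rk-∪-≤ : ∀ X Y → rk (X ∪ Y) ≤ rk X + ∣ Y ∣
    rk-∪-≤ X Y = begin
      rk (X ∪ Y) ≤⟨ m≤m+n _ _ ⟩
      rk (X ∪ Y) + rk (X ∩ Y) ≤⟨ r-submod M X Y ⟩
      rk X + rk Y ≤⟨ +-monoʳ-≤ (rk X) (r-bounded M Y) ⟩
      rk X + ∣ Y ∣ ∎
      where open ≤-Reasoning

    rk-∪⁅⁆-≤ : ∀ X x → rk (X ∪ ⁅ x ⁆) ≤ rk X + 1
    rk-∪⁅⁆-≤ X x = ≤-trans (rk-∪-≤ X ⁅ x ⁆) (≤-reflexive (cong (rk X +_) (∣⁅x⁆∣≡1 x)))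

    -- λ(X) + r(M), which avoids truncated subtraction.
    cut : Subset n → ℕ
    cut X = rk X + rk (∁ X)

    cut-submod : ∀ X Y → cut (X ∩ Y) + cut (X ∪ Y) ≤ cut X + cut Y
    cut-submod X Y = linear
      (rk (X ∪ Y) ∷ rk (X ∩ Y) ∷ rk (∁ (X ∪ Y)) ∷ rk (∁ (X ∩ Y)) ∷ rk X ∷ rk Y ∷ rk (∁ X) ∷ rk (∁ Y) ∷ [])
      (λ { (u ∷ i ∷ cu ∷ ci ∷ x ∷ y ∷ cx ∷ cy ∷ []) →
        (1 , u +ₑ i ≤ₑ x +ₑ y) ∷ (1 , ci +ₑ cu ≤ₑ cx +ₑ cy) ∷ [] ,
        (i +ₑ ci) +ₑ (u +ₑ cu) ≤ₑ (x +ₑ cx) +ₑ (y +ₑ cy) })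
      (r-submod M X Y ∷
       submod (∁ X) (∁ Y) (∁ (X ∩ Y)) (∁ (X ∪ Y))
         (decide-⊆ (X ∷ Y ∷ []) (λ { (x ∷ y ∷ []) → [] , ∁ₑ (x ∩ₑ y) ⊆ₑ ∁ₑ x ∪ₑ ∁ₑ y }) [])
         (decide-⊆ (X ∷ Y ∷ []) (λ { (x ∷ y ∷ []) → [] , ∁ₑ (x ∪ₑ y) ⊆ₑ ∁ₑ x ∩ₑ ∁ₑ y }) []) ∷ [])

    -- Connectivity does not increase under minors: (P , R) separates a minor with contracted set P ∩ R,
    -- and (P′ , R′) is the induced separation of a further minor with contracted set I.
    minor-mono : ∀ P R I P′ R′ → P ∩ R ⊆ I → I ⊆ P ∪ R → I ⊆ P′ → P′ ⊆ P ∪ I → I ⊆ R′ → R′ ⊆ R ∪ I →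
                 rk P′ + rk R′ + rk (P ∩ R) + rk (P ∪ R) ≤ rk P + rk R + rk I + rk (P′ ∪ R′)
    minor-mono P R I P′ R′ h₁ h₂ h₃ h₄ h₅ h₆ = linear
      (rk P ∷ rk R ∷ rk I ∷ rk P′ ∷ rk R′ ∷ rk (P ∩ R) ∷ rk (P ∪ R) ∷ rk (P′ ∪ R′)
        ∷ rk (P ∪ I) ∷ rk (I ∩ P) ∷ rk (R ∪ I) ∷ rk (I ∩ R) ∷ rk (P′ ∪ (R ∪ I)) ∷ [])
      (λ { (p ∷ q ∷ i ∷ p′ ∷ q′ ∷ p∩q ∷ p∪q ∷ p′q′ ∷ pi ∷ ip ∷ qi ∷ iq ∷ p′qi ∷ []) →
        (1 , pi +ₑ ip ≤ₑ p +ₑ i) ∷ (1 , qi +ₑ iq ≤ₑ q +ₑ i) ∷ (1 , i +ₑ p∩q ≤ₑ ip +ₑ iq) ∷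
        (1 , p∪q +ₑ p′ ≤ₑ pi +ₑ p′qi) ∷ (1 , p′qi +ₑ q′ ≤ₑ qi +ₑ p′q′) ∷ [] ,
        p′ +ₑ q′ +ₑ p∩q +ₑ p∪q ≤ₑ p +ₑ q +ₑ i +ₑ p′q′ })
      (submod P I (P ∪ I) (I ∩ P) (λ z → z) (incl (λ { (p ∷ q ∷ i ∷ p′ ∷ q′ ∷ []) → i ∩ₑ p ⊆ₑ p ∩ₑ i })) ∷
       submod R I (R ∪ I) (I ∩ R) (λ z → z) (incl (λ { (p ∷ q ∷ i ∷ p′ ∷ q′ ∷ []) → i ∩ₑ q ⊆ₑ q ∩ₑ i })) ∷
       submod (I ∩ P) (I ∩ R) I (P ∩ R) (incl (λ { (p ∷ q ∷ i ∷ p′ ∷ q′ ∷ []) → i ⊆ₑ (i ∩ₑ p) ∪ₑ (i ∩ₑ q) }))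
         (incl (λ { (p ∷ q ∷ i ∷ p′ ∷ q′ ∷ []) → p ∩ₑ q ⊆ₑ (i ∩ₑ p) ∩ₑ (i ∩ₑ q) })) ∷
       submod (P ∪ I) (P′ ∪ (R ∪ I)) (P ∪ R) P′
         (incl (λ { (p ∷ q ∷ i ∷ p′ ∷ q′ ∷ []) → p ∪ₑ q ⊆ₑ (p ∪ₑ i) ∪ₑ (p′ ∪ₑ (q ∪ₑ i)) }))
         (incl (λ { (p ∷ q ∷ i ∷ p′ ∷ q′ ∷ []) → p′ ⊆ₑ (p ∪ₑ i) ∩ₑ (p′ ∪ₑ (q ∪ₑ i)) })) ∷
       submod (R ∪ I) (P′ ∪ R′) (P′ ∪ (R ∪ I)) R′
         (incl (λ { (p ∷ q ∷ i ∷ p′ ∷ q′ ∷ []) → p′ ∪ₑ (q ∪ₑ i) ⊆ₑ (q ∪ₑ i) ∪ₑ (p′ ∪ₑ q′) }))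
         (incl (λ { (p ∷ q ∷ i ∷ p′ ∷ q′ ∷ []) → q′ ⊆ₑ (q ∪ₑ i) ∩ₑ (p′ ∪ₑ q′) })) ∷ [])
      where
      incl = decide-⊆-under (P ∷ R ∷ I ∷ P′ ∷ R′ ∷ [])
        (λ { (p ∷ q ∷ i ∷ p′ ∷ q′ ∷ []) → (p ∩ₑ q ⊆ₑ i) ∷ (i ⊆ₑ p ∪ₑ q) ∷ (i ⊆ₑ p′) ∷ (p′ ⊆ₑ p ∪ₑ i) ∷ (i ⊆ₑ q′) ∷
          (q′ ⊆ₑ q ∪ₑ i) ∷ [] })
        (h₁ ∷ h₂ ∷ h₃ ∷ h₄ ∷ h₅ ∷ h₆ ∷ [])

    -- Tutte's linking theorem, by induction on the set R of elements still to be contracted or deleted.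
    -- If neither option works for an element, uncrossing the two violating sets contradicts the hypothesis.
    module _ (S B : Subset n) (t : ℕ) where

      linked-at : Subset n → Subset n → Subset n → Set
      linked-at C R X = t + rk C + rk (S ∪ B ∪ R ∪ C) ≤ rk (S ∪ C ∪ (R ∩ X)) + rk (B ∪ C ∪ (R ∩ ∁ X))

      linking-step : ∀ C R x → x ∈ R → (∀ X → linked-at C R X) → ∀ X Y →
        ¬ linked-at C (R ∩ ∁ ⁅ x ⁆) X → ¬ linked-at (C ∪ ⁅ x ⁆) (R ∩ ∁ ⁅ x ⁆) Y → Empty.⊥
      linking-step C R x x∈R H X Y ¬X ¬Y = ≤⇒≯ contra (s≤s z≤n)
        where
        e = ⁅ x ⁆
        R′ = R ∩ ∁ e
        -- The failing sets X and Y split only `R′`. The union receives x and the intersection omits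
        -- it, so that both can be inserted into the hypothesis on all of `R`.
        Z₁ = X ∪ Y ∪ e
        Z₂ = (X ∩ Y) ∩ ∁ e
        incl = decide-⊆-under (S ∷ B ∷ C ∷ R ∷ X ∷ Y ∷ e ∷ [])
          (λ { (s ∷ b ∷ c ∷ q ∷ x ∷ y ∷ e ∷ []) → (e ⊆ₑ q) ∷ [] }) (x∈⇒⁅x⁆⊆ x∈R ∷ [])
        -- Each failed option contributes a slack of 1. Contracting x raises the rank of the
        -- contracted set by at most 1, so one unit of the two remains.
        contra : 1 ≤ 0
        contra = linear
          (t ∷ rk C ∷ rk (S ∪ B ∪ R ∪ C) ∷ rk (C ∪ e) ∷ rk (S ∪ B ∪ R′ ∪ C) ∷ rk (S ∪ B ∪ R′ ∪ (C ∪ e))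
           ∷ rk (S ∪ C ∪ (R ∩ Z₁)) ∷ rk (B ∪ C ∪ (R ∩ ∁ Z₁)) ∷ rk (S ∪ C ∪ (R ∩ Z₂)) ∷ rk (B ∪ C ∪ (R ∩ ∁ Z₂))
           ∷ rk (S ∪ C ∪ (R′ ∩ X)) ∷ rk (B ∪ C ∪ (R′ ∩ ∁ X))
           ∷ rk (S ∪ (C ∪ e) ∪ (R′ ∩ Y)) ∷ rk (B ∪ (C ∪ e) ∪ (R′ ∩ ∁ Y)) ∷ [])
          (λ { (t ∷ c ∷ sbrc ∷ ce ∷ sbr′c ∷ sbr′ce ∷ s₁ ∷ b₁ ∷ s₂ ∷ b₂ ∷ sx ∷ bx ∷ sy ∷ by ∷ []) →
            (1 , t +ₑ c +ₑ sbrc ≤ₑ s₁ +ₑ b₁) ∷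
            (1 , t +ₑ c +ₑ sbrc ≤ₑ s₂ +ₑ b₂) ∷
            (1 , con 1 +ₑ (sx +ₑ bx) ≤ₑ t +ₑ c +ₑ sbr′c) ∷
            (1 , con 1 +ₑ (sy +ₑ by) ≤ₑ t +ₑ ce +ₑ sbr′ce) ∷
            (1 , s₁ +ₑ s₂ ≤ₑ sx +ₑ sy) ∷
            (1 , b₂ +ₑ b₁ ≤ₑ bx +ₑ by) ∷
            (1 , ce ≤ₑ c +ₑ con 1) ∷ (1 , sbr′c ≤ₑ sbrc) ∷ (1 , sbr′ce ≤ₑ sbrc) ∷ [] ,
            con 1 ≤ₑ con 0 })
          (H Z₁ ∷ H Z₂ ∷ ≰⇒> ¬X ∷ ≰⇒> ¬Y ∷
           submod _ _ _ _
             (incl (λ { (s ∷ b ∷ c ∷ q ∷ x ∷ y ∷ e ∷ []) → s ∪ₑ c ∪ₑ (q ∩ₑ (x ∪ₑ y ∪ₑ e)) ⊆ₑ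
                (s ∪ₑ c ∪ₑ ((q ∩ₑ ∁ₑ e) ∩ₑ x)) ∪ₑ (s ∪ₑ (c ∪ₑ e) ∪ₑ ((q ∩ₑ ∁ₑ e) ∩ₑ y)) }))
             (incl (λ { (s ∷ b ∷ c ∷ q ∷ x ∷ y ∷ e ∷ []) → s ∪ₑ c ∪ₑ (q ∩ₑ ((x ∩ₑ y) ∩ₑ ∁ₑ e)) ⊆ₑ
                (s ∪ₑ c ∪ₑ ((q ∩ₑ ∁ₑ e) ∩ₑ x)) ∩ₑ (s ∪ₑ (c ∪ₑ e) ∪ₑ ((q ∩ₑ ∁ₑ e) ∩ₑ y)) })) ∷
           submod _ _ _ _
             (incl (λ { (s ∷ b ∷ c ∷ q ∷ x ∷ y ∷ e ∷ []) → b ∪ₑ c ∪ₑ (q ∩ₑ ∁ₑ ((x ∩ₑ y) ∩ₑ ∁ₑ e)) ⊆ₑ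
                (b ∪ₑ c ∪ₑ ((q ∩ₑ ∁ₑ e) ∩ₑ ∁ₑ x)) ∪ₑ (b ∪ₑ (c ∪ₑ e) ∪ₑ ((q ∩ₑ ∁ₑ e) ∩ₑ ∁ₑ y)) }))
             (incl (λ { (s ∷ b ∷ c ∷ q ∷ x ∷ y ∷ e ∷ []) → b ∪ₑ c ∪ₑ (q ∩ₑ ∁ₑ (x ∪ₑ y ∪ₑ e)) ⊆ₑ
                (b ∪ₑ c ∪ₑ ((q ∩ₑ ∁ₑ e) ∩ₑ ∁ₑ x)) ∩ₑ (b ∪ₑ (c ∪ₑ e) ∪ₑ ((q ∩ₑ ∁ₑ e) ∩ₑ ∁ₑ y)) })) ∷
           rk-∪⁅⁆-≤ C x ∷
           r-mono M (incl (λ { (s ∷ b ∷ c ∷ q ∷ x ∷ y ∷ e ∷ []) → s ∪ₑ b ∪ₑ (q ∩ₑ ∁ₑ e) ∪ₑ c ⊆ₑ s ∪ₑ b ∪ₑ q ∪ₑ c }))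
             ∷
           r-mono M (incl (λ { (s ∷ b ∷ c ∷ q ∷ x ∷ y ∷ e ∷ []) → s ∪ₑ b ∪ₑ (q ∩ₑ ∁ₑ e) ∪ₑ
             (c ∪ₑ e) ⊆ₑ s ∪ₑ b ∪ₑ q ∪ₑ c })) ∷ [])

      all-linked? : ∀ C R → (∀ X → linked-at C R X) ⊎ ∃ λ X → ¬ linked-at C R X
      all-linked? C R with anySubset? (λ X → ¬?
        (t + rk C + rk (S ∪ B ∪ R ∪ C) ≤? rk (S ∪ C ∪ (R ∩ X)) + rk (B ∪ C ∪ (R ∩ ∁ X))))
      ... | yes w = inj₂ w
      ... | no ¬w = inj₁ (λ X → decidable-stable (_ ≤? _) (λ ¬p → ¬w (X , ¬p)))

      linking-from : ∀ f C R → ∣ R ∣ ≤ f → (∀ X → linked-at C R X) →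
                 ∃ λ C′ → C′ ⊆ C ∪ R × t + rk C′ + rk (S ∪ B ∪ C′) ≤ rk (S ∪ C′) + rk (B ∪ C′)
      linking-from f C R ∣R∣≤f H with nonempty? R
      ... | no R-empty with refl ← Empty-unique R-empty = C , p⊆p∪q ⊥ , (begin
        t + rk C + rk (S ∪ B ∪ C) ≤⟨ +-monoʳ-≤ (t + rk C)
          (r-mono M (decide-⊆ (S ∷ B ∷ C ∷ []) (λ { (s ∷ b ∷ c ∷ []) → [] , s ∪ₑ b ∪ₑ c ⊆ₑ s ∪ₑ b ∪ₑ ⊥ₑ ∪ₑ c }) []))
          ⟩
        t + rk C + rk (S ∪ B ∪ ⊥ ∪ C) ≤⟨ H ⊥ ⟩
        rk (S ∪ C ∪ (⊥ ∩ ⊥)) + rk (B ∪ C ∪ (⊥ ∩ ∁ ⊥)) ≤⟨ +-mono-≤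
           (r-mono M (decide-⊆ (S ∷ B ∷ C ∷ []) (λ { (s ∷ b ∷ c ∷ []) → [] , s ∪ₑ c ∪ₑ (⊥ₑ ∩ₑ ⊥ₑ) ⊆ₑ s ∪ₑ c }) []))
           (r-mono M (decide-⊆ (S ∷ B ∷ C ∷ [])
             (λ { (s ∷ b ∷ c ∷ []) → [] , b ∪ₑ c ∪ₑ (⊥ₑ ∩ₑ ∁ₑ ⊥ₑ) ⊆ₑ b ∪ₑ c }) [])) ⟩
        rk (S ∪ C) + rk (B ∪ C) ∎)
        where open ≤-Reasoning
      linking-from zero C R ∣R∣≤f H | yes (x , x∈R) = Empty.⊥-elim (<⇒≱ (x∈p⇒∣p-x∣<∣p∣ x∈R) (≤-trans ∣R∣≤f z≤n))
      linking-from (suc f) C R ∣R∣≤f H | yes (x , x∈R)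
        with all-linked? C (R ∩ ∁ ⁅ x ⁆) | all-linked? (C ∪ ⁅ x ⁆) (R ∩ ∁ ⁅ x ⁆)
      ... | inj₁ H′ | _ = let C′ , C′⊆ , p = linking-from f C _ (remove-smaller x∈R ∣R∣≤f) H′ in
            C′ , ⊆-trans C′⊆ (decide-⊆ (C ∷ R ∷ ⁅ x ⁆ ∷ [])
              (λ { (c ∷ q ∷ e ∷ []) → [] , c ∪ₑ (q ∩ₑ ∁ₑ e) ⊆ₑ c ∪ₑ q }) []) , p
      ... | inj₂ _ | inj₁ H′ = let C′ , C′⊆ , p = linking-from f (C ∪ ⁅ x ⁆) _ (remove-smaller x∈R ∣R∣≤f) H′ in
            C′ , ⊆-trans C′⊆ (decide-⊆ (C ∷ R ∷ ⁅ x ⁆ ∷ [])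
              (λ { (c ∷ q ∷ e ∷ []) → (e ⊆ₑ q) ∷ [] , (c ∪ₑ e) ∪ₑ (q ∩ₑ ∁ₑ e) ⊆ₑ c ∪ₑ q }) (x∈⇒⁅x⁆⊆ x∈R ∷ [])) , p
      ... | inj₂ (X , ¬X) | inj₂ (Y , ¬Y) = Empty.⊥-elim (linking-step C R x x∈R H X Y ¬X ¬Y)

    -- The conclusion says, without subtraction, that S has connectivity at least t in the minor
    -- with C contracted and ground set `S ∪ ∁ T`. The induction starts with the whole of `T ∩ ∁ S`
    -- undecided, where `linked-at` for X is the hypothesis for `S ∪ (T ∩ X)`.
    linking : ∀ S T t → S ⊆ T → (∀ Z → S ⊆ Z → Z ⊆ T → t + rk ⊤ ≤ cut Z) →
              ∃ λ C → C ⊆ T × C ⊆ ∁ S × t + rk C + rk (S ∪ ∁ T ∪ C) ≤ rk (S ∪ C) + rk (∁ T ∪ C)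
    linking S T t S⊆T κ =
      let C , C⊆ , p = linking-from S (∁ T) t n ⊥ (T ∩ ∁ S) (∣p∣≤n (T ∩ ∁ S)) H in
      C , ⊆-trans C⊆ (decide-⊆ (S ∷ T ∷ []) (λ { (s ∷ t ∷ []) → [] , ⊥ₑ ∪ₑ (t ∩ₑ ∁ₑ s) ⊆ₑ t }) []) ,
      ⊆-trans C⊆ (decide-⊆ (S ∷ T ∷ []) (λ { (s ∷ t ∷ []) → [] , ⊥ₑ ∪ₑ (t ∩ₑ ∁ₑ s) ⊆ₑ ∁ₑ s }) []) , p
      where
      H : ∀ X → linked-at S (∁ T) t ⊥ (T ∩ ∁ S) X
      H X = linear
        (t ∷ rk ⊥ ∷ rk (S ∪ ∁ T ∪ (T ∩ ∁ S) ∪ ⊥) ∷ rk ⊤ ∷ rk (S ∪ ⊥ ∪ ((T ∩ ∁ S) ∩ X)) ∷ rk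
          (∁ T ∪ ⊥ ∪ ((T ∩ ∁ S) ∩ ∁ X))
          ∷ rk (S ∪ (T ∩ X)) ∷ rk (∁ (S ∪ (T ∩ X))) ∷ [])
        (λ { (t ∷ b ∷ u ∷ f ∷ p ∷ q ∷ p′ ∷ q′ ∷ []) →
          (1 , b ≤ₑ con 0) ∷ (1 , u ≤ₑ f) ∷ (1 , t +ₑ f ≤ₑ p′ +ₑ q′) ∷ (1 , p′ ≤ₑ p) ∷ (1 , q′ ≤ₑ q) ∷ [] ,
          t +ₑ b +ₑ u ≤ₑ p +ₑ q })
        (≤-reflexive rk-⊥ ∷ r-mono M (⊆-max _) ∷
         κ (S ∪ (T ∩ X)) (p⊆p∪q _) (decide-⊆ (S ∷ T ∷ X ∷ [])
           (λ { (s ∷ t ∷ x ∷ []) → (s ⊆ₑ t) ∷ [] , s ∪ₑ (t ∩ₑ x) ⊆ₑ t }) (S⊆T ∷ [])) ∷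
         r-mono M (decide-⊆ (S ∷ T ∷ X ∷ []) (λ { (s ∷ t ∷ x ∷ []) → [] , s ∪ₑ (t ∩ₑ x) ⊆ₑ s ∪ₑ ⊥ₑ ∪ₑ
           ((t ∩ₑ ∁ₑ s) ∩ₑ x) }) []) ∷
         r-mono M (decide-⊆ (S ∷ T ∷ X ∷ []) (λ { (s ∷ t ∷ x ∷ []) → [] , ∁ₑ (s ∪ₑ (t ∩ₑ x)) ⊆ₑ ∁ₑ t ∪ₑ ⊥ₑ ∪ₑ
           ((t ∩ₑ ∁ₑ s) ∩ₑ ∁ₑ x) }) []) ∷ [])

-- Counting subsets by injections

module Cardinality where

  open import Data.Bool using (true; false)
  open import Data.Fin using (Fin; zero; suc; combine; remQuot)
  open import Data.Fin.Properties using (suc-injective; injective⇒≤; any?; _≟_; combine-injective; combine-remQuot)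
  open import Data.Nat using (zero; suc; _*_; _≤_)
  open import Data.Nat.Properties using (<⇒≱)
  open import Data.Vec using (_∷_; here; there; tabulate)
  open import Data.Vec.Properties using (lookup∘tabulate; lookup⇒[]=; []=⇒lookup)
  open import Function using (_∘_)
  open import Relation.Binary.PropositionalEquality
  open import Relation.Nullary.Decidable using (dec-true)
  open import Relation.Unary using (Decidable)

  module _ {n} {P : Fin n → Set} (P? : Decidable P) where

    select : Subset n
    select = tabulate (λ x → does (P? x))

    ∈-select⁺ : ∀ {x} → P x → x ∈ select
    ∈-select⁺ {x} px = lookup⇒[]= x _ (trans (lookup∘tabulate _ x) (dec-true (P? x) px))

    ∈-select⁻ : ∀ {x} → x ∈ select → P x
    ∈-select⁻ {x} x∈ with P? x | trans (sym (lookup∘tabulate (λ x → does (P? x)) x)) ([]=⇒lookup x∈)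
    ... | yes px | _ = px

  enum : ∀ {n} (S : Subset n) → Fin ∣ S ∣ → Fin n
  enum (true ∷ S) zero = zero
  enum (true ∷ S) (suc i) = suc (enum S i)
  enum (false ∷ S) i = suc (enum S i)

  enum-∈ : ∀ {n} (S : Subset n) i → enum S i ∈ S
  enum-∈ (true ∷ S) zero = here
  enum-∈ (true ∷ S) (suc i) = there (enum-∈ S i)
  enum-∈ (false ∷ S) i = there (enum-∈ S i)

  enum-injective : ∀ {n} (S : Subset n) {i j} → enum S i ≡ enum S j → i ≡ j
  enum-injective (true ∷ S) {zero} {zero} eq = refl
  enum-injective (true ∷ S) {suc i} {suc j} eq = cong suc (enum-injective S (suc-injective eq))
  enum-injective (false ∷ S) eq = enum-injective S (suc-injective eq)

  index : ∀ {n} (S : Subset n) {x} → x ∈ S → Fin ∣ S ∣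
  index (true ∷ S) here = zero
  index (true ∷ S) (there p) = suc (index S p)
  index (false ∷ S) (there p) = index S p

  enum-index : ∀ {n} (S : Subset n) {x} (p : x ∈ S) → enum S (index S p) ≡ x
  enum-index (true ∷ S) here = refl
  enum-index (true ∷ S) (there p) = cong suc (enum-index S p)
  enum-index (false ∷ S) (there p) = cong suc (enum-index S p)

  index-enum : ∀ {n} (S : Subset n) i (p : enum S i ∈ S) → index S p ≡ i
  index-enum S i p = enum-injective S (enum-index S p)

  index-injective : ∀ {n} (S : Subset n) {x y} (p : x ∈ S) (p′ : y ∈ S) → index S p ≡ index S p′ → x ≡ y
  index-injective S p p′ eq = trans (sym (enum-index S p)) (trans (cong (enum S) eq) (enum-index S p′))

  module _ {n} (S : Subset n) where

    ≤-∣∣ : ∀ {a} (f : Fin a → Fin n) → (∀ i → f i ∈ S) → (∀ {i j} → f i ≡ f j → i ≡ j) → a ≤ ∣ S ∣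
    ≤-∣∣ f f∈ inj = injective⇒≤ {f = λ i → index S (f∈ i)} (λ eq → inj (index-injective S _ _ eq))

    ∣∣-≤ : ∀ {a} (f : ∀ x → x ∈ S → Fin a) → (∀ {x y} p p′ → f x p ≡ f y p′ → x ≡ y) → ∣ S ∣ ≤ a
    ∣∣-≤ f inj = injective⇒≤ {f = λ i → f _ (enum-∈ S i)} (λ eq → enum-injective S (inj _ _ eq))

    -- A missed element x could be added as one more value, which would give an injection of `suc a`
    -- elements into S.
    onto : ∀ {a} (f : Fin a → Fin n) → (∀ i → f i ∈ S) → (∀ {i j} → f i ≡ f j → i ≡ j) → ∣ S ∣ ≤ a →
           ∀ {x} → x ∈ S → ∃ λ i → f i ≡ x
    onto {a} f f∈ inj ∣S∣≤a {x} x∈S with any? (λ i → f i ≟ x)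
    ... | yes w = w
    ... | no ¬w = Empty.⊥-elim (<⇒≱ (≤-∣∣ g g∈ g-inj) ∣S∣≤a)
      where
      g : Fin (suc a) → Fin n
      g zero = x
      g (suc i) = f i
      g∈ : ∀ i → g i ∈ S
      g∈ zero = x∈S
      g∈ (suc i) = f∈ i
      g-inj : ∀ {i j} → g i ≡ g j → i ≡ j
      g-inj {zero} {zero} eq = refl
      g-inj {zero} {suc j} eq = Empty.⊥-elim (¬w (j , sym eq))
      g-inj {suc i} {zero} eq = Empty.⊥-elim (¬w (i , eq))
      g-inj {suc i} {suc j} eq = cong suc (inj eq)

  ⊆∧∣∣≥⇒⊇ : ∀ {n} {S T : Subset n} → S ⊆ T → ∣ T ∣ ≤ ∣ S ∣ → T ⊆ S
  ⊆∧∣∣≥⇒⊇ {S = S} S⊆T ∣T∣≤∣S∣ {x} x∈T with x ∈? S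
  ... | yes x∈S = x∈S
  ... | no x∉S = Empty.⊥-elim (<⇒≱ (p⊂q⇒∣p∣<∣q∣ (S⊆T , x , x∈T , x∉S)) ∣T∣≤∣S∣)

  -- Used in both directions for the modular law of spans, where two injections are easier to write
  -- down than one bijection. The map may depend on the membership proofs, because decompositions of
  -- vectors do.
  ∣×∣-≤ : ∀ {a b c d} (S : Subset a) (T : Subset b) (S′ : Subset c) (T′ : Subset d)
          (f : ∀ {x y} → x ∈ S → y ∈ T → Fin c × Fin d) →
          (∀ {x y} (p : x ∈ S) (p′ : y ∈ T) → proj₁ (f p p′) ∈ S′ × proj₂ (f p p′) ∈ T′) →
          (∀ {x y z w} (p : x ∈ S) (p′ : y ∈ T) (r : z ∈ S) (r′ : w ∈ T) → f p p′ ≡ f r r′ → x ≡ z × y ≡ w) →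
          ∣ S ∣ * ∣ T ∣ ≤ ∣ S′ ∣ * ∣ T′ ∣
  ∣×∣-≤ S T S′ T′ f f∈ inj = injective⇒≤ {f = g} g-inj
    where
    pair : Fin (∣ S ∣ * ∣ T ∣) → Fin ∣ S ∣ × Fin ∣ T ∣
    pair = remQuot ∣ T ∣
    F : ∀ i j → Fin _ × Fin _
    F i j = f (enum-∈ S i) (enum-∈ T j)
    F∈ : ∀ i j → proj₁ (F i j) ∈ S′ × proj₂ (F i j) ∈ T′
    F∈ i j = f∈ (enum-∈ S i) (enum-∈ T j)
    G : Fin ∣ S ∣ × Fin ∣ T ∣ → Fin (∣ S′ ∣ * ∣ T′ ∣)
    G (i , j) = combine (index S′ (proj₁ (F∈ i j))) (index T′ (proj₂ (F∈ i j)))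
    G-inj : ∀ x y → G x ≡ G y → x ≡ y
    G-inj (i , j) (k , l) eq with e₁ , e₂ ← combine-injective _ _ _ _ eq
      with e₃ , e₄ ← inj (enum-∈ S i) (enum-∈ T j) (enum-∈ S k) (enum-∈ T l)
        (cong₂ _,_ (index-injective S′ _ _ e₁) (index-injective T′ _ _ e₂)) =
      cong₂ _,_ (enum-injective S e₃) (enum-injective T e₄)
    g : Fin (∣ S ∣ * ∣ T ∣) → Fin (∣ S′ ∣ * ∣ T′ ∣)
    g = G ∘ pair
    g-inj : ∀ {i j} → g i ≡ g j → i ≡ j
    g-inj {i} {j} eq = trans (sym (combine-remQuot {∣ S ∣} ∣ T ∣ i))
      (trans (cong (λ (x , y) → combine x y) (G-inj (pair i) (pair j) eq)) (combine-remQuot {∣ S ∣} ∣ T ∣ j))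

-- Spans of columns over a finite field

module ColumnSpaces where

  open Solvers
  open RankFunctions
  open Cardinality
  open import Algebra.Bundles using (AbelianGroup)
  open import Algebra.Structures using (IsAbelianGroup)
  import Algebra.Properties.Ring as RingProperties
  open import Data.Bool using (true; false; if_then_else_)
  open import Data.Fin using (Fin; zero; suc; combine; funToFin; finToFun)
  open import Data.Fin.Properties using (suc-injective; any?; all?; _≟_; funToFin-finToFin; finToFun-funToFin)
  open import Data.Nat using (ℕ; zero; suc; _^_; _≤_; _<_)
  import Data.Nat as ℕ
  import Data.Nat.Properties as ℕ
  open import Data.Vec using ([]; _∷_; lookup)
  open import Data.Vec.Properties using (lookup⇒[]=; []=⇒lookup)
  open import Function using (_∘_)
  open import Relation.Binary.PropositionalEquality as ≡ using (_≡_; _≢_; refl; cong; cong₂)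

  -- All that the later argument knows of a representation: spans as subgroups of a finite abelian
  -- group, with the rank as exponent of `q`. Vectors are numbers in `Fin V` because field elements
  -- form only a setoid, whereas traces need decidable propositional equality.
  record SpanSystem {n} (M : Matroid n) (q : ℕ) : Set where
    infixl 6 _⊕_
    field
      V              : ℕ
      _⊕_            : Fin V → Fin V → Fin V
      𝟎              : Fin V
      ⊖_             : Fin V → Fin V
      isAbelianGroup : IsAbelianGroup _≡_ _⊕_ 𝟎 ⊖_
      ⟨_⟩            : Subset n → Subset V
      ⟨⟩-𝟎           : ∀ X → 𝟎 ∈ ⟨ X ⟩
      ⟨⟩-⊕           : ∀ X {x y} → x ∈ ⟨ X ⟩ → y ∈ ⟨ X ⟩ → x ⊕ y ∈ ⟨ X ⟩
      ⟨⟩-⊖           : ∀ X {x} → x ∈ ⟨ X ⟩ → ⊖ x ∈ ⟨ X ⟩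
      ⟨⟩-mono        : ∀ {X Y} → X ⊆ Y → ⟨ X ⟩ ⊆ ⟨ Y ⟩
      ⟨⟩-split       : ∀ X Y {z} → z ∈ ⟨ X ∪ Y ⟩ → ∃ λ x → ∃ λ y → x ∈ ⟨ X ⟩ × y ∈ ⟨ Y ⟩ × z ≡ x ⊕ y
      ∣⟨⟩∣           : ∀ X → ∣ ⟨ X ⟩ ∣ ≡ q ^ r M X

  funToFin-cong : ∀ {m n} {f g : Fin m → Fin n} → (∀ i → f i ≡ g i) → funToFin f ≡ funToFin g
  funToFin-cong {zero} eq = refl
  funToFin-cong {suc m} eq = cong₂ combine (eq zero) (funToFin-cong (eq ∘ suc))

  finToFun-injective : ∀ {m n} {k l : Fin (n ^ m)} → (∀ i → finToFun {n} {m} k i ≡ finToFun l i) → k ≡ l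
  finToFun-injective {m} {n} {k} {l} eq =
    ≡.trans (≡.sym (funToFin-finToFin {m} {n} k)) (≡.trans (funToFin-cong eq) (funToFin-finToFin {m} {n} l))

  lookup-∉ : ∀ {n} {x : Fin n} {X} → x ∉ X → lookup X x ≡ false
  lookup-∉ {x = x} {X} x∉X with lookup X x in eq
  ... | true = Empty.⊥-elim (x∉X (lookup⇒[]= x X eq))
  ... | false = refl

  module ColumnSpace {q} (F : FiniteField q) {m n} (A : Fin m → Fin n → FiniteField.Carrier F) where

    open FiniteField F hiding (zero) renaming (refl to ≈-refl; sym to ≈-sym; trans to ≈-trans)
    open RingProperties ring using (-‿distribˡ-*; -‿distribʳ-*; -1*x≈-x)
    open import Relation.Binary.Reasoning.Setoid setoid

    _≈?_ : ∀ x y → Dec (x ≈ y)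
    x ≈? y with enc x ≟ enc y
    ... | yes eq = yes (enc-inj eq)
    ... | no ¬eq = no (¬eq ∘ enc-cong)

    dec : Fin q → Carrier
    dec c = proj₁ (enc-onto c)

    enc-dec : ∀ c → enc (dec c) ≡ c
    enc-dec c = proj₂ (enc-onto c)

    module Coding (d : ℕ) where

      decode : Fin (q ^ d) → Fin d → Carrier
      decode x i = dec (finToFun x i)

      code : (Fin d → Carrier) → Fin (q ^ d)
      code v = funToFin (enc ∘ v)

      decode-code : ∀ v i → decode (code v) i ≈ v i
      decode-code v i = enc-inj (≡.trans (enc-dec _) (finToFun-funToFin (enc ∘ v) i))

      decode-injective : ∀ {x y} → (∀ i → decode x i ≈ decode y i) → x ≡ y
      decode-injective eq = finToFun-injective {d} {q} (λ i →
        ≡.trans (≡.sym (enc-dec _)) (≡.trans (enc-cong (eq i)) (enc-dec _)))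

      code-injective : ∀ {v w} → code v ≡ code w → ∀ i → v i ≈ w i
      code-injective {v} {w} eq i =
        ≈-trans (≈-sym (decode-code v i)) (≈-trans (reflexive (cong (λ z → decode z i) eq)) (decode-code w i))

    sum : ∀ {d} → (Fin d → Carrier) → Carrier
    sum = sumF F

    sum-cong : ∀ {d} {f g : Fin d → Carrier} → (∀ i → f i ≈ g i) → sum f ≈ sum g
    sum-cong {zero} eq = ≈-refl
    sum-cong {suc d} eq = +-cong (eq zero) (sum-cong (eq ∘ suc))

    sum-0 : ∀ {d} {f : Fin d → Carrier} → (∀ i → f i ≈ 0#) → sum f ≈ 0#
    sum-0 {zero} eq = ≈-refl
    sum-0 {suc d} eq = ≈-trans (+-cong (eq zero) (sum-0 (eq ∘ suc))) (+-identityˡ 0#)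

    +-interchange : ∀ a b c d → (a + b) + (c + d) ≈ (a + c) + (b + d)
    +-interchange a b c d = begin
      (a + b) + (c + d) ≈⟨ +-assoc a b (c + d) ⟩
      a + (b + (c + d)) ≈⟨ +-congˡ (+-assoc b c d) ⟨
      a + ((b + c) + d) ≈⟨ +-congˡ (+-congʳ (+-comm b c)) ⟩
      a + ((c + b) + d) ≈⟨ +-congˡ (+-assoc c b d) ⟩
      a + (c + (b + d)) ≈⟨ +-assoc a c (b + d) ⟨
      (a + c) + (b + d) ∎

    sum-+ : ∀ {d} (f g : Fin d → Carrier) → sum (λ i → f i + g i) ≈ sum f + sum g
    sum-+ {zero} f g = ≈-sym (+-identityˡ 0#)
    sum-+ {suc d} f g = ≈-trans (+-congˡ (sum-+ (f ∘ suc) (g ∘ suc))) (+-interchange _ _ _ _)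

    sum-* : ∀ {d} c (f : Fin d → Carrier) → sum (λ i → c * f i) ≈ c * sum f
    sum-* {zero} c f = ≈-sym (zeroʳ c)
    sum-* {suc d} c f = ≈-trans (+-congˡ (sum-* c (f ∘ suc))) (≈-sym (distribˡ c _ _))

    sum-single : ∀ {d} (f : Fin d → Carrier) e → (∀ i → i ≢ e → f i ≈ 0#) → sum f ≈ f e
    sum-single f zero eq = ≈-trans (+-congˡ (sum-0 (λ i → eq (suc i) λ ()))) (+-identityʳ _)
    sum-single f (suc e) eq = ≈-trans
      (+-cong (eq zero λ ()) (sum-single (f ∘ suc) e (λ i i≢e → eq (suc i) (i≢e ∘ suc-injective)))) (+-identityˡ _)

    term : Subset n → (Fin n → Carrier) → Fin m → Fin n → Carrier
    term X a i j = if lookup X j then a j * A i j else 0#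

    comb : Subset n → (Fin n → Carrier) → Fin m → Carrier
    comb X a i = sum (term X a i)

    term-∈ : ∀ {X j} a i → j ∈ X → term X a i j ≈ a j * A i j
    term-∈ a i j∈X rewrite []=⇒lookup j∈X = ≈-refl

    term-∉ : ∀ {X j} a i → j ∉ X → term X a i j ≈ 0#
    term-∉ a i j∉X rewrite lookup-∉ j∉X = ≈-refl

    comb-cong : ∀ X {a b} i → (∀ j → j ∈ X → a j ≈ b j) → comb X a i ≈ comb X b i
    comb-cong X {a} {b} i eq = sum-cong step
      where
      step : ∀ j → term X a i j ≈ term X b i j
      step j with j ∈? X
      ... | yes p = ≈-trans (term-∈ a i p) (≈-trans (*-congʳ (eq j p)) (≈-sym (term-∈ b i p)))
      ... | no p = ≈-trans (term-∉ a i p) (≈-sym (term-∉ b i p))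

    comb-+ : ∀ X a b i → comb X (λ j → a j + b j) i ≈ comb X a i + comb X b i
    comb-+ X a b i = ≈-trans (sum-cong step) (sum-+ (term X a i) (term X b i))
      where
      step : ∀ j → term X (λ j → a j + b j) i j ≈ term X a i j + term X b i j
      step j with lookup X j
      ... | true = distribʳ _ _ _
      ... | false = ≈-sym (+-identityˡ 0#)

    comb-* : ∀ X c a i → comb X (λ j → c * a j) i ≈ c * comb X a i
    comb-* X c a i = ≈-trans (sum-cong step) (sum-* c (term X a i))
      where
      step : ∀ j → term X (λ j → c * a j) i j ≈ c * term X a i j
      step j with lookup X j
      ... | true = *-assoc _ _ _
      ... | false = ≈-sym (zeroʳ c)

    restrict : Subset n → (Fin n → Carrier) → Fin n → Carrier
    restrict X a j = if lookup X j then a j else 0#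

    restrict-∈ : ∀ {X j} a → j ∈ X → restrict X a j ≈ a j
    restrict-∈ a j∈X rewrite []=⇒lookup j∈X = ≈-refl

    restrict-∉ : ∀ {X j} a → j ∉ X → restrict X a j ≈ 0#
    restrict-∉ a j∉X rewrite lookup-∉ j∉X = ≈-refl

    comb-restrict : ∀ {X Y} a i → X ⊆ Y → comb Y (restrict X a) i ≈ comb X a i
    comb-restrict {X} {Y} a i X⊆Y = sum-cong step
      where
      step : ∀ j → term Y (restrict X a) i j ≈ term X a i j
      step j with j ∈? X | j ∈? Y
      ... | yes p | yes p′ = ≈-trans (term-∈ (restrict X a) i p′)
        (≈-trans (*-congʳ (restrict-∈ a p)) (≈-sym (term-∈ a i p)))
      ... | yes p | no p′ = Empty.⊥-elim (p′ (X⊆Y p))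
      ... | no p | yes p′ = ≈-trans (term-∈ (restrict X a) i p′)
        (≈-trans (≈-trans (*-congʳ (restrict-∉ a p)) (zeroˡ _)) (≈-sym (term-∉ a i p)))
      ... | no p | no p′ = ≈-trans (term-∉ (restrict X a) i p′) (≈-sym (term-∉ a i p))

    comb-∪ : ∀ X Y a i → (∀ {j} → j ∈ X → j ∉ Y) → comb (X ∪ Y) a i ≈ comb X a i + comb Y a i
    comb-∪ X Y a i disj = ≈-trans (sum-cong step) (sum-+ (term X a i) (term Y a i))
      where
      step : ∀ j → term (X ∪ Y) a i j ≈ term X a i j + term Y a i j
      step j with j ∈? X | j ∈? Y
      ... | yes p | yes p′ = Empty.⊥-elim (disj p p′)
      ... | yes p | no p′ = ≈-trans (term-∈ a i (p⊆p∪q Y p))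
        (≈-sym (≈-trans (+-cong (term-∈ a i p) (term-∉ a i p′)) (+-identityʳ _)))
      ... | no p | yes p′ = ≈-trans (term-∈ a i (q⊆p∪q X Y p′))
        (≈-sym (≈-trans (+-cong (term-∉ a i p) (term-∈ a i p′)) (+-identityˡ _)))
      ... | no p | no p′ = ≈-trans (term-∉ a i (λ z → [_,_]′ p p′ (x∈p∪q⁻ X Y z)))
        (≈-sym (≈-trans (+-cong (term-∉ a i p) (term-∉ a i p′)) (+-identityˡ _)))

    comb-⁅⁆ : ∀ e a i → comb ⁅ e ⁆ a i ≈ a e * A i e
    comb-⁅⁆ e a i = ≈-trans (sum-single (term ⁅ e ⁆ a i) e (λ j j≢e → term-∉ a i (j≢e ∘ x∈⁅y⁆⇒x≡y e)))
      (term-∈ a i (x∈⁅x⁆ e))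

    record InSpan (X : Subset n) (v : Fin m → Carrier) : Set where
      constructor combination
      field
        coefficients : Fin n → Carrier
        expansion    : ∀ i → v i ≈ comb X coefficients i

    open InSpan

    inSpan-cong : ∀ {X v w} → (∀ i → v i ≈ w i) → InSpan X v → InSpan X w
    inSpan-cong eq (combination a p) = combination a λ i → ≈-trans (≈-sym (eq i)) (p i)

    inSpan-0 : ∀ X → InSpan X (λ _ → 0#)
    inSpan-0 X = combination (λ _ → 0#) λ i → ≈-sym (sum-0 (step i))
      where
      step : ∀ i j → term X (λ _ → 0#) i j ≈ 0#
      step i j with lookup X j
      ... | true = zeroˡ _
      ... | false = ≈-refl

    inSpan-+ : ∀ {X v w} → InSpan X v → InSpan X w → InSpan X (λ i → v i + w i)
    inSpan-+ {X} (combination a p) (combination b p′) = combination (λ j → a j + b j) λ i → ≈-trans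
      (+-cong (p i) (p′ i)) (≈-sym (comb-+ X a b i))

    inSpan-* : ∀ {X v} c → InSpan X v → InSpan X (λ i → c * v i)
    inSpan-* {X} c (combination a p) = combination (λ j → c * a j) λ i → ≈-trans (*-congˡ (p i))
      (≈-sym (comb-* X c a i))

    inSpan-sum : ∀ {X d} (t : Fin d → Fin m → Carrier) → (∀ j → InSpan X (t j)) → InSpan X (λ i → sum (λ j → t j i))
    inSpan-sum {X} {zero} t p = inSpan-0 X
    inSpan-sum {X} {suc d} t p = inSpan-+ (p zero) (inSpan-sum (t ∘ suc) (p ∘ suc))

    inSpan-mono : ∀ {X Y v} → X ⊆ Y → InSpan X v → InSpan Y v
    inSpan-mono {X} X⊆Y (combination a p) = combination (restrict X a) λ i → ≈-trans (p i)
      (≈-sym (comb-restrict a i X⊆Y))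

    column : Fin n → Fin m → Carrier
    column e i = A i e

    inSpan-column : ∀ {X e} → e ∈ X → InSpan X (column e)
    inSpan-column {X} {e} e∈X = inSpan-mono (x∈⇒⁅x⁆⊆ e∈X)
      (combination (λ _ → 1#) λ i → ≈-sym (≈-trans (comb-⁅⁆ e (λ _ → 1#) i) (*-identityˡ _)))

    inSpan-trans : ∀ {X Y v} → (∀ e → e ∈ X → InSpan Y (column e)) → InSpan X v → InSpan Y v
    inSpan-trans {X} {Y} cols (combination a p) = inSpan-cong (λ i → ≈-sym (p i))
      (inSpan-sum (λ j i → term X a i j) step)
      where
      step : ∀ j → InSpan Y (λ i → term X a i j)
      step j with j ∈? X
      ... | yes p = inSpan-cong (λ i → ≈-sym (term-∈ a i p)) (inSpan-* (a j) (cols j p))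
      ... | no p = inSpan-cong (λ i → ≈-sym (term-∉ a i p)) (inSpan-0 Y)

    module Coefficients = Coding n
    open Coding m

    -- Up to `≈` there are only `q ^ n` coefficient vectors, and all of them are tried.
    inSpan? : ∀ X v → Dec (InSpan X v)
    inSpan? X v with any? (λ k → all? (λ i → v i ≈? comb X (Coefficients.decode k) i))
    ... | yes (k , p) = yes (combination (Coefficients.decode k) p)
    ... | no ¬p = no λ (combination a p) → ¬p (Coefficients.code a , λ i →
      ≈-trans (p i) (comb-cong X i (λ j _ → ≈-sym (Coefficients.decode-code a j))))

    inSpan-independent : ∀ {Y} → IndependentCols F A Y → (a b : Fin n → Carrier) →
                         (∀ i → comb Y a i ≈ comb Y b i) → ∀ j → j ∈ Y → a j ≈ b j
    inSpan-independent {Y} ind a b eq j j∈Y = begin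
      a j ≈⟨ +-identityʳ _ ⟨
      a j + 0# ≈⟨ +-congˡ (-‿inverseˡ (b j)) ⟨
      a j + (- b j + b j) ≈⟨ +-assoc _ _ _ ⟨
      (a j + - b j) + b j ≈⟨ +-congʳ (+-congˡ (-1*x≈-x _)) ⟨
      (a j + - 1# * b j) + b j ≈⟨ +-congʳ (ind (λ j → a j + - 1# * b j) zeros j j∈Y) ⟩
      0# + b j ≈⟨ +-identityˡ _ ⟩
      b j ∎
      where
      zeros : ∀ i → comb Y (λ j → a j + - 1# * b j) i ≈ 0#
      zeros i = begin
        comb Y (λ j → a j + - 1# * b j) i ≈⟨ comb-+ Y a _ i ⟩
        comb Y a i + comb Y (λ j → - 1# * b j) i ≈⟨ +-cong (eq i) (comb-* Y (- 1#) b i) ⟩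
        comb Y b i + - 1# * comb Y b i ≈⟨ +-congˡ (-1*x≈-x _) ⟩
        comb Y b i + - comb Y b i ≈⟨ -‿inverseʳ _ ⟩
        0# ∎

    -- If column e were not spanned, a relation on `Y ∪ ⁅ e ⁆` could not have a nonzero coefficient
    -- at e, since it could be solved for that column. The set `Y ∪ ⁅ e ⁆` would then be a larger
    -- independent set.
    maximal-spans : ∀ {X Y} → Y ⊆ X → IndependentCols F A Y →
      (∀ Z → Z ⊆ X → IndependentCols F A Z → ∣ Z ∣ ≤ ∣ Y ∣) →
                    ∀ e → e ∈ X → InSpan Y (column e)
    maximal-spans {X} {Y} Y⊆X ind max e e∈X with inSpan? Y (column e)
    ... | yes p = p
    ... | no ¬p = Empty.⊥-elim (ℕ.<⇒≱ bigger (max (Y ∪ ⁅ e ⁆) Y∪e⊆X ind′))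
      where
      e∉Y : e ∉ Y
      e∉Y e∈Y = ¬p (inSpan-column e∈Y)
      bigger : ∣ Y ∣ < ∣ Y ∪ ⁅ e ⁆ ∣
      bigger = p⊂q⇒∣p∣<∣q∣ (p⊆p∪q _ , e , q⊆p∪q Y _ (x∈⁅x⁆ e) , e∉Y)
      Y∪e⊆X : Y ∪ ⁅ e ⁆ ⊆ X
      Y∪e⊆X = decide-⊆ (X ∷ Y ∷ ⁅ e ⁆ ∷ []) (λ { (x ∷ y ∷ e ∷ []) → (y ⊆ₑ x) ∷ (e ⊆ₑ x) ∷ [] , y ∪ₑ e ⊆ₑ x })
        (Y⊆X ∷ x∈⇒⁅x⁆⊆ e∈X ∷ [])
      disj : ∀ {j} → j ∈ Y → j ∉ ⁅ e ⁆
      disj j∈Y j∈e with refl ← x∈⁅y⁆⇒x≡y e j∈e = e∉Y j∈Y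
      ind′ : IndependentCols F A (Y ∪ ⁅ e ⁆)
      ind′ a eq j j∈ = case-∪ (x∈p∪q⁻ Y ⁅ e ⁆ j∈)
        where
        split : ∀ i → comb Y a i + a e * A i e ≈ 0#
        split i = ≈-trans (+-congˡ (≈-sym (comb-⁅⁆ e a i))) (≈-trans (≈-sym (comb-∪ Y ⁅ e ⁆ a i disj)) (eq i))
        ae≈0 : a e ≈ 0#
        ae≈0 with a e ≈? 0#
        ... | yes eq = eq
        ... | no ne = Empty.⊥-elim (¬p (inSpan-cong col (inSpan-* (- b) (combination a λ _ → ≈-refl))))
          where
          b = proj₁ (inv (a e) ne)
          col : ∀ i → - b * comb Y a i ≈ A i e
          col i = begin
            - b * comb Y a i ≈⟨ -‿distribˡ-* _ _ ⟨
            - (b * comb Y a i) ≈⟨ +-identityʳ _ ⟨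
            - (b * comb Y a i) + 0# ≈⟨ +-congˡ (≈-trans (*-congˡ (split i)) (zeroʳ b)) ⟨
            - (b * comb Y a i) + b * (comb Y a i + a e * A i e) ≈⟨ +-congˡ (distribˡ _ _ _) ⟩
            - (b * comb Y a i) + (b * comb Y a i + b * (a e * A i e)) ≈⟨ +-assoc _ _ _ ⟨
            (- (b * comb Y a i) + b * comb Y a i) + b * (a e * A i e) ≈⟨ +-cong (-‿inverseˡ _)
              (≈-sym (*-assoc _ _ _)) ⟩
            0# + (b * a e) * A i e ≈⟨ +-identityˡ _ ⟩
            (b * a e) * A i e ≈⟨ *-congʳ (≈-trans (*-comm _ _) (proj₂ (inv (a e) ne))) ⟩
            1# * A i e ≈⟨ *-identityˡ _ ⟩
            A i e ∎
        zeros : ∀ i → comb Y a i ≈ 0#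
        zeros i = ≈-trans (≈-sym (+-identityʳ _))
          (≈-trans (+-congˡ (≈-sym (≈-trans (*-congʳ ae≈0) (zeroˡ _)))) (split i))
        case-∪ : j ∈ Y ⊎ j ∈ ⁅ e ⁆ → a j ≈ 0#
        case-∪ (inj₁ j∈Y) = ind a zeros j j∈Y
        case-∪ (inj₂ j∈e) with refl ← x∈⁅y⁆⇒x≡y e j∈e = ae≈0

    extend : (Y : Subset n) → (Fin ∣ Y ∣ → Carrier) → Fin n → Carrier
    extend Y c j with j ∈? Y
    ... | yes p = c (index Y p)
    ... | no _ = 0#

    extend-enum : ∀ Y c k → extend Y c (enum Y k) ≈ c k
    extend-enum Y c k with enum Y k ∈? Y
    ... | yes p = reflexive (cong c (index-enum Y k p))
    ... | no p = Empty.⊥-elim (p (enum-∈ Y k))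

    span : Subset n → Subset (q ^ m)
    span X = select (λ x → inSpan? X (decode x))

    span⁺ : ∀ {X} v → InSpan X v → code v ∈ span X
    span⁺ {X} v p = ∈-select⁺ (λ x → inSpan? X (decode x)) (inSpan-cong (λ i → ≈-sym (decode-code v i)) p)

    span⁻ : ∀ {X x} → x ∈ span X → InSpan X (decode x)
    span⁻ {X} = ∈-select⁻ (λ x → inSpan? X (decode x))

    -- The coefficients on a maximal independent subset parametrise the span.
    ∣span∣ : ∀ {X ρ} → IsColRank F A X ρ → ∣ span X ∣ ≡ q ^ ρ
    ∣span∣ {X} ((Y , Y⊆X , ind , refl) , max) = ℕ.≤-antisym
      (∣∣-≤ (span X) coords coords-inj) (≤-∣∣ (span X) point point-∈ point-inj)
      where
      module C = Coding ∣ Y ∣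
      basis : ∀ {x} → x ∈ span X → InSpan Y (decode x)
      basis x∈ = inSpan-trans (maximal-spans Y⊆X ind max) (span⁻ x∈)
      coords : ∀ x → x ∈ span X → Fin (q ^ ∣ Y ∣)
      coords x x∈ = C.code (coefficients (basis x∈) ∘ enum Y)
      coords-inj : ∀ {x y} p p′ → coords x p ≡ coords y p′ → x ≡ y
      coords-inj {x} {y} p p′ eq = decode-injective (λ i → ≈-trans (expansion (basis p) i)
        (≈-trans (comb-cong Y i agree) (≈-sym (expansion (basis p′) i))))
        where
        agree : ∀ j → j ∈ Y → coefficients (basis p) j ≈ coefficients (basis p′) j
        agree j j∈Y = ≡.subst (λ j → coefficients (basis p) j ≈ coefficients (basis p′) j) (enum-index Y j∈Y)
          (C.code-injective eq (index Y j∈Y))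
      point : Fin (q ^ ∣ Y ∣) → Fin (q ^ m)
      point k = code (comb Y (extend Y (C.decode k)))
      point-∈ : ∀ k → point k ∈ span X
      point-∈ k = span⁺ _ (inSpan-mono Y⊆X (combination (extend Y (C.decode k)) λ _ → ≈-refl))
      point-inj : ∀ {k l} → point k ≡ point l → k ≡ l
      point-inj {k} {l} eq = C.decode-injective (λ i → ≈-trans (≈-sym (extend-enum Y _ i))
        (≈-trans (inSpan-independent ind _ _ (code-injective eq) (enum Y i) (enum-∈ Y i)) (extend-enum Y _ i)))

    private
      _⊕_ : Fin (q ^ m) → Fin (q ^ m) → Fin (q ^ m)
      x ⊕ y = code (λ i → decode x i + decode y i)
      𝟎 : Fin (q ^ m)
      𝟎 = code (λ _ → 0#)
      ⊖_ : Fin (q ^ m) → Fin (q ^ m)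
      ⊖ x = code (λ i → - decode x i)

      decode-⊕ : ∀ x y i → decode (x ⊕ y) i ≈ decode x i + decode y i
      decode-⊕ x y i = decode-code _ i

      isAbelianGroup′ : IsAbelianGroup _≡_ _⊕_ 𝟎 ⊖_
      isAbelianGroup′ = record
        { isGroup = record
          { isMonoid = record
            { isSemigroup = record
              { isMagma = record { isEquivalence = ≡.isEquivalence ; ∙-cong = cong₂ _⊕_ }
              ; assoc = λ x y z → decode-injective
                (λ i → ≈-trans (decode-⊕ (x ⊕ y) z i) (≈-trans (+-congʳ (decode-⊕ x y i))
                  (≈-trans (+-assoc _ _ _) (≈-sym (≈-trans (decode-⊕ x (y ⊕ z) i) (+-congˡ (decode-⊕ y z i)))))))
              }
            ; identity = idˡ , λ x → ≡.trans (comm⊕ x 𝟎) (idˡ x)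
            }
          ; inverse = invˡ , λ x → ≡.trans (comm⊕ x (⊖ x)) (invˡ x)
          ; ⁻¹-cong = cong ⊖_
          }
        ; comm = comm⊕
        }
        where
        comm⊕ : ∀ x y → x ⊕ y ≡ y ⊕ x
        comm⊕ x y = decode-injective (λ i → ≈-trans (decode-⊕ x y i)
          (≈-trans (+-comm _ _) (≈-sym (decode-⊕ y x i))))
        idˡ : ∀ x → 𝟎 ⊕ x ≡ x
        idˡ x = decode-injective (λ i → ≈-trans (decode-⊕ 𝟎 x i)
          (≈-trans (+-congʳ (decode-code _ i)) (+-identityˡ _)))
        invˡ : ∀ x → (⊖ x) ⊕ x ≡ 𝟎
        invˡ x = decode-injective (λ i → ≈-trans (decode-⊕ (⊖ x) x i) (≈-trans (+-congʳ (decode-code _ i))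
          (≈-trans (-‿inverseˡ _) (≈-sym (decode-code _ i)))))

      -- Elements of `X ∩ Y` are charged to X alone: the coefficients of the second summand are set
      -- to zero on X.
      span-split : ∀ X Y {z} → z ∈ span (X ∪ Y) → ∃ λ x → ∃ λ y → x ∈ span X × y ∈ span Y × z ≡ x ⊕ y
      span-split X Y {z} z∈ with combination a p ← span⁻ {X ∪ Y} z∈ =
        code (comb X a) , code (comb Y (restrict (∁ X) a)) , span⁺ {X} _ (combination a λ _ → ≈-refl) , span⁺ {Y} _
          (combination (restrict (∁ X) a) λ _ → ≈-refl) ,
        decode-injective (λ i → ≈-trans (p i) (≈-trans (eq i)
          (≈-sym (≈-trans (decode-⊕ (code (comb X a)) (code (comb Y (restrict (∁ X) a))) i)
          (+-cong (decode-code _ i) (decode-code _ i))))))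
        where
        step : ∀ i j → term (X ∪ Y) a i j ≈ term X a i j + term Y (restrict (∁ X) a) i j
        step i j with j ∈? X | j ∈? Y
        ... | yes u | yes w = ≈-trans (term-∈ a i (p⊆p∪q Y u)) (≈-sym (≈-trans
          (+-cong (term-∈ a i u) (≈-trans (term-∈ (restrict (∁ X) a) i w)
            (≈-trans (*-congʳ (restrict-∉ {∁ X} a (λ z → x∈∁p⇒x∉p z u))) (zeroˡ _)))) (+-identityʳ _)))
        ... | yes u | no w = ≈-trans (term-∈ a i (p⊆p∪q Y u))
          (≈-sym (≈-trans (+-cong (term-∈ a i u) (term-∉ (restrict (∁ X) a) i w)) (+-identityʳ _)))
        ... | no u | yes w = ≈-trans (term-∈ a i (q⊆p∪q X Y w)) (≈-sym (≈-trans
          (+-cong (term-∉ a i u) (≈-trans (term-∈ (restrict (∁ X) a) i w)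
            (*-congʳ (restrict-∈ {∁ X} a (x∉p⇒x∈∁p u))))) (+-identityˡ _)))
        ... | no u | no w = ≈-trans (term-∉ a i (λ z → [_,_]′ u w (x∈p∪q⁻ X Y z)))
          (≈-sym (≈-trans (+-cong (term-∉ a i u) (term-∉ (restrict (∁ X) a) i w)) (+-identityˡ _)))
        eq : ∀ i → comb (X ∪ Y) a i ≈ comb X a i + comb Y (restrict (∁ X) a) i
        eq i = ≈-trans (sum-cong (step i)) (sum-+ (term X a i) (term Y (restrict (∁ X) a) i))

    spanSystem : (M : Matroid n) → (∀ X → IsColRank F A X (r M X)) → SpanSystem M q
    spanSystem M rank = record
      { V = q ^ m
      ; _⊕_ = _⊕_
      ; 𝟎 = 𝟎
      ; ⊖_ = ⊖_
      ; isAbelianGroup = isAbelianGroup′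
      ; ⟨_⟩ = span
      ; ⟨⟩-𝟎 = λ X → span⁺ _ (inSpan-0 X)
      ; ⟨⟩-⊕ = λ X p p′ → span⁺ {X} _ (inSpan-+ (span⁻ p) (span⁻ p′))
      ; ⟨⟩-⊖ = λ X p → span⁺ {X} _ (inSpan-cong (λ i → -1*x≈-x _) (inSpan-* (- 1#) (span⁻ p)))
      ; ⟨⟩-mono = λ {X} {Y} X⊆Y p → ∈-select⁺ (λ x → inSpan? Y (decode x)) (inSpan-mono {X} {Y} X⊆Y (span⁻ p))
      ; ⟨⟩-split = span-split
      ; ∣⟨⟩∣ = λ X → ∣span∣ (rank X)
      }

open Solvers
open RankFunctions
open Cardinality
open ColumnSpaces
open import Algebra.Bundles using (AbelianGroup)
import Algebra.Properties.AbelianGroup as AbelianGroupProperties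
open import Data.Bool using (true; false)
open import Data.Bool.Properties using (T-≡) renaming (_≟_ to _≟ᵇ_)
open import Data.Fin as Fin using (Fin; suc; zero; toℕ; fromℕ<; inject≤; combine)
open import Data.Fin.Permutation as Perm using (Permutation′; permutation; _⟨$⟩ˡ_; _⟨$⟩ʳ_)
open import Data.Fin.Properties using (any?; toℕ<n; toℕ-injective; toℕ-fromℕ<; injective⇒≤; combine-injective;
  inject≤-injective; fromℕ<-injective; suc-injective; pigeonhole) renaming (_≟_ to _≟ᶠ_)
open import Data.List using (List; []; _∷_; _++_; length; map)
open import Data.List.Properties using (++-assoc; length-++; ++-conicalˡ; ++-conicalʳ; ++-identityʳ; map-id; map-∘)
open import Data.List.Relation.Unary.All as All using (All; []; _∷_)
import Data.List.Relation.Unary.All.Properties as All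
open import Data.List.Relation.Unary.All.Properties using (++⁺; ++⁻; ++⁻ˡ; ++⁻ʳ)
open import Data.List.Relation.Unary.AllPairs as AllPairs using (AllPairs; []; _∷_)
import Data.List.Relation.Unary.AllPairs.Properties as AllPairs
open import Data.Nat
open import Data.Nat.Properties hiding (suc-injective)
open import Data.Vec using ([]; _∷_; lookup)
open import Data.Vec.Properties using (≡-dec; lookup∘tabulate; lookup⇒[]=; []=⇒lookup)
open import Function using (_∘_; id; Equivalence)
open import Relation.Binary.PropositionalEquality
open import Relation.Nullary.Decidable using (_×-dec_)
open import Relation.Unary using (Decidable)

-- Boundary spaces

-- The summands chosen by `⟨⟩-split` depend on a membership proof. Irrelevance turns them into
-- functions of the vector, which the injectivity arguments below require.
∈-irrelevant : ∀ {n} {x : Fin n} {X} (p p′ : x ∈ X) → p ≡ p′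
∈-irrelevant here here = refl
∈-irrelevant (there p) (there p′) = cong there (∈-irrelevant p p′)

^-injectiveʳ : ∀ {q a b} → 1 < q → q ^ a ≡ q ^ b → a ≡ b
^-injectiveʳ {q} {a} {b} 1<q eq = ≤-antisym (≮⇒≥ λ b<a → <⇒≢ (^-monoʳ-< q 1<q b<a) (sym eq))
  (≮⇒≥ λ a<b → <⇒≢ (^-monoʳ-< q 1<q a<b) eq)

module Spans {n} {M : Matroid n} {q} (1<q : 1 < q) (Sp : SpanSystem M q) where

  open SpanSystem Sp public
  open Rank M public

  group : AbelianGroup _ _
  group = record { isAbelianGroup = isAbelianGroup }

  open AbelianGroup group using (assoc; comm; identityˡ; identityʳ; inverseˡ; inverseʳ)
  open AbelianGroupProperties group using (⁻¹-∙-comm; x∙y⁻¹≈ε⇒x≈y; ⁻¹-involutive; ∙-cancelˡ; ∙-cancelʳ)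

  infixl 6 _⊝_
  _⊝_ : Fin V → Fin V → Fin V
  x ⊝ y = x ⊕ ⊖ y

  open ≡-Reasoning

  ⊝-⊕ : ∀ x y → (x ⊝ y) ⊕ y ≡ x
  ⊝-⊕ x y = trans (assoc x (⊖ y) y) (trans (cong (x ⊕_) (inverseˡ y)) (identityʳ x))

  ⊕-⊝ : ∀ x y → (x ⊕ y) ⊝ y ≡ x
  ⊕-⊝ x y = trans (assoc x y (⊖ y)) (trans (cong (x ⊕_) (inverseʳ y)) (identityʳ x))

  ⊝-telescope : ∀ x y z → (x ⊝ y) ⊕ (y ⊝ z) ≡ x ⊝ z
  ⊝-telescope x y z = trans (sym (assoc (x ⊝ y) y (⊖ z))) (cong (_⊕ ⊖ z) (⊝-⊕ x y))

  ⊖-⊝ : ∀ x y → ⊖ (x ⊝ y) ≡ y ⊝ x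
  ⊖-⊝ x y = trans (sym (⁻¹-∙-comm x (⊖ y))) (trans (cong (⊖ x ⊕_) (⁻¹-involutive y)) (comm (⊖ x) y))

  ⟨⟩-⊝ : ∀ X {x y} → x ∈ ⟨ X ⟩ → y ∈ ⟨ X ⟩ → x ⊝ y ∈ ⟨ X ⟩
  ⟨⟩-⊝ X p p′ = ⟨⟩-⊕ X p (⟨⟩-⊖ X p′)

  ⟨⟩-∪ : ∀ X Y {x y} → x ∈ ⟨ X ⟩ → y ∈ ⟨ Y ⟩ → x ⊕ y ∈ ⟨ X ∪ Y ⟩
  ⟨⟩-∪ X Y p p′ = ⟨⟩-⊕ (X ∪ Y) (⟨⟩-mono (p⊆p∪q Y) p) (⟨⟩-mono (q⊆p∪q X Y) p′)

  module _ (X Y : Subset n) where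

    private
      left right : ∀ {z} → z ∈ ⟨ X ∪ Y ⟩ → Fin V
      left p = proj₁ (⟨⟩-split X Y p)
      right p = proj₁ (proj₂ (⟨⟩-split X Y p))

      left-∈ : ∀ {z} (p : z ∈ ⟨ X ∪ Y ⟩) → left p ∈ ⟨ X ⟩
      left-∈ p = proj₁ (proj₂ (proj₂ (⟨⟩-split X Y p)))

      right-∈ : ∀ {z} (p : z ∈ ⟨ X ∪ Y ⟩) → right p ∈ ⟨ Y ⟩
      right-∈ p = proj₁ (proj₂ (proj₂ (proj₂ (⟨⟩-split X Y p))))

      split-≡ : ∀ {z} (p : z ∈ ⟨ X ∪ Y ⟩) → z ≡ left p ⊕ right p
      split-≡ p = proj₂ (proj₂ (proj₂ (proj₂ (⟨⟩-split X Y p))))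

      left-cong : ∀ {z w} (p : z ∈ ⟨ X ∪ Y ⟩) (p′ : w ∈ ⟨ X ∪ Y ⟩) → z ≡ w → left p ≡ left p′
      left-cong p p′ refl = cong left (∈-irrelevant p p′)

      shift-sum : ∀ s t w → (s ⊕ w) ⊕ (t ⊝ w) ≡ s ⊕ t
      shift-sum s t w = begin
        (s ⊕ w) ⊕ (t ⊝ w) ≡⟨ assoc s w (t ⊝ w) ⟩
        s ⊕ (w ⊕ (t ⊝ w)) ≡⟨ cong (s ⊕_) (comm w (t ⊝ w)) ⟩
        s ⊕ ((t ⊝ w) ⊕ w) ≡⟨ cong (s ⊕_) (⊝-⊕ t w) ⟩
        s ⊕ t ∎

      exchange : ∀ s t s′ t′ → s ⊕ t ≡ s′ ⊕ t′ → s ⊝ s′ ≡ t′ ⊝ t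
      exchange s t s′ t′ eq = begin
        s ⊝ s′ ≡⟨ cong (_⊝ s′) (⊕-⊝ s t) ⟨
        (s ⊕ t) ⊝ t ⊝ s′ ≡⟨ cong (λ z → z ⊝ t ⊝ s′) eq ⟩
        (s′ ⊕ t′) ⊝ t ⊝ s′ ≡⟨ cong (λ z → z ⊝ t ⊝ s′) (comm s′ t′) ⟩
        (t′ ⊕ s′) ⊝ t ⊝ s′ ≡⟨ cong (_⊝ s′) (assoc t′ s′ (⊖ t)) ⟩
        t′ ⊕ (s′ ⊝ t) ⊝ s′ ≡⟨ cong (λ z → t′ ⊕ z ⊝ s′) (comm s′ (⊖ t)) ⟩
        t′ ⊕ (⊖ t ⊕ s′) ⊝ s′ ≡⟨ cong (_⊝ s′) (assoc t′ (⊖ t) s′) ⟨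
        (t′ ⊝ t) ⊕ s′ ⊝ s′ ≡⟨ ⊕-⊝ (t′ ⊝ t) s′ ⟩
        t′ ⊝ t ∎

    -- The decompositions of z as a sum over X and Y differ by a vector w of the intersection: the
    -- pair (w, z) is sent to the chosen decomposition shifted by w. Conversely (s, t) is sent to
    -- its deviation from the chosen decomposition of `s ⊕ t`, together with that sum.
    ∣∩∣*∣∪∣ : ∣ ⟨ X ⟩ ∩ ⟨ Y ⟩ ∣ * ∣ ⟨ X ∪ Y ⟩ ∣ ≡ ∣ ⟨ X ⟩ ∣ * ∣ ⟨ Y ⟩ ∣
    ∣∩∣*∣∪∣ = ≤-antisym
      (∣×∣-≤ (⟨ X ⟩ ∩ ⟨ Y ⟩) ⟨ X ∪ Y ⟩ ⟨ X ⟩ ⟨ Y ⟩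
        (λ {w} {z} w∈ z∈ → left z∈ ⊕ w , right z∈ ⊝ w)
        (λ w∈ z∈ → ⟨⟩-⊕ X (left-∈ z∈) (p∩q⊆p _ _ w∈) , ⟨⟩-⊝ Y (right-∈ z∈) (p∩q⊆q _ _ w∈))
        shift-injective)
      (∣×∣-≤ ⟨ X ⟩ ⟨ Y ⟩ (⟨ X ⟩ ∩ ⟨ Y ⟩) ⟨ X ∪ Y ⟩
        (λ {s} {t} s∈ t∈ → s ⊝ left (⟨⟩-∪ X Y s∈ t∈) , s ⊕ t)
        (λ {s} {t} s∈ t∈ → let z∈ = ⟨⟩-∪ X Y s∈ t∈ in
          x∈p∩q⁺ (⟨⟩-⊝ X s∈ (left-∈ z∈) ,
                  subst (_∈ ⟨ Y ⟩) (sym (exchange s t (left z∈) (right z∈) (split-≡ z∈))) (⟨⟩-⊝ Y (right-∈ z∈) t∈))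
                    , z∈)
        difference-injective)
      where
      shift-injective : ∀ {w z w′ z′} (w∈ : w ∈ ⟨ X ⟩ ∩ ⟨ Y ⟩) (z∈ : z ∈ ⟨ X ∪ Y ⟩) (w′∈ : w′ ∈ ⟨ X ⟩ ∩ ⟨ Y ⟩)
        (z′∈ : z′ ∈ ⟨ X ∪ Y ⟩) →
             (left z∈ ⊕ w , right z∈ ⊝ w) ≡ (left z′∈ ⊕ w′ , right z′∈ ⊝ w′) → w ≡ w′ × z ≡ z′
      shift-injective {w} {z} {w′} {z′} w∈ z∈ w′∈ z′∈ eq = ∙-cancelˡ (left z∈) w w′
        (trans (cong proj₁ eq) (cong (_⊕ w′) (left-cong z′∈ z∈ (sym z≡z′)))) , z≡z′
        where
        z≡z′ : z ≡ z′
        z≡z′ = begin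
          z ≡⟨ split-≡ z∈ ⟩
          left z∈ ⊕ right z∈ ≡⟨ shift-sum (left z∈) (right z∈) w ⟨
          (left z∈ ⊕ w) ⊕ (right z∈ ⊝ w) ≡⟨ cong (λ (x , y) → x ⊕ y) eq ⟩
          (left z′∈ ⊕ w′) ⊕ (right z′∈ ⊝ w′) ≡⟨ shift-sum (left z′∈) (right z′∈) w′ ⟩
          left z′∈ ⊕ right z′∈ ≡⟨ split-≡ z′∈ ⟨
          z′ ∎
      difference-injective : ∀ {s t s′ t′} (s∈ : s ∈ ⟨ X ⟩) (t∈ : t ∈ ⟨ Y ⟩) (s′∈ : s′ ∈ ⟨ X ⟩) (t′∈ : t′ ∈ ⟨ Y ⟩) →
             (s ⊝ left (⟨⟩-∪ X Y s∈ t∈) , s ⊕ t) ≡ (s′ ⊝ left (⟨⟩-∪ X Y s′∈ t′∈) , s′ ⊕ t′) → s ≡ s′ × t ≡ t′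
      difference-injective {s} {t} {s′} {t′} s∈ t∈ s′∈ t′∈ eq = s≡s′ , ∙-cancelˡ s t t′
        (trans (cong proj₂ eq) (cong (_⊕ t′) (sym s≡s′)))
        where
        s≡s′ : s ≡ s′
        s≡s′ = ∙-cancelʳ (⊖ left (⟨⟩-∪ X Y s∈ t∈)) s s′ (trans (cong proj₁ eq)
          (cong (s′ ⊝_) (left-cong (⟨⟩-∪ X Y s′∈ t′∈) (⟨⟩-∪ X Y s∈ t∈) (sym (cong proj₂ eq)))))

    abstract
      -- This d is the dimension of the intersection. It is read off from the product formula by
      -- cancelling a power of `q`, so no basis of the intersection is constructed.
      ∣∩∣ : ∃ λ d → ∣ ⟨ X ⟩ ∩ ⟨ Y ⟩ ∣ ≡ q ^ d × d + rk (X ∪ Y) ≡ rk X + rk Y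
      ∣∩∣ = d , *-cancelʳ-≡ _ _ (q ^ rk (X ∪ Y)) {{>-nonZero (m^n>0 q {{q≢0}} (rk (X ∪ Y)))}} (begin
          ∣ ⟨ X ⟩ ∩ ⟨ Y ⟩ ∣ * q ^ rk (X ∪ Y) ≡⟨ cong (∣ ⟨ X ⟩ ∩ ⟨ Y ⟩ ∣ *_) (∣⟨⟩∣ (X ∪ Y)) ⟨
          ∣ ⟨ X ⟩ ∩ ⟨ Y ⟩ ∣ * ∣ ⟨ X ∪ Y ⟩ ∣ ≡⟨ ∣∩∣*∣∪∣ ⟩
          ∣ ⟨ X ⟩ ∣ * ∣ ⟨ Y ⟩ ∣ ≡⟨ cong₂ _*_ (∣⟨⟩∣ X) (∣⟨⟩∣ Y) ⟩
          q ^ rk X * q ^ rk Y ≡⟨ ^-distribˡ-+-* q (rk X) (rk Y) ⟨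
          q ^ (rk X + rk Y) ≡⟨ cong (q ^_) d-eq ⟨
          q ^ (d + rk (X ∪ Y)) ≡⟨ ^-distribˡ-+-* q d (rk (X ∪ Y)) ⟩
          q ^ d * q ^ rk (X ∪ Y) ∎) , d-eq
        where
        q≢0 : NonZero q
        q≢0 = >-nonZero (<-trans (s≤s z≤n) 1<q)
        d : ℕ
        d = rk X + rk Y ∸ rk (X ∪ Y)
        d-eq : d + rk (X ∪ Y) ≡ rk X + rk Y
        d-eq = m∸n+n≡m (≤-trans (m≤m+n (rk (X ∪ Y)) (rk (X ∩ Y))) (r-submod M X Y))

    ∩-trivial : rk X + rk Y ≤ rk (X ∪ Y) → ∀ {x} → x ∈ ⟨ X ⟩ → x ∈ ⟨ Y ⟩ → x ≡ 𝟎
    ∩-trivial p {x} x∈X x∈Y = x∈⁅y⁆⇒x≡y 𝟎 (⊆∧∣∣≥⇒⊇ 𝟎⊆ (≤-reflexive card≡1) (x∈p∩q⁺ (x∈X , x∈Y)))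
      where
      d = proj₁ ∣∩∣
      d≡0 : d ≡ 0
      d≡0 = n≤0⇒n≡0 (+-cancelʳ-≤ (rk (X ∪ Y)) d 0 (≤-trans (≤-reflexive (proj₂ (proj₂ ∣∩∣))) p))
      card≡1 : ∣ ⟨ X ⟩ ∩ ⟨ Y ⟩ ∣ ≡ ∣ ⁅ 𝟎 ⁆ ∣
      card≡1 = trans (proj₁ (proj₂ ∣∩∣)) (trans (cong (q ^_) d≡0) (sym (∣⁅x⁆∣≡1 𝟎)))
      𝟎⊆ : ⁅ 𝟎 ⁆ ⊆ ⟨ X ⟩ ∩ ⟨ Y ⟩
      𝟎⊆ = x∈⇒⁅x⁆⊆ (x∈p∩q⁺ (⟨⟩-𝟎 X , ⟨⟩-𝟎 Y))

  boundary : Subset n → Subset V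
  boundary A = ⟨ A ⟩ ∩ ⟨ ∁ A ⟩

  ∣boundary∣ : ∀ A {t} → cut A ≡ t + rk ⊤ → ∣ boundary A ∣ ≡ q ^ t
  ∣boundary∣ A {t} eq with d , card , d-eq ← ∣∩∣ A (∁ A) =
    trans card (cong (q ^_) (+-cancelʳ-≡ (rk ⊤) d t
      (trans (cong (λ z → d + rk z) (sym (p∪∁p≡⊤ A))) (trans d-eq eq))))

  -- A and B = ∁ A′ are the two sides of the minor M / C \ (A′ ∖ A ∖ C) in which they are joined
  -- with the same connectivity t that A and A′ have in M.
  record Linked (A A′ C : Subset n) (t : ℕ) : Set where
    field
      A⊆A′    : A ⊆ A′
      C⊆A′    : C ⊆ A′
      C⊆∁A    : C ⊆ ∁ A
      cut-A   : cut A ≡ t + rk ⊤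
      cut-A′  : cut A′ ≡ t + rk ⊤
      linkage : t + rk C + rk (A ∪ ∁ A′ ∪ C) ≤ rk (A ∪ C) + rk (∁ A′ ∪ C)

    B : Subset n
    B = ∁ A′

    private
      sets = A ∷ A′ ∷ C ∷ []
      incl = decide-⊆-under sets (λ { (a ∷ a′ ∷ c ∷ []) → (a ⊆ₑ a′) ∷ (c ⊆ₑ a′) ∷ (c ⊆ₑ ∁ₑ a) ∷ [] })
        (A⊆A′ ∷ C⊆A′ ∷ C⊆∁A ∷ [])

    -- Contraction of a set that is not skew to A would reduce the connectivity of A. By `linkage`
    -- the minor still has connectivity at least t, and in M it was exactly t, which leaves no room
    -- for a loss.
    A-skew-C : rk A + rk C ≤ rk (A ∪ C)
    A-skew-C = linear (t ∷ rk A ∷ rk (∁ A) ∷ rk C ∷ rk (A ∪ B ∪ C) ∷ rk (A ∪ C) ∷ rk (B ∪ C) ∷ rk ⊤ ∷ [])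
      (λ { (t ∷ a ∷ a′ ∷ c ∷ abc ∷ ac ∷ bc ∷ e ∷ []) →
        (1 , t +ₑ c +ₑ abc ≤ₑ ac +ₑ bc) ∷ (1 , e +ₑ bc ≤ₑ a′ +ₑ abc) ∷ (1 , a +ₑ a′ ≤ₑ t +ₑ e) ∷ [] ,
          a +ₑ c ≤ₑ ac })
      (linkage ∷ submod (∁ A) (A ∪ B ∪ C) ⊤ (B ∪ C)
        (incl (λ { (a ∷ a′ ∷ c ∷ []) → ⊤ₑ ⊆ₑ ∁ₑ a ∪ₑ (a ∪ₑ ∁ₑ a′ ∪ₑ c) }))
        (incl (λ { (a ∷ a′ ∷ c ∷ []) → ∁ₑ a′ ∪ₑ c ⊆ₑ ∁ₑ a ∩ₑ (a ∪ₑ ∁ₑ a′ ∪ₑ c) }))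
       ∷ ≤-reflexive cut-A ∷ [])

    B-skew-C : rk B + rk C ≤ rk (B ∪ C)
    B-skew-C = linear (t ∷ rk A′ ∷ rk B ∷ rk C ∷ rk (A ∪ B ∪ C) ∷ rk (A ∪ C) ∷ rk (B ∪ C) ∷ rk ⊤ ∷ [])
      (λ { (t ∷ a′ ∷ b ∷ c ∷ abc ∷ ac ∷ bc ∷ e ∷ []) →
        (1 , t +ₑ c +ₑ abc ≤ₑ ac +ₑ bc) ∷ (1 , e +ₑ ac ≤ₑ a′ +ₑ abc) ∷ (1 , a′ +ₑ b ≤ₑ t +ₑ e) ∷ [] ,
          b +ₑ c ≤ₑ bc })
      (linkage ∷ submod A′ (A ∪ B ∪ C) ⊤ (A ∪ C)
        (incl (λ { (a ∷ a′ ∷ c ∷ []) → ⊤ₑ ⊆ₑ a′ ∪ₑ (a ∪ₑ ∁ₑ a′ ∪ₑ c) }))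
        (incl (λ { (a ∷ a′ ∷ c ∷ []) → a ∪ₑ c ⊆ₑ a′ ∩ₑ (a ∪ₑ ∁ₑ a′ ∪ₑ c) }))
       ∷ ≤-reflexive cut-A′ ∷ [])

    C⊆ : B ∪ C ⊆ ∁ A
    C⊆ = incl (λ { (a ∷ a′ ∷ c ∷ []) → ∁ₑ a′ ∪ₑ c ⊆ₑ ∁ₑ a })

    -- The right-hand space is contained in the boundary, and by `linkage` its dimension is at least
    -- t, the dimension of the boundary. Hence the two coincide.
    boundary⊆ : boundary A ⊆ ⟨ A ⟩ ∩ ⟨ B ∪ C ⟩
    boundary⊆ with d , card , d-eq ← ∣∩∣ A (B ∪ C) =
      ⊆∧∣∣≥⇒⊇ (λ x∈ → x∈p∩q⁺ (p∩q⊆p _ _ x∈ , ⟨⟩-mono C⊆ (p∩q⊆q _ _ x∈)))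
        (≤-trans (≤-reflexive (∣boundary∣ A cut-A))
          (≤-trans (^-monoʳ-≤ q {{>-nonZero (<-trans (s≤s z≤n) 1<q)}} t≤d) (≤-reflexive (sym card))))
      where
      t≤d : t ≤ d
      t≤d = linear (t ∷ d ∷ rk A ∷ rk C ∷ rk (A ∪ B ∪ C) ∷ rk (A ∪ C) ∷ rk (B ∪ C) ∷ rk (A ∩ C) ∷ [])
        (λ { (t ∷ d ∷ a ∷ c ∷ abc ∷ ac ∷ bc ∷ a∩c ∷ []) →
          (1 , t +ₑ c +ₑ abc ≤ₑ ac +ₑ bc) ∷ (1 , ac +ₑ a∩c ≤ₑ a +ₑ c) ∷ (1 , a +ₑ bc ≤ₑ d +ₑ abc) ∷ [] , t ≤ₑ d })
        (linkage ∷ r-submod M A C ∷ ≤-reflexive (sym d-eq) ∷ [])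

    -- Split u over `B ∪ C` and keep the part in ⟨ B ⟩. It equals u minus a vector of ⟨ C ⟩, so it
    -- also lies in ⟨ A′ ⟩ and is a boundary point of `A′`.
    transfer : ∀ {u} → u ∈ boundary A → ∃ λ u′ → u′ ∈ boundary A′ × u ⊝ u′ ∈ ⟨ C ⟩
    transfer {u} u∈ with u∈A , u∈BC ← x∈p∩q⁻ _ _ (boundary⊆ u∈)
      with b , c , b∈ , c∈ , eq ← ⟨⟩-split B C u∈BC =
      b , x∈p∩q⁺ (subst (_∈ ⟨ A′ ⟩) u⊝c≡b (⟨⟩-⊝ A′ (⟨⟩-mono A⊆A′ u∈A) (⟨⟩-mono C⊆A′ c∈)) , b∈) ,
      subst (_∈ ⟨ C ⟩) (sym (trans (cong (_⊝ b) (trans eq (comm b c))) (⊕-⊝ c b))) c∈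
      where
      u⊝c≡b : u ⊝ c ≡ b
      u⊝c≡b = trans (cong (_⊝ c) eq) (⊕-⊝ b c)

    unique-A : ∀ {x y} → x ∈ ⟨ A ⟩ → y ∈ ⟨ A ⟩ → x ⊝ y ∈ ⟨ C ⟩ → x ≡ y
    unique-A {x} {y} x∈ y∈ p = x∙y⁻¹≈ε⇒x≈y x y (∩-trivial A C A-skew-C (⟨⟩-⊝ A x∈ y∈) p)

    unique-B : ∀ {x y} → x ∈ ⟨ B ⟩ → y ∈ ⟨ B ⟩ → x ⊝ y ∈ ⟨ C ⟩ → x ≡ y
    unique-B {x} {y} x∈ y∈ p = x∙y⁻¹≈ε⇒x≈y x y (∩-trivial B C B-skew-C (⟨⟩-⊝ B x∈ y∈) p)

  -- The span of X is recorded in coordinates `Fin Q` instead of vectors, so that traces on the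
  -- boundaries of different sets can be intersected.
  trace : ∀ {Q} → (Fin Q → Fin V) → Subset n → Subset Q
  trace f X = select (λ v → f v ∈? ⟨ X ⟩)

  trace-mono : ∀ {Q} (f : Fin Q → Fin V) {X Y} → X ⊆ Y → trace f X ⊆ trace f Y
  trace-mono f {X} {Y} X⊆Y v∈ = ∈-select⁺ (λ v → f v ∈? ⟨ Y ⟩) (⟨⟩-mono X⊆Y (∈-select⁻ (λ v → f v ∈? ⟨ X ⟩) v∈))

  -- The connectivity of the minor is determined by the traces on the boundary.
  module _ {A A′ C t} (ℓ : Linked A A′ C t) {Q} (f f′ : Fin Q → Fin V)
           (f-inj : ∀ {v w} → f v ≡ f w → v ≡ w)
           (f-onto : ∀ {x} → x ∈ boundary A → ∃ λ v → f v ≡ x)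
           (f′-∈ : ∀ v → f′ v ∈ boundary A′)
           (f-f′ : ∀ v → f v ⊝ f′ v ∈ ⟨ C ⟩) where

    open Linked ℓ

    ∣trace∩trace∣ : ∀ X Y → X ⊆ A → Y ⊆ B →
      ∃ λ d → ∣ trace f X ∩ trace f′ Y ∣ ≡ q ^ d × d + rk (X ∪ (Y ∪ C)) ≡ rk X + rk Y + rk C
    ∣trace∩trace∣ X Y X⊆A Y⊆B with d , card , d-eq ← ∣∩∣ X (Y ∪ C) =
      d , trans same-size card , trans d-eq (trans (cong (rk X +_) rk-Y∪C) (sym (+-assoc (rk X) (rk Y) (rk C))))
      where
      rk-Y∪C : rk (Y ∪ C) ≡ rk Y + rk C
      rk-Y∪C = ≤-antisym (≤-trans (m≤m+n _ _) (r-submod M Y C))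
        (linear (rk Y ∷ rk B ∷ rk C ∷ rk (Y ∪ C) ∷ rk (B ∪ C) ∷ [])
          (λ { (y ∷ b ∷ c ∷ yc ∷ bc ∷ []) → (1 , b +ₑ c ≤ₑ bc) ∷ (1 , bc +ₑ y ≤ₑ b +ₑ yc) ∷ [] , y +ₑ c ≤ₑ yc })
          (B-skew-C ∷ submod B (Y ∪ C) (B ∪ C) Y
            (decide-⊆ (B ∷ Y ∷ C ∷ []) (λ { (b ∷ y ∷ c ∷ []) → [] , b ∪ₑ c ⊆ₑ b ∪ₑ (y ∪ₑ c) }) [])
            (decide-⊆ (B ∷ Y ∷ C ∷ []) (λ { (b ∷ y ∷ c ∷ []) → (y ⊆ₑ b) ∷ [] , y ⊆ₑ b ∩ₑ (y ∪ₑ c) }) (Y⊆B ∷ [])) ∷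
              []))
      T = trace f X ∩ trace f′ Y
      W = ⟨ X ⟩ ∩ ⟨ Y ∪ C ⟩
      f-∈ : ∀ v → v ∈ T → f v ∈ W
      f-∈ v v∈ with v∈₁ , v∈₂ ← x∈p∩q⁻ _ _ v∈ = x∈p∩q⁺
        (∈-select⁻ (λ v → f v ∈? ⟨ X ⟩) v∈₁ ,
         subst (_∈ ⟨ Y ∪ C ⟩) (trans (comm (f′ v) _) (⊝-⊕ (f v) (f′ v)))
           (⟨⟩-∪ Y C (∈-select⁻ (λ v → f′ v ∈? ⟨ Y ⟩) v∈₂) (f-f′ v)))
      pre : ∀ x → x ∈ W → ∃ λ v → f v ≡ x
      pre x x∈ with x∈₁ , x∈₂ ← x∈p∩q⁻ _ _ x∈ =
        f-onto (x∈p∩q⁺ (⟨⟩-mono X⊆A x∈₁ , ⟨⟩-mono C⊆ (⟨⟩-mono Y∪C⊆B∪C x∈₂)))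
        where
        Y∪C⊆B∪C : Y ∪ C ⊆ B ∪ C
        Y∪C⊆B∪C = decide-⊆ (B ∷ Y ∷ C ∷ []) (λ { (b ∷ y ∷ c ∷ []) → (y ⊆ₑ b) ∷ [] , y ∪ₑ c ⊆ₑ b ∪ₑ c }) (Y⊆B ∷ [])
      -- Splitting x over `Y ∪ C` might produce a vector of ⟨ B ⟩ other than `f′ v`. Both are
      -- congruent to x modulo ⟨ C ⟩, and B is skew to C, so they agree.
      pre-∈ : ∀ x (x∈ : x ∈ W) → proj₁ (pre x x∈) ∈ T
      pre-∈ x x∈ with x∈₁ , x∈₂ ← x∈p∩q⁻ _ _ x∈ | v , refl ← pre x x∈
        with y , c , y∈ , c∈ , eq ← ⟨⟩-split Y C x∈₂ = x∈p∩q⁺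
        (∈-select⁺ (λ v → f v ∈? ⟨ X ⟩) x∈₁ ,
         ∈-select⁺ (λ v → f′ v ∈? ⟨ Y ⟩) (subst (_∈ ⟨ Y ⟩)
           (unique-B (⟨⟩-mono Y⊆B y∈) (p∩q⊆q _ _ (f′-∈ v)) y⊝f′v) y∈))
        where
        y⊝f′v : y ⊝ f′ v ∈ ⟨ C ⟩
        y⊝f′v = subst (_∈ ⟨ C ⟩) (trans (cong (_⊕ (f v ⊝ f′ v)) (trans (⊖-eq c (f v) y (trans eq (comm y c))) refl))
          (⊝-telescope y (f v) (f′ v)))
          (⟨⟩-⊕ C (⟨⟩-⊖ C c∈) (f-f′ v))
          where
          ⊖-eq : ∀ c x y → x ≡ c ⊕ y → ⊖ c ≡ y ⊝ x
          ⊖-eq c x y refl = trans (cong ⊖_ (sym (⊕-⊝ c y))) (⊖-⊝ (c ⊕ y) y)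
      same-size : ∣ T ∣ ≡ ∣ W ∣
      same-size = ≤-antisym
        (∣∣-≤ T (λ v v∈ → index W (f-∈ v v∈)) (λ p p′ eq → f-inj (index-injective W _ _ eq)))
        (∣∣-≤ W (λ x x∈ → index T (pre-∈ x x∈)) (λ p p′ eq →
          trans (sym (proj₂ (pre _ p))) (trans (cong f (index-injective T _ _ eq)) (proj₂ (pre _ p′)))))

-- Linked chains

-- The sequence may be stationary from N on; indexing it by ℕ avoids bounds in every statement. The
-- lower bound on `cut` refers to the outer interval from `A 0` to T, so it passes to every pair of
-- members.
record LinkedChain {n} (M : Matroid n) (t N : ℕ) : Set where
  open Rank M
  field
    A        : ℕ → Subset n
    T        : Subset n
    A-step   : ∀ j → A j ⊆ A (suc j)
    A-strict : ∀ {j} → j < N → A j ≢ A (suc j)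
    A⊆T      : ∀ j → A j ⊆ T
    A-cut    : ∀ j → cut (A j) ≡ t + rk ⊤
    linked   : ∀ Z → A 0 ⊆ Z → Z ⊆ T → t + rk ⊤ ≤ cut Z

  A-mono′ : ∀ {j m} → j ≤′ m → A j ⊆ A m
  A-mono′ ≤′-refl = ⊆-refl
  A-mono′ (≤′-step p) = ⊆-trans (A-mono′ p) (A-step _)

  A-mono : ∀ {j m} → j ≤ m → A j ⊆ A m
  A-mono p = A-mono′ (≤⇒≤′ p)

  abstract
    link : ∃ λ C → C ⊆ T × C ⊆ ∁ (A 0) × t + rk C + rk (A 0 ∪ ∁ T ∪ C) ≤ rk (A 0 ∪ C) + rk (∁ T ∪ C)
    link = linking (A 0) T t (A⊆T 0) linked

  contracted : Subset n
  contracted = proj₁ link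

  -- All pairs use parts of one contracted set. Contractions chosen separately for each pair would
  -- not be contained in a common one, and the transfers between the members of the chain would not
  -- compose.
  C : ℕ → ℕ → Subset n
  C j m = contracted ∩ A m ∩ ∁ (A j)

  -- The linked minor on `A 0` and `∁ T` is a minor of the one on `A j` and `∁ (A m)` with `C j m`
  -- contracted. By `minor-mono` the connectivity of the latter is at least as large.
  C-linkage : ∀ {j m} → j ≤ m → t + rk (C j m) + rk (A j ∪ ∁ (A m) ∪ C j m) ≤ rk (A j ∪ C j m) + rk
    (∁ (A m) ∪ C j m)
  C-linkage {j} {m} j≤m = linear
    (t ∷ rk K ∷ rk (A 0 ∪ ∁ T ∪ K) ∷ rk (A 0 ∪ K) ∷ rk (∁ T ∪ K) ∷ rk ((A 0 ∪ K) ∪ (∁ T ∪ K))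
      ∷ rk (C j m) ∷ rk P ∷ rk R ∷ rk (P ∩ R) ∷ rk (P ∪ R) ∷ rk (A j ∪ ∁ (A m) ∪ C j m) ∷ [])
    (λ { (t ∷ k ∷ abk ∷ ak ∷ bk ∷ u ∷ c ∷ p ∷ q ∷ p∩q ∷ p∪q ∷ abc ∷ []) →
      (1 , t +ₑ k +ₑ abk ≤ₑ ak +ₑ bk) ∷
      (1 , ak +ₑ bk +ₑ p∩q +ₑ p∪q ≤ₑ p +ₑ q +ₑ k +ₑ u) ∷
      (1 , u ≤ₑ abk) ∷ (1 , c ≤ₑ p∩q) ∷ (1 , abc ≤ₑ p∪q) ∷ [] ,
      t +ₑ c +ₑ abc ≤ₑ p +ₑ q })
    (proj₂ (proj₂ (proj₂ link)) ∷
     minor-mono P R K (A 0 ∪ K) (∁ T ∪ K)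
       (incl (λ { (k ∷ a₀ ∷ aj ∷ am ∷ t ∷ []) → (aj ∪ₑ c k aj am) ∩ₑ (∁ₑ am ∪ₑ c k aj am) ⊆ₑ k }))
       (incl (λ { (k ∷ a₀ ∷ aj ∷ am ∷ t ∷ []) → k ⊆ₑ (aj ∪ₑ c k aj am) ∪ₑ (∁ₑ am ∪ₑ c k aj am) }))
       (incl (λ { (k ∷ a₀ ∷ aj ∷ am ∷ t ∷ []) → k ⊆ₑ a₀ ∪ₑ k }))
       (incl (λ { (k ∷ a₀ ∷ aj ∷ am ∷ t ∷ []) → a₀ ∪ₑ k ⊆ₑ (aj ∪ₑ c k aj am) ∪ₑ k }))
       (incl (λ { (k ∷ a₀ ∷ aj ∷ am ∷ t ∷ []) → k ⊆ₑ ∁ₑ t ∪ₑ k }))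
       (incl (λ { (k ∷ a₀ ∷ aj ∷ am ∷ t ∷ []) → ∁ₑ t ∪ₑ k ⊆ₑ (∁ₑ am ∪ₑ c k aj am) ∪ₑ k })) ∷
     r-mono M (incl (λ { (k ∷ a₀ ∷ aj ∷ am ∷ t ∷ []) → (a₀ ∪ₑ k) ∪ₑ (∁ₑ t ∪ₑ k) ⊆ₑ a₀ ∪ₑ ∁ₑ t ∪ₑ k })) ∷
     r-mono M (incl (λ { (k ∷ a₀ ∷ aj ∷ am ∷ t ∷ []) → c k aj am ⊆ₑ (aj ∪ₑ c k aj am) ∩ₑ (∁ₑ am ∪ₑ c k aj am) })) ∷
     r-mono M (incl (λ { (k ∷ a₀ ∷ aj ∷ am ∷ t ∷ []) → aj ∪ₑ ∁ₑ am ∪ₑ c k aj am ⊆ₑ (aj ∪ₑ c k aj am) ∪ₑ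
       (∁ₑ am ∪ₑ c k aj am) })) ∷ [])
    where
    K = contracted
    P = A j ∪ C j m
    R = ∁ (A m) ∪ C j m
    c : ∀ {l} → (k aj am : SetSolver.Expr l) → SetSolver.Expr l
    c k aj am = k ∩ₑ am ∩ₑ ∁ₑ aj
    incl = decide-⊆-under (K ∷ A 0 ∷ A j ∷ A m ∷ T ∷ [])
      (λ { (k ∷ a₀ ∷ aj ∷ am ∷ t ∷ []) → (a₀ ⊆ₑ aj) ∷ (aj ⊆ₑ am) ∷ (am ⊆ₑ t) ∷ (k ⊆ₑ ∁ₑ a₀) ∷ [] })
      (A-mono z≤n ∷ A-mono j≤m ∷ A⊆T m ∷ proj₁ (proj₂ (proj₂ link)) ∷ [])

module Frames {n} {M : Matroid n} {q} (1<q : 1 < q) (Sp : SpanSystem M q) {t N} (ch : LinkedChain M t N) where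

  open LinkedChain ch public
  open Spans 1<q Sp
  open AbelianGroup group using (assoc; comm; identityˡ; identityʳ; inverseˡ; inverseʳ)

  pair : ∀ {j m} → j ≤ m → Linked (A j) (A m) (C j m) t
  pair {j} {m} j≤m = record
    { A⊆A′ = A-mono j≤m
    ; C⊆A′ = decide-⊆ (contracted ∷ A m ∷ A j ∷ []) (λ { (k ∷ am ∷ aj ∷ []) → [] , k ∩ₑ am ∩ₑ ∁ₑ aj ⊆ₑ am }) []
    ; C⊆∁A = decide-⊆ (contracted ∷ A m ∷ A j ∷ []) (λ { (k ∷ am ∷ aj ∷ []) → [] , k ∩ₑ am ∩ₑ ∁ₑ aj ⊆ₑ ∁ₑ aj }) []
    ; cut-A = A-cut j
    ; cut-A′ = A-cut m
    ; linkage = C-linkage j≤m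
    }

  Q : ℕ
  Q = ∣ boundary (A 0) ∣

  Q≡q^t : Q ≡ q ^ t
  Q≡q^t = ∣boundary∣ (A 0) (A-cut 0)

  base : Fin Q → Fin V
  base = enum (boundary (A 0))

  abstract
    -- The points of the boundary of `A 0` serve as coordinates; `frame j v` is the copy of the
    -- point v on the boundary of `A j`.
    frame : ℕ → Fin Q → Fin V
    frame j v = proj₁ (Linked.transfer (pair {0} {j} z≤n) (enum-∈ (boundary (A 0)) v))

    frame-∈ : ∀ j v → frame j v ∈ boundary (A j)
    frame-∈ j v = proj₁ (proj₂ (Linked.transfer (pair {0} {j} z≤n) (enum-∈ (boundary (A 0)) v)))

    base-frame : ∀ j v → base v ⊝ frame j v ∈ ⟨ C 0 j ⟩
    base-frame j v = proj₂ (proj₂ (Linked.transfer (pair {0} {j} z≤n) (enum-∈ (boundary (A 0)) v)))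

  frame-injective : ∀ j {v w} → frame j v ≡ frame j w → v ≡ w
  frame-injective j {v} {w} eq = enum-injective (boundary (A 0)) (Linked.unique-A (pair {0} {j} z≤n)
    (p∩q⊆p _ _ (enum-∈ (boundary (A 0)) v)) (p∩q⊆p _ _ (enum-∈ (boundary (A 0)) w))
    (subst (_∈ ⟨ C 0 j ⟩) (trans (cong ((base v ⊝ frame j v) ⊕_)
      (trans (⊖-⊝ (base w) (frame j w)) (cong (_⊝ base w) (sym eq))))
       (⊝-telescope (base v) (frame j v) (base w)))
      (⟨⟩-⊝ (C 0 j) (base-frame j v) (base-frame j w))))

  frame-onto : ∀ j {x} → x ∈ boundary (A j) → ∃ λ v → frame j v ≡ x
  frame-onto j = onto (boundary (A j)) (frame j) (frame-∈ j) (frame-injective j)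
    (≤-reflexive (trans (∣boundary∣ (A j) (A-cut j)) (sym Q≡q^t)))

  -- Going from 0 to m by way of j gives another copy u of the point v. Since `C 0 j` and `C j m`
  -- lie in `C 0 m`, it differs from `frame m v` by a vector of ⟨ C 0 m ⟩, and `unique-B` makes the
  -- two equal.
  frame-frame : ∀ {j m} → j ≤ m → ∀ v → frame j v ⊝ frame m v ∈ ⟨ C j m ⟩
  frame-frame {j} {m} j≤m v = subst (λ z → frame j v ⊝ z ∈ ⟨ C j m ⟩) (sym u≡frame) u-∈
    where
    transferred = Linked.transfer (pair j≤m) (frame-∈ j v)
    u : Fin V
    u = proj₁ transferred
    u-∈ : frame j v ⊝ u ∈ ⟨ C j m ⟩
    u-∈ = proj₂ (proj₂ transferred)
    C₀ⱼ⊆ : C 0 j ⊆ C 0 m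
    C₀ⱼ⊆ = decide-⊆ (contracted ∷ A 0 ∷ A j ∷ A m ∷ [])
      (λ { (k ∷ a₀ ∷ aj ∷ am ∷ []) → (aj ⊆ₑ am) ∷ [] , k ∩ₑ aj ∩ₑ ∁ₑ a₀ ⊆ₑ k ∩ₑ am ∩ₑ ∁ₑ a₀ }) (A-mono j≤m ∷ [])
    Cⱼₘ⊆ : C j m ⊆ C 0 m
    Cⱼₘ⊆ = decide-⊆ (contracted ∷ A 0 ∷ A j ∷ A m ∷ [])
      (λ { (k ∷ a₀ ∷ aj ∷ am ∷ []) → (a₀ ⊆ₑ aj) ∷ [] , k ∩ₑ am ∩ₑ ∁ₑ aj ⊆ₑ k ∩ₑ am ∩ₑ ∁ₑ a₀ }) (A-mono z≤n ∷ [])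
    base-u : base v ⊝ u ∈ ⟨ C 0 m ⟩
    base-u = subst (_∈ ⟨ C 0 m ⟩) (⊝-telescope (base v) (frame j v) u)
      (⟨⟩-⊕ (C 0 m) (⟨⟩-mono C₀ⱼ⊆ (base-frame j v)) (⟨⟩-mono Cⱼₘ⊆ u-∈))
    u≡frame : frame m v ≡ u
    u≡frame = Linked.unique-B (pair {0} {m} z≤n) (p∩q⊆q _ _ (frame-∈ m v)) (p∩q⊆q _ _ (proj₁ (proj₂ transferred)))
      (subst (_∈ ⟨ C 0 m ⟩) (trans (cong (_⊕ (base v ⊝ u)) (⊖-⊝ (base v) (frame m v)))
        (⊝-telescope (frame m v) (base v) u))
        (⟨⟩-⊕ (C 0 m) (⟨⟩-⊖ (C 0 m) (base-frame m v)) base-u))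

  L : ℕ → Subset n → Subset Q
  L j = trace (frame j)

  abstract
    ∣L∩L∣ : ∀ {j m} → j ≤ m → ∀ X Y → X ⊆ A j → Y ⊆ ∁ (A m) →
      ∃ λ d → ∣ L j X ∩ L m Y ∣ ≡ q ^ d × d + rk (X ∪ (Y ∪ C j m)) ≡ rk X + rk Y + rk (C j m)
    ∣L∩L∣ {j} {m} j≤m = ∣trace∩trace∣ (pair j≤m) (frame j) (frame m) (frame-injective j) (frame-onto j) (frame-∈ m)
      (frame-frame j≤m)

  L-mono : ∀ j {X Y} → X ⊆ Y → L j X ⊆ L j Y
  L-mono j = trace-mono (frame j)

  -- The two whole sides have full trace, so their common trace has all `q ^ t` points. The
  -- connectivity of the joined minor is therefore exactly t.
  rk-total : ∀ {j m} → j ≤ m → t + rk (A j ∪ (∁ (A m) ∪ C j m)) ≡ rk (A j) + rk (∁ (A m)) + rk (C j m)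
  rk-total {j} {m} j≤m = trans (cong (_+ rk (A j ∪ (∁ (A m) ∪ C j m))) (sym d≡t)) (proj₂ (proj₂ full))
    where
    full = ∣L∩L∣ j≤m (A j) (∁ (A m)) ⊆-refl ⊆-refl
    ⊤⊆ : ⊤ ⊆ L j (A j) ∩ L m (∁ (A m))
    ⊤⊆ {v} _ = x∈p∩q⁺ (∈-select⁺ (λ v → frame j v ∈? ⟨ A j ⟩) (p∩q⊆p _ _ (frame-∈ j v)) ,
                   ∈-select⁺ (λ v → frame m v ∈? ⟨ ∁ (A m) ⟩) (p∩q⊆q _ _ (frame-∈ m v)))
    d≡t : proj₁ full ≡ t
    d≡t = ^-injectiveʳ 1<q (trans (sym (proj₁ (proj₂ full)))
      (trans (cong ∣_∣ (⊆-antisym (⊆-max _) ⊤⊆)) (trans (∣⊤∣≡n Q) Q≡q^t)))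

-- Layouts and the extraction of a linked chain

_≟ˢ_ : ∀ {n} (X Y : Subset n) → Dec (X ≡ Y)
_≟ˢ_ = ≡-dec _≟ᵇ_

-- A step that adds nothing is allowed. This makes steps stable under intersection and union with a
-- fixed set; repetitions are removed only when a permutation is needed.
record Step {n} (X Y : Subset n) : Set where
  constructor step
  field
    grows      : X ⊆ Y
    new-unique : ∀ {x y} → x ∈ Y → x ∉ X → y ∈ Y → y ∉ X → x ≡ y

open Step public

step-∩ : ∀ {n} {X Y : Subset n} W → Step X Y → Step (X ∩ W) (Y ∩ W)
step-∩ {X = X} {Y} W (step g u) = step
  (λ x∈ → let x∈X , x∈W = x∈p∩q⁻ X W x∈ in x∈p∩q⁺ (g x∈X , x∈W))
  (λ x∈ x∉ y∈ y∉ → let x∈Y , x∈W = x∈p∩q⁻ Y W x∈ ; y∈Y , y∈W = x∈p∩q⁻ Y W y∈ in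
    u x∈Y (λ z → x∉ (x∈p∩q⁺ (z , x∈W))) y∈Y (λ z → y∉ (x∈p∩q⁺ (z , y∈W))))

step-∪ : ∀ {n} {X Y : Subset n} W → Step X Y → Step (X ∪ W) (Y ∪ W)
step-∪ {X = X} {Y} W (step g u) = step
  (λ x∈ → x∈p∪q⁺ (Data.Sum.map₁ g (x∈p∪q⁻ X W x∈)))
  (λ x∈ x∉ y∈ y∉ → u (old x∈ x∉) (x∉ ∘ p⊆p∪q W) (old y∈ y∉) (y∉ ∘ p⊆p∪q W))
  where
  old : ∀ {x} → x ∈ Y ∪ W → x ∉ X ∪ W → x ∈ Y
  old x∈ x∉ with x∈p∪q⁻ Y W x∈
  ... | inj₁ x∈Y = x∈Y
  ... | inj₂ x∈W = Empty.⊥-elim (x∉ (q⊆p∪q X W x∈W))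

∣∪⁅⁆∣≤ : ∀ {n} (X : Subset n) x → ∣ X ∪ ⁅ x ⁆ ∣ ≤ suc ∣ X ∣
∣∪⁅⁆∣≤ X x = ∣∣-≤ (X ∪ ⁅ x ⁆) f f-inj
  where
  f : ∀ y → y ∈ X ∪ ⁅ x ⁆ → Fin (suc ∣ X ∣)
  f y y∈ with y ∈? X
  ... | yes p = suc (index X p)
  ... | no _ = zero
  f-inj : ∀ {y z} p p′ → f y p ≡ f z p′ → y ≡ z
  f-inj {y} {z} p p′ eq with y ∈? X | z ∈? X
  f-inj {y} {z} p p′ eq | yes u | yes w = index-injective X u w (Data.Fin.Properties.suc-injective eq)
    where import Data.Fin.Properties
  f-inj {y} {z} p p′ eq | no u | no w with x∈p∪q⁻ X _ p | x∈p∪q⁻ X _ p′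
  ... | inj₁ y∈X | _ = Empty.⊥-elim (u y∈X)
  ... | inj₂ _ | inj₁ z∈X = Empty.⊥-elim (w z∈X)
  ... | inj₂ y∈x | inj₂ z∈x = trans (x∈⁅y⁆⇒x≡y x y∈x) (sym (x∈⁅y⁆⇒x≡y x z∈x))

step-size : ∀ {n} {X Y : Subset n} → Step X Y → ∣ Y ∣ ≤ suc ∣ X ∣
step-size {X = X} {Y} s with nonempty? (Y ∩ ∁ X)
... | no ¬new = ≤-trans (p⊆q⇒∣p∣≤∣q∣ Y⊆X) (n≤1+n _)
  where
  Y⊆X : Y ⊆ X
  Y⊆X {x} x∈Y with x ∈? X
  ... | yes p = p
  ... | no p = Empty.⊥-elim (¬new (x , x∈p∩q⁺ (x∈Y , x∉p⇒x∈∁p p)))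
... | yes (x , x∈) = ≤-trans (p⊆q⇒∣p∣≤∣q∣ Y⊆) (∣∪⁅⁆∣≤ X x)
  where
  Y⊆ : Y ⊆ X ∪ ⁅ x ⁆
  Y⊆ {y} y∈Y with y ∈? X
  ... | yes p = p⊆p∪q _ p
  ... | no p rewrite new-unique s y∈Y p (p∩q⊆p Y _ x∈) (x∈∁p⇒x∉p (p∩q⊆q Y _ x∈)) = q⊆p∪q X _ (x∈⁅x⁆ x)

infixr 5 _∷⟨_⟩_

-- A linear layout of Y ∖ X, recorded by its prefixes together with X; each entry of the chain may repeat.
data Chain {n} (P : Subset n → Set) : Subset n → Subset n → Set where
  [_]     : ∀ {X} → P X → Chain P X X
  _∷⟨_⟩_ : ∀ {X Y Z} → P X → Step X Y → Chain P Y Z → Chain P X Z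

chain-⊆ : ∀ {n} {P : Subset n → Set} {X Y} → Chain P X Y → X ⊆ Y
chain-⊆ [ _ ] = ⊆-refl
chain-⊆ (_ ∷⟨ s ⟩ c) = ⊆-trans (grows s) (chain-⊆ c)

chain-head : ∀ {n} {P : Subset n → Set} {X Y} → Chain P X Y → P X
chain-head [ p ] = p
chain-head (p ∷⟨ _ ⟩ _) = p

chain-map : ∀ {m n} {P : Subset m → Set} {P′ : Subset n → Set} (f : Subset m → Subset n) →
            (∀ {X Y} → Step X Y → Step (f X) (f Y)) → (∀ {X} → P X → P′ (f X)) → ∀ {X Y} → Chain P X Y → Chain P′
              (f X) (f Y)
chain-map f s g [ p ] = [ g p ]
chain-map f s g (p ∷⟨ t ⟩ c) = g p ∷⟨ s t ⟩ chain-map f s g c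

chain-bounds : ∀ {n} {P : Subset n → Set} {W X Y} → W ⊆ X → Chain P X Y → Chain (λ Z → P Z × W ⊆ Z × Z ⊆ Y) X Y
chain-bounds W⊆X [ p ] = [ p , W⊆X , ⊆-refl ]
chain-bounds W⊆X (p ∷⟨ s ⟩ c) = (p , W⊆X , ⊆-trans (grows s) (chain-⊆ c)) ∷⟨ s ⟩ chain-bounds
  (⊆-trans W⊆X (grows s)) c

drop-first : ∀ {n} {P : Subset n → Set} {X Y} → Chain P X Y → X ≡ Y ⊎ ∃ λ X′ → Step X X′ × X ≢ X′ × Chain P X′ Y
drop-first [ p ] = inj₁ refl
drop-first {X = X} (_∷⟨_⟩_ {Y = X′} p s c) with X ≟ˢ X′
... | yes refl = drop-first c
... | no ne = inj₂ (X′ , s , ne , c)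

drop-last : ∀ {n} {P : Subset n → Set} {X Y} → Chain P X Y → X ≡ Y ⊎ ∃ λ Y′ → Step Y′ Y × Y′ ≢ Y × Chain P X Y′
drop-last [ p ] = inj₁ refl
drop-last {X = X} {Y} (p ∷⟨ s ⟩ c) with drop-last c
... | inj₂ (Y′ , s′ , ne , c′) = inj₂ (Y′ , s′ , ne , p ∷⟨ s ⟩ c′)
... | inj₁ refl with X ≟ˢ Y
...   | yes eq = inj₁ eq
...   | no ne = inj₂ (X , s , ne , [ p ])

module Extraction {n} (M : Matroid n) (K N : ℕ) where

  open Rank M

  Narrow : Subset n → Set
  Narrow Z = cut Z ≤ K + rk ⊤

  -- The first argument s satisfies `K < s + t`, so it bounds the number of connectivities that are
  -- still possible; the second counts the further tight sets that are wanted. A gap between tight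
  -- sets that exceeds `longEnough s N` by 2 is long enough for the next level, even after its two
  -- end elements are removed. Shorter gaps are paid for by the summand with 3.
  longEnough : ℕ → ℕ → ℕ
  longEnough zero    _       = 0
  longEnough (suc s) zero    = longEnough s N + 3
  longEnough (suc s) (suc p) = (longEnough s N + 3) + longEnough (suc s) p

  Good : Set
  Good = ∃ λ t → t ≤ K × LinkedChain M t N

  module Level (t : ℕ) where

    Tight : Subset n → Set
    Tight Z = cut Z ≡ t + rk ⊤

    Bounded : Subset n → Subset n → Set
    Bounded S T = ∀ Z → S ⊆ Z → Z ⊆ T → t + rk ⊤ ≤ cut Z

    NoneInside : Subset n → Subset n → Set
    NoneInside S T = ∀ Z → S ⊆ Z → Z ⊆ T → Tight Z → Z ≡ S ⊎ Z ≡ T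

    record TightChain (p : ℕ) (S T : Subset n) : Set where
      field
        A        : ℕ → Subset n
        S⊆A₀     : S ⊆ A 0
        S≢A₀     : S ≢ A 0
        A-step   : ∀ j → A j ⊆ A (suc j)
        A-strict : ∀ {j} → j < p → A j ≢ A (suc j)
        A⊆T      : ∀ j → A j ⊆ T
        A-tight  : ∀ j → Tight (A j)

    open TightChain

    constant : ∀ {S T W} → S ⊆ W → S ≢ W → W ⊆ T → Tight W → TightChain 0 S T
    constant {W = W} S⊆W S≢W W⊆T tight = record
      { A = λ _ → W ; S⊆A₀ = S⊆W ; S≢A₀ = S≢W ; A-step = λ _ → ⊆-refl ; A-strict = λ ()
      ; A⊆T = λ _ → W⊆T ; A-tight = λ _ → tight }

    prepend : ∀ {p S T W} → S ⊆ W → S ≢ W → Tight W → TightChain p W T → TightChain (suc p) S T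
    prepend {p} {S} {T} {W} S⊆W S≢W tight c = record
      { A = A′ ; S⊆A₀ = S⊆W ; S≢A₀ = S≢W ; A-step = st ; A-strict = strict ; A⊆T = sub ; A-tight = ti }
      where
      A′ : ℕ → Subset n
      A′ zero = W
      A′ (suc j) = A c j
      st : ∀ j → A′ j ⊆ A′ (suc j)
      st zero = S⊆A₀ c
      st (suc j) = A-step c j
      strict : ∀ {j} → j < suc p → A′ j ≢ A′ (suc j)
      strict {zero} _ = S≢A₀ c
      strict {suc j} (s≤s j<p) = A-strict c j<p
      sub : ∀ j → A′ j ⊆ T
      sub zero = ⊆-trans (S⊆A₀ c) (A⊆T c 0)
      sub (suc j) = A⊆T c j
      ti : ∀ j → Tight (A′ j)
      ti zero = tight
      ti (suc j) = A-tight c j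

    Inside : Subset n → Subset n → Subset n → Set
    Inside S T Z = (S ⊆ Z × Z ⊆ T) × Tight Z × Z ≢ S × Z ≢ T

    inside? : ∀ S T Z → Dec (Inside S T Z)
    inside? S T Z = ((S ⊆? Z) ×-dec (Z ⊆? T)) ×-dec ((cut Z ≟ t + rk ⊤) ×-dec (¬? (Z ≟ˢ S) ×-dec ¬? (Z ≟ˢ T)))

    none-inside : ∀ {S T} → ¬ (∃ λ Z → Inside S T Z) → NoneInside S T
    none-inside {S} {T} ¬inside Z S⊆Z Z⊆T tight with Z ≟ˢ S | Z ≟ˢ T
    ... | yes eq | _ = inj₁ eq
    ... | no _ | yes eq = inj₂ eq
    ... | no ne | no ne′ = Empty.⊥-elim (¬inside (Z , (S⊆Z , Z⊆T) , tight , ne , ne′))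

    NextTight : Subset n → Subset n → Set
    NextTight S T = ∃ λ W → S ⊆ W × S ≢ W × W ⊆ T × Tight W × NoneInside S W

    minimal-tight : ∀ f S W → ∣ W ∣ ≤ f → S ⊆ W → S ≢ W → Tight W → NextTight S W
    minimal-tight f S W ∣W∣≤f S⊆W S≢W tight with anySubset? (inside? S W)
    ... | no ¬inside = W , S⊆W , S≢W , ⊆-refl , tight , none-inside ¬inside
    ... | yes (Z , (S⊆Z , Z⊆W) , tightZ , Z≢S , Z≢W) = recurse f ∣W∣≤f
      where
      ∣Z∣<∣W∣ : ∣ Z ∣ < ∣ W ∣
      ∣Z∣<∣W∣ = ≰⇒> (λ ∣W∣≤∣Z∣ → Z≢W (⊆-antisym Z⊆W (⊆∧∣∣≥⇒⊇ Z⊆W ∣W∣≤∣Z∣)))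
      recurse : ∀ f → ∣ W ∣ ≤ f → NextTight S W
      recurse zero le = Empty.⊥-elim (<⇒≱ ∣Z∣<∣W∣ (≤-trans le z≤n))
      recurse (suc f) le with W′ , a , b , c , d , e ← minimal-tight f S Z (≤-pred (≤-trans ∣Z∣<∣W∣ le)) S⊆Z
        (Z≢S ∘ sym) tightZ =
        W′ , a , b , ⊆-trans c Z⊆W , d , e

    next-tight : ∀ S T → NextTight S T ⊎ NoneInside S T
    next-tight S T with anySubset? (inside? S T)
    ... | yes (Z , (S⊆Z , Z⊆T) , tightZ , Z≢S , Z≢T) with W , a , b , c , d , e ← minimal-tight ∣ Z ∣ S Z ≤-refl S⊆Z
      (Z≢S ∘ sym) tightZ =
      inj₁ (W , a , b , ⊆-trans c Z⊆T , d , e)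
    ... | no ¬inside = inj₂ (none-inside ¬inside)

    -- The connectivity of `Z ∪ W` is at least t, which is that of W. By submodularity the
    -- connectivity of `Z ∩ W` is then at most that of Z, so a narrow layout of the interval from S
    -- to T restricts to one that ends at W.
    narrow-∩ : ∀ {S T W Z} → Bounded S T → S ⊆ W → W ⊆ T → Tight W → S ⊆ Z → Z ⊆ T → Narrow Z → Narrow (Z ∩ W)
    narrow-∩ {S} {T} {W} {Z} bd S⊆W W⊆T tight S⊆Z Z⊆T nz = linear
      (cut (Z ∩ W) ∷ cut (Z ∪ W) ∷ cut Z ∷ cut W ∷ t ∷ rk ⊤ ∷ K ∷ [])
      (λ { (i ∷ u ∷ z ∷ w ∷ t ∷ e ∷ k ∷ []) →
        (1 , i +ₑ u ≤ₑ z +ₑ w) ∷ (1 , t +ₑ e ≤ₑ u) ∷ (1 , w ≤ₑ t +ₑ e) ∷ (1 , z ≤ₑ k +ₑ e) ∷ [] , i ≤ₑ k +ₑ e })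
      (cut-submod Z W ∷ bd (Z ∪ W) (⊆-trans S⊆Z (p⊆p∪q W)) (λ x∈ → [ Z⊆T , W⊆T ]′ (x∈p∪q⁻ Z W x∈)) ∷
        ≤-reflexive tight ∷ nz ∷ [])

    narrow-∪ : ∀ {S T W Z} → Bounded S T → S ⊆ W → W ⊆ T → Tight W → S ⊆ Z → Z ⊆ T → Narrow Z → Narrow (Z ∪ W)
    narrow-∪ {S} {T} {W} {Z} bd S⊆W W⊆T tight S⊆Z Z⊆T nz = linear
      (cut (Z ∩ W) ∷ cut (Z ∪ W) ∷ cut Z ∷ cut W ∷ t ∷ rk ⊤ ∷ K ∷ [])
      (λ { (i ∷ u ∷ z ∷ w ∷ t ∷ e ∷ k ∷ []) →
        (1 , i +ₑ u ≤ₑ z +ₑ w) ∷ (1 , t +ₑ e ≤ₑ i) ∷ (1 , w ≤ₑ t +ₑ e) ∷ (1 , z ≤ₑ k +ₑ e) ∷ [] , u ≤ₑ k +ₑ e })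
      (cut-submod Z W ∷ bd (Z ∩ W) (λ x∈ → x∈p∩q⁺ (S⊆Z x∈ , S⊆W x∈)) (⊆-trans (p∩q⊆p Z W) Z⊆T) ∷ ≤-reflexive tight ∷
        nz ∷ [])

  open Level

  mutual

    -- Induction on the connectivity t from below. Either tight sets occur often enough to form the
    -- chain, or some long interval has no tight set strictly inside, and the search continues there
    -- with t + 1. It stops in time because every prefix has connectivity at most K.
    extract : ∀ s t S T → Chain Narrow S T → Bounded t S T → longEnough s N + ∣ S ∣ ≤ ∣ T ∣ → K < s + t → Good
    extract zero t S T c bd len K<t = Empty.⊥-elim (<⇒≱ K<t (level-≤ t c bd))
    extract (suc s) t S T c bd len K<s+t with extract-tight s t N S T c bd len K<s+t
    ... | inj₁ good = good
    ... | inj₂ tc = t , level-≤ t c bd , record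
      { A = TightChain.A tc ; T = T ; A-step = TightChain.A-step tc ; A-strict = TightChain.A-strict tc ; A⊆T =
        TightChain.A⊆T tc
      ; A-cut = TightChain.A-tight tc ; linked = λ Z A₀⊆Z Z⊆T → bd Z (⊆-trans (TightChain.S⊆A₀ tc) A₀⊆Z) Z⊆T }

    level-≤ : ∀ t {S T} → Chain Narrow S T → Bounded t S T → t ≤ K
    level-≤ t {S} c bd = +-cancelʳ-≤ (rk ⊤) t K (≤-trans (bd S ⊆-refl (chain-⊆ c)) (chain-head c))

    extract-tight : ∀ s t p S T → Chain Narrow S T → Bounded t S T → longEnough (suc s) p + ∣ S ∣ ≤ ∣ T ∣ →
      K < suc s + t →
                    Good ⊎ TightChain t p S T
    extract-tight s t p S T c bd len K<s+t with next-tight t S T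
    ... | inj₂ none = inj₁ (extract-inside s t S T c bd none (≤-trans (first-part p) len) K<s+t)
      where
      first-part : ∀ p → longEnough s N + 2 + ∣ S ∣ ≤ longEnough (suc s) p + ∣ S ∣
      first-part zero = +-monoˡ-≤ ∣ S ∣ (+-monoʳ-≤ (longEnough s N) (s≤s (s≤s z≤n)))
      first-part (suc p) = +-monoˡ-≤ ∣ S ∣ (≤-trans (+-monoʳ-≤ (longEnough s N) (s≤s (s≤s z≤n))) (m≤m+n _ _))
    ... | inj₁ (W , S⊆W , S≢W , W⊆T , tight , none) with longEnough s N + 2 + ∣ S ∣ ≤? ∣ W ∣
    ...   | yes long = inj₁ (extract-inside s t S W below bd-W none long K<s+t)
      where
      bd-W : Bounded t S W
      bd-W Z S⊆Z Z⊆W = bd Z S⊆Z (⊆-trans Z⊆W W⊆T)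
      below : Chain Narrow S W
      below = subst₂ (Chain Narrow) (⊆-antisym (p∩q⊆p S W) (λ x∈ → x∈p∩q⁺ (x∈ , S⊆W x∈)))
        (⊆-antisym (p∩q⊆q T W) (λ x∈ → x∈p∩q⁺ (W⊆T x∈ , x∈)))
        (chain-map (_∩ W) (step-∩ W) (λ (nz , S⊆Z , Z⊆T) → narrow-∩ t bd S⊆W W⊆T tight S⊆Z Z⊆T nz)
          (chain-bounds ⊆-refl c))
    extract-tight s t zero S T c bd len K<s+t | inj₁ (W , S⊆W , S≢W , W⊆T , tight , none) | no _ = inj₂
      (constant t S⊆W S≢W W⊆T tight)
    extract-tight s t (suc p) S T c bd len K<s+t | inj₁ (W , S⊆W , S≢W , W⊆T , tight , none) | no short
      with extract-tight s t p W T above bd-T len′ K<s+t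
      where
      bd-T : Bounded t W T
      bd-T Z W⊆Z Z⊆T = bd Z (⊆-trans S⊆W W⊆Z) Z⊆T
      above : Chain Narrow W T
      above = subst₂ (Chain Narrow) (⊆-antisym (λ x∈ → [ S⊆W , (λ z → z) ]′ (x∈p∪q⁻ S W x∈)) (q⊆p∪q S W))
                                    (⊆-antisym (λ x∈ → [ (λ z → z) , W⊆T ]′ (x∈p∪q⁻ T W x∈)) (p⊆p∪q W))
        (chain-map (_∪ W) (step-∪ W) (λ (nz , S⊆Z , Z⊆T) → narrow-∪ t bd S⊆W W⊆T tight S⊆Z Z⊆T nz)
          (chain-bounds ⊆-refl c))
      len′ : longEnough (suc s) p + ∣ W ∣ ≤ ∣ T ∣
      len′ = linear (longEnough s N ∷ longEnough (suc s) p ∷ ∣ S ∣ ∷ ∣ T ∣ ∷ ∣ W ∣ ∷ [])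
        (λ { (e ∷ f ∷ s ∷ t ∷ w ∷ []) → (1 , (e +ₑ con 3) +ₑ f +ₑ s ≤ₑ t) ∷ (1 , con 1 +ₑ w ≤ₑ e +ₑ con 2 +ₑ s) ∷
          [] , f +ₑ w ≤ₑ t })
        (len ∷ ≰⇒> short ∷ [])
    ... | inj₁ good = inj₁ good
    ... | inj₂ tc = inj₂ (prepend t S⊆W S≢W tight tc)

    -- After the first and the last element have been removed, no set between `S′` and `T′` can
    -- equal S or T. All of them fail to be tight, which raises the lower bound to t + 1.
    extract-inside : ∀ s t S T → Chain Narrow S T → Bounded t S T → NoneInside t S T →
      longEnough s N + 2 + ∣ S ∣ ≤ ∣ T ∣ →
                     K < suc s + t → Good
    extract-inside s t S T c bd none len K<s+t with drop-first c
    ... | inj₁ refl = Empty.⊥-elim (m+1+n≰m ∣ S ∣ (≤-trans (≤-reflexive (lem (longEnough s N) ∣ S ∣)) len))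
      where
      lem : ∀ e x → x + suc (suc e) ≡ e + 2 + x
      lem e x = trans (+-comm x (suc (suc e))) (cong (_+ x) (+-comm 2 e))
    ... | inj₂ (S′ , step-S , S≢S′ , c′) with drop-last c′
    ...   | inj₁ refl = Empty.⊥-elim (m+1+n≰m ∣ S ∣ (≤-pred (linear (longEnough s N ∷ ∣ S ∣ ∷ ∣ S′ ∣ ∷ [])
             (λ { (e ∷ s ∷ s′ ∷ []) → (1 , e +ₑ con 2 +ₑ s ≤ₑ s′) ∷ (1 , s′ ≤ₑ con 1 +ₑ s) ∷ [] , con 1 +ₑ
               (s +ₑ con 1) ≤ₑ con 1 +ₑ s })
             (len ∷ step-size step-S ∷ []))))
    ...   | inj₂ (T′ , step-T , T′≢T , c″) = extract s (suc t) S′ T′ c″ bd′ len′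
      (≤-trans K<s+t (≤-reflexive (sym (+-suc s t))))
      where
      bd′ : Bounded (suc t) S′ T′
      bd′ Z S′⊆Z Z⊆T′ = ≤∧≢⇒< (bd Z S⊆Z Z⊆T) (λ tight → [ Z≢S , Z≢T ]′ (none Z S⊆Z Z⊆T (sym tight)))
        where
        S⊆Z = ⊆-trans (grows step-S) S′⊆Z
        Z⊆T = ⊆-trans Z⊆T′ (grows step-T)
        Z≢S : Z ≢ S
        Z≢S refl = S≢S′ (⊆-antisym (grows step-S) S′⊆Z)
        Z≢T : Z ≢ T
        Z≢T refl = T′≢T (⊆-antisym (grows step-T) Z⊆T′)
      len′ : longEnough s N + ∣ S′ ∣ ≤ ∣ T′ ∣
      len′ = linear (longEnough s N ∷ ∣ S ∣ ∷ ∣ S′ ∣ ∷ ∣ T ∣ ∷ ∣ T′ ∣ ∷ [])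
        (λ { (e ∷ s ∷ s′ ∷ t ∷ t′ ∷ []) → (1 , e +ₑ con 2 +ₑ s ≤ₑ t) ∷ (1 , s′ ≤ₑ con 1 +ₑ s) ∷
          (1 , t ≤ₑ con 1 +ₑ t′) ∷ [] , e +ₑ s′ ≤ₑ t′ })
        (len ∷ step-size step-S ∷ step-size step-T ∷ [])

-- Merging and compressing sequences

-- A staircase through the grid of pairs of states, from the first pair to the last; it never leaves ok.
data Path {A B : Set} (ok : A → B → Set) : List A → List B → Set where
  stop : ∀ {a b bs} → ok a b → bs ≡ [] → Path ok (a ∷ []) (b ∷ bs)
  goˡ  : ∀ {a b as bs} → ok a b → Path ok as (b ∷ bs) → Path ok (a ∷ as) (b ∷ bs)
  goʳ  : ∀ {a b as bs} → ok a b → Path ok (a ∷ as) bs → Path ok (a ∷ as) (b ∷ bs)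

data Ends {B : Set} (D : B → Set) : List B → Set where
  none : ∀ {w} → All (¬_ ∘ D) w → Ends D w
  one  : ∀ u x z → D x → All (¬_ ∘ D) u → All (¬_ ∘ D) z → Ends D (u ++ x ∷ z)
  two  : ∀ u x v y z → D x → D y → All (¬_ ∘ D) u → All (¬_ ∘ D) z → Ends D (u ++ x ∷ v ++ y ∷ z)

ends : ∀ {B : Set} {D : B → Set} → Decidable D → ∀ w → Ends D w
ends D? [] = none []
ends D? (b ∷ w) with D? b | ends D? w
... | no ¬d | none n = none (¬d ∷ n)
... | yes d | none n = one [] b w d [] n
... | no ¬d | one u x z dx nu nz = one (b ∷ u) x z dx (¬d ∷ nu) nz
... | yes d | one u x z dx nu nz = two [] b u x z d dx [] nz
... | no ¬d | two u x v y z dx dy nu nz = two (b ∷ u) x v y z dx dy (¬d ∷ nu) nz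
... | yes d | two u x v y z dx dy nu nz =
  subst (Ends _) (cong (b ∷_) (++-assoc u (x ∷ v) (y ∷ z))) (two [] b (u ++ x ∷ v) y z d dy [] nz)

module Compression {A B Θ J : Set} (ok : J → A → B → Set) (θ : B → Θ) (val : B → ℕ)
                   (ok-mono : ∀ {j a b c} → θ b ≡ θ c → val b ≤ val c → ok j a c → ok j a b) where

  infix 4 _≼_ _≈_

  _≼_ : B → B → Set
  b ≼ c = θ b ≡ θ c × val b ≤ val c

  -- The context, the left sequence and the index j are quantified inside. An equivalence found in
  -- one minor can therefore be applied with the left side of another.
  Carries : List B → List B → Set
  Carries u w = ∀ {j as} l r → Path (ok j) as (l ++ u ++ r) → Path (ok j) as (l ++ w ++ r)

  record _≈_ (u w : List B) : Set where
    constructor _,_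
    field
      to   : Carries u w
      from : Carries w u

  open _≈_

  ≈-refl : ∀ {u} → u ≈ u
  ≈-refl = (λ _ _ p → p) , (λ _ _ p → p)

  ≈-trans : ∀ {u v w} → u ≈ v → v ≈ w → u ≈ w
  ≈-trans e f = (λ l r → to f l r ∘ to e l r) , (λ l r → from e l r ∘ from f l r)

  ++-carries : ∀ {u u′ v v′} → Carries u u′ → Carries v v′ → Carries (u ++ v) (u′ ++ v′)
  ++-carries {u} {u′} {v} {v′} f g {j} {as} l r p =
    subst (Path (ok j) as) (cong (l ++_) (sym (++-assoc u′ v′ r)))
      (subst (Path (ok j) as) (++-assoc l u′ (v′ ++ r))
        (g (l ++ u′) r
          (subst (Path (ok j) as) (sym (++-assoc l u′ (v ++ r)))
            (f l (v ++ r) (subst (Path (ok j) as) (cong (l ++_) (++-assoc u v r)) p)))))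

  ++-cong : ∀ {u u′ v v′} → u ≈ u′ → v ≈ v′ → u ++ v ≈ u′ ++ v′
  ++-cong e f = ++-carries (to e) (to f) , ++-carries (from e) (from f)

  prefix-path : ∀ {j} l {u w} → (∀ {as} → Path (ok j) as u → Path (ok j) as w) → (u ≡ [] → w ≡ []) →
                ∀ {as} → Path (ok j) as (l ++ u) → Path (ok j) as (l ++ w)
  prefix-path [] f e p = f p
  prefix-path (b ∷ l) {u} {w} f e (stop o eq) =
    stop o (trans (cong₂ _++_ (++-conicalˡ l u eq) (e (++-conicalʳ l u eq))) refl)
  prefix-path (b ∷ l) f e (goˡ o p) = goˡ o (prefix-path (b ∷ l) f e p)
  prefix-path (b ∷ l) f e (goʳ o p) = goʳ o (prefix-path l f e p)

  module _ {j : J} {p q : B} {r : List B} where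

    private
      Path′ = Path (ok j)

    -- Instead of visiting values above p, stay at p until q is reached.
    drop-above-left : ∀ {as b} mid → p ≼ b → All (p ≼_) mid → Path′ as (b ∷ mid ++ q ∷ r) → Path′ as (p ∷ q ∷ r)
    drop-above-left [] p≼b _ (stop o ())
    drop-above-left (_ ∷ _) p≼b _ (stop o ())
    drop-above-left mid (e , le) h (goˡ o s) = goˡ (ok-mono e le o) (drop-above-left mid (e , le) h s)
    drop-above-left [] (e , le) h (goʳ o s) = goʳ (ok-mono e le o) s
    drop-above-left (m ∷ mid) _ (p≼m ∷ h) (goʳ o s) = drop-above-left mid p≼m h s

    -- Instead of visiting values above q, move to q at once.
    drop-above-right′ : ∀ {as b} mid → q ≼ b → All (q ≼_) mid → Path′ as (b ∷ mid ++ q ∷ r) → Path′ as (q ∷ r)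
    drop-above-right′ [] q≼b _ (stop o ())
    drop-above-right′ (_ ∷ _) q≼b _ (stop o ())
    drop-above-right′ mid (e , le) h (goˡ o s) = goˡ (ok-mono e le o) (drop-above-right′ mid (e , le) h s)
    drop-above-right′ [] (e , le) h (goʳ o s) = s
    drop-above-right′ (m ∷ mid) _ (q≼m ∷ h) (goʳ o s) = drop-above-right′ mid q≼m h s

    drop-above-right : ∀ {as} mid → All (q ≼_) mid → Path′ as (p ∷ mid ++ q ∷ r) → Path′ as (p ∷ q ∷ r)
    drop-above-right [] h s = s
    drop-above-right (m ∷ mid) h (stop o ())
    drop-above-right (m ∷ mid) h (goˡ o s) = goˡ o (drop-above-right (m ∷ mid) h s)
    drop-above-right (m ∷ mid) (q≼m ∷ h) (goʳ o s) = goʳ o (drop-above-right′ mid q≼m h s)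

    head-ok : ∀ {a as} → Path′ (a ∷ as) (q ∷ r) → ok j a q
    head-ok (stop o _) = o
    head-ok (goˡ o _) = o
    head-ok (goʳ o _) = o

    insert-here : ∀ {a as} mid → All (λ m → m ≼ p ⊎ m ≼ q) mid → ok j a p → ok j a q → Path′ (a ∷ as) (q ∷ r) →
      Path′ (a ∷ as) (mid ++ q ∷ r)
    insert-here [] h o o′ s = s
    insert-here (m ∷ mid) (inj₁ (e , le) ∷ h) o o′ s = goʳ (ok-mono e le o) (insert-here mid h o o′ s)
    insert-here (m ∷ mid) (inj₂ (e , le) ∷ h) o o′ s = goʳ (ok-mono e le o′) (insert-here mid h o o′ s)

    -- The new values are visited while the left side rests at the state where the path passes from
    -- p to q. There p and q are both allowed, hence so is every value below one of them.
    insert : ∀ {as} mid → All (λ m → m ≼ p ⊎ m ≼ q) mid → Path′ as (p ∷ q ∷ r) → Path′ as (p ∷ mid ++ q ∷ r)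
    insert mid h (stop o ())
    insert mid h (goˡ o s) = goˡ o (insert mid h s)
    insert {a ∷ as} mid h (goʳ o s) = goʳ o (insert-here mid h o (head-ok s) s)

  -- Lying above one fixed end allows the middle to be skipped; lying, letter by letter, below one
  -- of the two ends allows it to be put back.
  drop-between : ∀ p mid q → All (p ≼_) mid ⊎ All (q ≼_) mid → All (λ m → m ≼ p ⊎ m ≼ q) mid →
                 p ∷ mid ++ q ∷ [] ≈ p ∷ q ∷ []
  drop-between p mid q above below =
    (λ {j} {as} l r s → prefix-path l (shorten above) (λ ())
      (subst (Path (ok j) as) (cong (λ z → l ++ p ∷ z) (++-assoc mid (q ∷ []) r)) s)) ,
    (λ {j} {as} l r s → subst (Path (ok j) as) (cong (λ z → l ++ p ∷ z) (sym (++-assoc mid (q ∷ []) r)))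
      (prefix-path l (insert mid below) (λ ()) s))
    where
    shorten : ∀ {j as r} → All (p ≼_) mid ⊎ All (q ≼_) mid → Path (ok j) as (p ∷ mid ++ q ∷ r) → Path (ok j) as
      (p ∷ q ∷ r)
    shorten (inj₁ h) s = drop-above-left mid (refl , ≤-refl) h s
    shorten (inj₂ h) s = drop-above-right mid h s

  -- The field `letters` says that the compressed word uses only letters of w, in the form in which
  -- it is applied: every property of letters is inherited.
  record Compressed (w : List B) (bound : ℕ) : Set₁ where
    field
      word    : List B
      equiv   : w ≈ word
      short   : length word < bound
      letters : ∀ {P : B → Set} → All P w → All P word

  open Compressed

  Within : Θ → ℕ → ℕ → B → Set
  Within θ₀ lo K b = θ b ≡ θ₀ × lo ≤ val b × val b < lo + K

  above-minimum : ∀ {θ₀ lo K v} → All (Within θ₀ lo (suc K)) v → All (λ b → val b ≢ lo) v → All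
    (Within θ₀ (suc lo) K) v
  above-minimum {lo = lo} {K} h n =
    All.zipWith (λ ((e , l , h) , ne) → e , ≤∧≢⇒< l (ne ∘ sym) , ≤-trans h (≤-reflexive (+-suc lo K))) (h , n)

  -- The typical sequences of Bodlaender and Kloks, with a cruder length bound: everything between the
  -- first and the last occurrence of the minimum is absorbed by one occurrence of the maximum.
  compress-values : ∀ K θ₀ lo w → All (Within θ₀ lo K) w → Compressed w (4 ^ K)
  compress-values zero θ₀ lo [] [] = record { word = [] ; equiv = ≈-refl ; short = s≤s z≤n ; letters = id }
  compress-values zero θ₀ lo (b ∷ w) ((_ , l , h) ∷ _) = Empty.⊥-elim
    (<⇒≱ h (≤-trans (≤-reflexive (+-identityʳ lo)) l))
  compress-values (suc K) θ₀ lo w ws with ends (λ b → val b ≟ lo) w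
  ... | none n = record { word = word c ; equiv = equiv c ; short = ≤-trans (short c) (m≤m+n (4 ^ K) _) ; letters =
    letters c }
    where
    c = compress-values K θ₀ (suc lo) w (above-minimum ws n)
  ... | one u x z dx nu nz = record
    { word = word cu ++ x ∷ word cz
    ; equiv = ++-cong (equiv cu) (++-cong (≈-refl {x ∷ []}) (equiv cz))
    ; short = subst (_< 4 ^ suc K) (sym (length-++ (word cu)))
      (linear (length (word cu) ∷ length (word cz) ∷ 4 ^ K ∷ [])
        (λ { (u ∷ z ∷ k ∷ []) → (1 , con 1 +ₑ u ≤ₑ k) ∷ (1 , con 1 +ₑ z ≤ₑ k) ∷ [] , con 1 +ₑ
          (u +ₑ (con 1 +ₑ z)) ≤ₑ k +ₑ (k +ₑ (k +ₑ (k +ₑ con 0))) })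
        (short cu ∷ short cz ∷ []))
    ; letters = λ h → ++⁺ (letters cu (++⁻ˡ u h)) (All.head (++⁻ʳ u h) ∷ letters cz (All.tail (++⁻ʳ u h)))
    }
    where
    cu = compress-values K θ₀ (suc lo) u (above-minimum (++⁻ˡ u ws) nu)
    cz = compress-values K θ₀ (suc lo) z (above-minimum (All.tail (++⁻ʳ u ws)) nz)
  ... | two u x v y z dx dy nu nz = record
    { word = word cu ++ word cm ++ word cz
    ; equiv = subst (_≈ (word cu ++ word cm ++ word cz)) (cong (u ++_) (++-assoc (x ∷ v) (y ∷ []) z))
        (++-cong (equiv cu) (++-cong (equiv cm) (equiv cz)))
    ; short = subst (_< 4 ^ suc K) (sym (trans (length-++ (word cu))
      (cong (length (word cu) +_) (length-++ (word cm)))))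
        (linear (length (word cu) ∷ length (word cz) ∷ length (word cm) ∷ 4 ^ K ∷ [])
        (λ { (u ∷ z ∷ m ∷ k ∷ []) → (1 , con 1 +ₑ u ≤ₑ k) ∷ (1 , con 1 +ₑ z ≤ₑ k) ∷ (1 , con 1 +ₑ m ≤ₑ k +ₑ con 3) ∷
          (1 , con 1 ≤ₑ k) ∷ [] , con 1 +ₑ (u +ₑ (m +ₑ z)) ≤ₑ k +ₑ (k +ₑ (k +ₑ (k +ₑ con 0))) })
        (short cu ∷ short cz ∷ short cm ∷ m^n>0 4 K ∷ []))
    ; letters = λ h → let h′ = ++⁻ʳ u h ; h″ = ++⁻ʳ v (All.tail h′) in
        ++⁺ (letters cu (++⁻ˡ u h)) (++⁺ (letters cm (All.head h′ ∷ ++⁺ (++⁻ˡ v (All.tail h′)) (All.head h″ ∷ [])))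
          (letters cz (All.tail h″)))
    }
    where
    wx = All.head (++⁻ʳ u ws)
    wvyz = All.tail (++⁻ʳ u ws)
    wv = ++⁻ˡ v wvyz
    wy = All.head (++⁻ʳ v wvyz)
    wz = All.tail (++⁻ʳ v wvyz)
    cu = compress-values K θ₀ (suc lo) u (above-minimum (++⁻ˡ u ws) nu)
    cz = compress-values K θ₀ (suc lo) z (above-minimum wz nz)
    minimum : ∀ {b} → θ b ≡ θ₀ → val b ≡ lo → ∀ {c} → Within θ₀ lo (suc K) c → b ≼ c
    minimum e refl (e′ , l , _) = trans e (sym e′) , l
    maximum : ∀ {b} → θ b ≡ θ₀ → val b ≡ lo + K → ∀ {c} → Within θ₀ lo (suc K) c → c ≼ b
    maximum e eq (e′ , _ , h) = trans e′ (sym e) , ≤-trans (≤-pred (≤-trans h (≤-reflexive (+-suc lo K))))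
      (≤-reflexive (sym eq))
    absorb : ∀ v₁ t v₂ → All (Within θ₀ lo (suc K)) (v₁ ++ t ∷ v₂) → val t ≡ lo + K → Compressed
      (x ∷ (v₁ ++ t ∷ v₂) ++ y ∷ []) (4 ^ K + 3)
    absorb v₁ t v₂ h dt = record
      { word = x ∷ t ∷ y ∷ []
      ; equiv = subst (_≈ (x ∷ t ∷ y ∷ [])) (cong (x ∷_) (sym (++-assoc v₁ (t ∷ v₂) (y ∷ []))))
         (≈-trans (subst (_≈ (x ∷ t ∷ v₂ ++ y ∷ [])) (cong (x ∷_) (++-assoc v₁ (t ∷ []) (v₂ ++ y ∷ [])))
            (++-cong (drop-between x v₁ t (inj₁ (All.map (minimum (proj₁ wx) dx) h₁))
              (All.map (inj₂ ∘ maximum (proj₁ ht) dt) h₁)) (≈-refl {v₂ ++ y ∷ []})))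
            (++-cong (≈-refl {x ∷ []}) (drop-between t v₂ y (inj₂ (All.map (minimum (proj₁ wy) dy) h₂))
              (All.map (inj₁ ∘ maximum (proj₁ ht) dt) h₂))))
      ; short = +-monoˡ-≤ 3 (m^n>0 4 K)
      ; letters = λ { (hx ∷ h) → let h′ = ++⁻ (v₁ ++ t ∷ v₂) h in hx ∷ All.head (++⁻ʳ v₁ (proj₁ h′)) ∷ proj₂ h′ }
      }
      where
      h₁ = ++⁻ˡ v₁ h
      ht = All.head (++⁻ʳ v₁ h)
      h₂ = All.tail (++⁻ʳ v₁ h)
    -- If the largest value `lo + K` is absent from v, then v needs only K values and is compressed
    -- recursively. If it is present, one occurrence t absorbs both parts of v, which lie above the
    -- minimum at x or y and below t.
    cm : Compressed (x ∷ v ++ y ∷ []) (4 ^ K + 3)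
    cm with ends (λ b → val b ≟ lo + K) v
    ... | none n = record
      { word = x ∷ word cv ++ y ∷ []
      ; equiv = ++-cong (≈-refl {x ∷ []}) (++-cong (equiv cv) (≈-refl {y ∷ []}))
      ; short = subst (λ z → suc z < 4 ^ K + 3) (sym (length-++ (word cv)))
          (linear (length (word cv) ∷ 4 ^ K ∷ [])
            (λ { (v ∷ k ∷ []) → (1 , con 1 +ₑ v ≤ₑ k) ∷ [] , con 1 +ₑ (con 1 +ₑ (v +ₑ con 1)) ≤ₑ k +ₑ con 3 })
            (short cv ∷ []))
      ; letters = λ { (hx ∷ h) → hx ∷ ++⁺ (letters cv (++⁻ˡ v h)) (++⁻ʳ v h) }
      }
      where
      cv = compress-values K θ₀ lo v (All.zipWith
        (λ ((e , l , h) , ne) → e , l , ≤∧≢⇒< (≤-pred (≤-trans h (≤-reflexive (+-suc lo K)))) ne) (wv , n))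
    ... | one v₁ t v₂ dt _ _ = absorb v₁ t v₂ wv dt
    ... | two v₁ t v′ t′ v₂ dt dt′ _ _ = absorb v₁ t (v′ ++ t′ ∷ v₂) wv dt

  module _ (level : Θ → ℕ) where

    -- Levels increase along the word and determine the type of its letters. The word is thus a
    -- concatenation of blocks of constant type, one for each level that occurs.
    Ordered : B → B → Set
    Ordered b c = level (θ b) ≤ level (θ c) × (level (θ b) ≡ level (θ c) → θ b ≡ θ c)

    record LevelSplit (lo : ℕ) (w : List B) : Set where
      constructor split
      field
        low high   : List B
        w≡         : w ≡ low ++ high
        low-level  : All (λ b → level (θ b) ≡ lo) low
        high-level : All (λ b → lo < level (θ b)) high

    level-split : ∀ lo w → All (λ b → lo ≤ level (θ b)) w → AllPairs Ordered w → LevelSplit lo w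
    level-split lo [] [] [] = split [] [] refl [] []
    level-split lo (b ∷ w) (lo≤b ∷ h) (b≤ ∷ o) with level (θ b) ≟ lo
    ... | yes eq = let split u v e hu hv = level-split lo w h o in split (b ∷ u) v (cong (b ∷_) e) (eq ∷ hu) hv
    ... | no ne = split [] (b ∷ w) refl [] (lo<b ∷ All.map (λ (le , _) → ≤-trans lo<b le) b≤)
      where
      lo<b : lo < level (θ b)
      lo<b = ≤∧≢⇒< lo≤b (ne ∘ sym)

    allPairs-++ : ∀ u {v} → AllPairs Ordered (u ++ v) → AllPairs Ordered u × AllPairs Ordered v
    allPairs-++ [] p = [] , p
    allPairs-++ (b ∷ u) (h ∷ p) = let p₁ , p₂ = allPairs-++ u p in ++⁻ˡ u h ∷ p₁ , p₂

    compress-low : ∀ G lo u → All (λ b → level (θ b) ≡ lo) u → AllPairs Ordered u → All (λ b → val b < G) u →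
      Compressed u (4 ^ G)
    compress-low G lo [] _ _ _ = record { word = [] ; equiv = ≈-refl ; short = m^n>0 4 G ; letters = id }
    compress-low G lo (b ∷ u) (eb ∷ eu) (ob ∷ _) (hb ∷ hu) = compress-values G (θ b) 0 (b ∷ u)
      ((refl , z≤n , hb) ∷ All.zipWith (λ ((e , (_ , o)) , h) → sym (o (trans eb (sym e))) , z≤n , h)
        (All.zip (eu , ob) , hu))

    -- There are at most J blocks, and each of them is compressed to fewer than `4 ^ G` letters by
    -- its values alone.
    compress : ∀ J G lo w → All (λ b → lo ≤ level (θ b)) w → All (λ b → level (θ b) < lo + J) w →
      AllPairs Ordered w → All (λ b → val b < G) w →
               Compressed w (suc (J * 4 ^ G))
    compress zero G lo [] _ _ _ _ = record { word = [] ; equiv = ≈-refl ; short = s≤s z≤n ; letters = id }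
    compress zero G lo (b ∷ w) (l ∷ _) (h ∷ _) _ _ = Empty.⊥-elim (<⇒≱ h (≤-trans (≤-reflexive (+-identityʳ lo)) l))
    compress (suc J) G lo w lb ub ord hv with level-split lo w lb ord
    ... | split u v refl hu hv′ = record
      { word = word cu ++ word cv
      ; equiv = ++-cong (equiv cu) (equiv cv)
      ; short = subst (_< suc (suc J * 4 ^ G)) (sym (length-++ (word cu)))
          (linear (length (word cu) ∷ length (word cv) ∷ 4 ^ G ∷ J * 4 ^ G ∷ [])
            (λ { (u ∷ v ∷ k ∷ jk ∷ []) → (1 , con 1 +ₑ u ≤ₑ k) ∷ (1 , con 1 +ₑ v ≤ₑ con 1 +ₑ jk) ∷ [] , con 1 +ₑ
              (u +ₑ v) ≤ₑ con 1 +ₑ (k +ₑ jk) })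
            (short cu ∷ short cv ∷ []))
      ; letters = λ h → ++⁺ (letters cu (++⁻ˡ u h)) (letters cv (++⁻ʳ u h))
      }
      where
      cu = compress-low G lo u hu (proj₁ (allPairs-++ u ord)) (++⁻ˡ u hv)
      cv = compress J G (suc lo) v hv′ (All.map (λ h → ≤-trans h (≤-reflexive (+-suc lo J))) (++⁻ʳ u ub))
             (proj₂ (allPairs-++ u ord)) (++⁻ʳ u hv)

-- Path-decompositions and minors as chains of prefixes

module _ {n} (π : Permutation′ n) where

  ∈-prefix⁺ : ∀ {i x} → toℕ (π ⟨$⟩ˡ x) < i → x ∈ prefix π i
  ∈-prefix⁺ {i} {x} p = lookup⇒[]= x _ (trans (lookup∘tabulate _ x) (Equivalence.to T-≡ (<⇒<ᵇ p)))

  ∈-prefix⁻ : ∀ {i x} → x ∈ prefix π i → toℕ (π ⟨$⟩ˡ x) < i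
  ∈-prefix⁻ {i} {x} p = <ᵇ⇒< _ _ (Equivalence.from T-≡
    (trans (sym (lookup∘tabulate (λ e → toℕ (π ⟨$⟩ˡ e) <ᵇ i) x)) ([]=⇒lookup p)))

  prefix-0 : prefix π 0 ≡ ⊥
  prefix-0 = ⊆-antisym (λ x∈ → Empty.⊥-elim (n≮0 (∈-prefix⁻ x∈))) (⊆-min _)

  prefix-n : prefix π n ≡ ⊤
  prefix-n = ⊆-antisym (⊆-max _) (λ _ → ∈-prefix⁺ (toℕ<n _))

  prefix-step : ∀ i → Step (prefix π i) (prefix π (suc i))
  prefix-step i = step (λ x∈ → ∈-prefix⁺ (m<n⇒m<1+n (∈-prefix⁻ x∈)))
    (λ {x} {y} x∈ x∉ y∈ y∉ → trans (sym (Perm.inverseʳ π)) (trans (cong (π ⟨$⟩ʳ_)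
      (toℕ-injective (trans (position x∈ x∉) (sym (position y∈ y∉))))) (Perm.inverseʳ π)))
    where
    position : ∀ {x} → x ∈ prefix π (suc i) → x ∉ prefix π i → toℕ (π ⟨$⟩ˡ x) ≡ i
    position x∈ x∉ = ≤-antisym (≤-pred (∈-prefix⁻ x∈)) (≮⇒≥ (λ p → x∉ (∈-prefix⁺ p)))

  prefix-chain : ∀ {P : Subset n → Set} l i → (∀ j → j ≤ l + i → P (prefix π j)) → Chain P (prefix π i)
    (prefix π (l + i))
  prefix-chain zero i p = [ p i ≤-refl ]
  prefix-chain {P} (suc l) i p = p i (m≤n+m i (suc l)) ∷⟨ prefix-step i ⟩
    subst (λ z → Chain P (prefix π (suc i)) (prefix π z)) (+-suc l i)
      (prefix-chain l (suc i) (λ j j≤ → p j (≤-trans j≤ (≤-reflexive (+-suc l i)))))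

≤-maxUpTo : ∀ f m {i} → 1 ≤ i → i ≤ m → f i ≤ maxUpTo f m
≤-maxUpTo f zero 1≤i i≤0 = Empty.⊥-elim (<⇒≱ 1≤i i≤0)
≤-maxUpTo f (suc m) {i} 1≤i i≤m with i ≟ suc m
... | yes refl = m≤n⊔m (maxUpTo f m) _
... | no ne = ≤-trans (≤-maxUpTo f m 1≤i (≤-pred (≤∧≢⇒< i≤m ne))) (m≤m⊔n _ _)

maxUpTo-≤ : ∀ f m {k} → (∀ i → i ≤ m → f i ≤ k) → maxUpTo f m ≤ k
maxUpTo-≤ f zero p = z≤n
maxUpTo-≤ f (suc m) p = ⊔-lub (maxUpTo-≤ f m (λ i i≤m → p i (m≤n⇒m≤1+n i≤m))) (p (suc m) ≤-refl)

module _ {n} (M : Matroid n) where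

  open Rank M

  cut-⊥ : cut ⊥ ≤ rk ⊤
  cut-⊥ = ≤-trans (+-monoˡ-≤ (rk (∁ ⊥)) (≤-reflexive rk-⊥)) (r-mono M (⊆-max _))

  cut-⊤ : cut ⊤ ≤ rk ⊤
  cut-⊤ = ≤-trans (+-monoʳ-≤ (rk ⊤) (≤-trans (r-mono M (decide-⊆ [] (λ { [] → [] , ∁ₑ ⊤ₑ ⊆ₑ ⊥ₑ }) []))
    (≤-reflexive rk-⊥))) (≤-reflexive (+-identityʳ (rk ⊤)))

  pathWidth⇒chain : ∀ {k} → PathWidth≤ M k → Chain (λ Z → cut Z ≤ k + rk ⊤) ⊥ ⊤
  pathWidth⇒chain {k} (π , w≤k) = subst₂ (Chain _) (prefix-0 π)
    (trans (cong (prefix π) (+-identityʳ n)) (prefix-n π)) (prefix-chain π n 0 narrow)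
    where
    narrow : ∀ j → j ≤ n + 0 → cut (prefix π j) ≤ k + rk ⊤
    -- The width controls only the proper nonempty prefixes. The two remaining ones, ⊥ and ⊤, have
    -- connectivity 0.
    narrow j j≤ with j ≟ 0 | j ≟ n
    ... | yes refl | _ = ≤-trans (≤-reflexive (cong cut (prefix-0 π))) (≤-trans cut-⊥ (m≤n+m _ k))
    ... | no _ | yes refl = ≤-trans (≤-reflexive (cong cut (prefix-n π))) (≤-trans cut-⊤ (m≤n+m _ k))
    ... | no j≢0 | no j≢n = ≤-trans (m≤n+m∸n _ (rk ⊤)) (≤-trans (≤-reflexive (+-comm (rk ⊤) _)) (+-monoˡ-≤ (rk ⊤)
      (≤-trans (≤-maxUpTo (λ i → conn M (prefix π i)) (n ∸ 1) (n≢0⇒n>0 j≢0)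
        (≤-pred′ (≤∧≢⇒< (≤-trans j≤ (≤-reflexive (+-identityʳ n))) j≢n))) w≤k)))
      where
      ≤-pred′ : ∀ {m n} → m < n → m ≤ n ∸ 1
      ≤-pred′ (s≤s p) = p

-- A chain may repeat its sets, but a permutation needs each index to contribute exactly one new
-- element. Between ⊥ and ⊤ this forces `len` to be the number of elements.
record StrictSequence {n} (P : Subset n → Set) (X Y : Subset n) : Set where
  field
    len    : ℕ
    Z      : ℕ → Subset n
    first  : Z 0 ≡ X
    last   : Z len ≡ Y
    steps  : ∀ i → i < len → Step (Z i) (Z (suc i))
    strict : ∀ i → i < len → Z i ≢ Z (suc i)
    holds  : ∀ i → i ≤ len → P (Z i)

open StrictSequence

strict-sequence : ∀ {n} {P : Subset n → Set} {X Y} → Chain P X Y → StrictSequence P X Y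
strict-sequence {X = X} [ p ] = record
  { len = 0 ; Z = λ _ → X ; first = refl ; last = refl ; steps = λ _ () ; strict = λ _ () ; holds = λ _ _ → p }
strict-sequence {P = P} {X} {Y} (_∷⟨_⟩_ {Y = X′} p s c) with X ≟ˢ X′ | strict-sequence c
... | yes refl | q = q
... | no ne | q = record
  { len = suc (len q) ; Z = Z′ ; first = refl ; last = last q ; steps = st ; strict = sr ; holds = ho }
  where
  Z′ : ℕ → Subset _
  Z′ zero = X
  Z′ (suc i) = Z q i
  st : ∀ i → i < suc (len q) → Step (Z′ i) (Z′ (suc i))
  st zero _ = subst (Step X) (sym (first q)) s
  st (suc i) (s≤s h) = steps q i h
  sr : ∀ i → i < suc (len q) → Z′ i ≢ Z′ (suc i)
  sr zero _ eq = ne (trans eq (first q))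
  sr (suc i) (s≤s h) = strict q i h
  ho : ∀ i → i ≤ suc (len q) → P (Z′ i)
  ho zero _ = p
  ho (suc i) (s≤s h) = holds q i h

module LayoutOf {n} {P : Subset n → Set} (q : StrictSequence P ⊥ ⊤) where

  nested : ∀ {i j} → i ≤′ j → j ≤ len q → Z q i ⊆ Z q j
  nested ≤′-refl _ = ⊆-refl
  nested (≤′-step p) h = ⊆-trans (nested p (<⇒≤ h)) (grows (steps q _ h))

  new : ∀ i → i < len q → ∃ λ x → x ∈ Z q (suc i) × x ∉ Z q i
  new i h with nonempty? (Z q (suc i) ∩ ∁ (Z q i))
  ... | yes (x , x∈) = x , p∩q⊆p _ _ x∈ , x∈∁p⇒x∉p (p∩q⊆q _ _ x∈)
  ... | no ¬new = Empty.⊥-elim (strict q i h (⊆-antisym (grows (steps q i h)) sub))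
    where
    sub : Z q (suc i) ⊆ Z q i
    sub {x} x∈ with x ∈? Z q i
    ... | yes p = p
    ... | no p = Empty.⊥-elim (¬new (x , x∈p∩q⁺ (x∈ , x∉p⇒x∈∁p p)))

  entry : ∀ l {x} → x ∈ Z q l → ∃ λ i → i < l × x ∈ Z q (suc i) × x ∉ Z q i
  entry zero x∈ = Empty.⊥-elim (∉⊥ (subst (_ ∈_) (first q) x∈))
  entry (suc l) {x} x∈ with x ∈? Z q l
  ... | no x∉ = l , ≤-refl , x∈ , x∉
  ... | yes p with i , h , a , b ← entry l p = i , m<n⇒m<1+n h , a , b

  in-order : ∀ {i j x} → i < len q → j < len q → x ∈ Z q (suc i) → x ∉ Z q j → j ≤ i
  in-order {i} {j} hi hj x∈ x∉ = ≮⇒≥ (λ i<j → x∉ (nested (≤⇒≤′ i<j) (<⇒≤ hj) x∈))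

  entry-of : ∀ x → ∃ λ i → i < len q × x ∈ Z q (suc i) × x ∉ Z q i
  entry-of x = entry (len q) (subst (x ∈_) (sym (last q)) ∈⊤)

  at : Fin (len q) → Fin n
  at i = proj₁ (new (toℕ i) (toℕ<n i))

  position : Fin n → Fin (len q)
  position x = fromℕ< (proj₁ (proj₂ (entry-of x)))

  toℕ-position : ∀ x → toℕ (position x) ≡ proj₁ (entry-of x)
  toℕ-position x = toℕ-fromℕ< _

  at-position : ∀ x → at (position x) ≡ x
  at-position x with i , h , a , b ← entry-of x = new-unique (steps q i h)
    (subst (λ z → at (fromℕ< h) ∈ Z q (suc z)) eq (proj₁ (proj₂ (new _ (toℕ<n (fromℕ< h))))))
    (subst (λ z → at (fromℕ< h) ∉ Z q z) eq (proj₂ (proj₂ (new _ (toℕ<n (fromℕ< h))))))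
    a b
    where
    eq : toℕ (fromℕ< h) ≡ i
    eq = toℕ-fromℕ< h

  position-at : ∀ i → position (at i) ≡ i
  position-at i = toℕ-injective (trans (toℕ-position (at i)) (≤-antisym
    (in-order (toℕ<n i) (proj₁ (proj₂ e)) (proj₁ (proj₂ nw)) (proj₂ (proj₂ (proj₂ e))))
    (in-order (proj₁ (proj₂ e)) (toℕ<n i) (proj₁ (proj₂ (proj₂ e))) (proj₂ (proj₂ nw)))))
    where
    e = entry-of (at i)
    nw = new (toℕ i) (toℕ<n i)

  len≡n : len q ≡ n
  len≡n = ≤-antisym
    (injective⇒≤ {f = at} (λ {i} {j} eq → trans (sym (position-at i)) (trans (cong position eq) (position-at j))))
    (injective⇒≤ {f = position} (λ {x} {y} eq → trans (sym (at-position x)) (trans (cong at eq) (at-position y))))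

  ∈⇒position< : ∀ {i x} → i ≤ len q → x ∈ Z q i → toℕ (position x) < i
  ∈⇒position< {i} {x} h x∈ = subst (_< i) (sym (toℕ-position x))
    (≰⇒> (λ i≤ → proj₂ (proj₂ (proj₂ e)) (nested (≤⇒≤′ i≤) (<⇒≤ (proj₁ (proj₂ e))) x∈)))
    where e = entry-of x

  position<⇒∈ : ∀ {i x} → i ≤ len q → toℕ (position x) < i → x ∈ Z q i
  position<⇒∈ {i} {x} h lt = nested (≤⇒≤′ (subst (_< i) (toℕ-position x) lt)) h (proj₁ (proj₂ (proj₂ (entry-of x))))

layout⇒pathWidth : ∀ {n} (M : Matroid n) {k l} → l ≡ n → (f : Fin l → Fin n) (g : Fin n → Fin l) →
                   (∀ x → f (g x) ≡ x) → (∀ i → g (f i) ≡ i) → (Z : ℕ → Subset n) →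
                   (∀ {i x} → i ≤ l → x ∈ Z i → toℕ (g x) < i) → (∀ {i x} → i ≤ l → toℕ (g x) < i → x ∈ Z i) →
                   (∀ i → i ≤ l → Rank.cut M (Z i) ≤ k + r M ⊤) → PathWidth≤ M k
layout⇒pathWidth {n} M {k} refl f g fg gf Z to from narrow = π , maxUpTo-≤ _ (n ∸ 1) bound
  where
  π : Permutation′ n
  π = permutation f g fg gf
  bound : ∀ i → i ≤ n ∸ 1 → conn M (prefix π i) ≤ k
  bound i h = m≤n+o⇒m∸n≤o _ (r M ⊤) (≤-trans (≤-reflexive (cong (Rank.cut M) prefix≡Z))
    (≤-trans (narrow i i≤n) (≤-reflexive (+-comm k (r M ⊤)))))
    where
    i≤n : i ≤ n
    i≤n = ≤-trans h (m∸n≤m n 1)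
    prefix≡Z : prefix π i ≡ Z i
    prefix≡Z = ⊆-antisym (λ x∈ → from i≤n (∈-prefix⁻ π x∈)) (λ x∈ → ∈-prefix⁺ π (to i≤n x∈))

chain⇒pathWidth : ∀ {n} (M : Matroid n) {k} → Chain (λ Z → Rank.cut M Z ≤ k + r M ⊤) ⊥ ⊤ → PathWidth≤ M k
chain⇒pathWidth M c = layout⇒pathWidth M len≡n at position at-position position-at (Z q) ∈⇒position< position<⇒∈
  (holds q)
  where
  q = strict-sequence c
  open LayoutOf q

module MinorOf {n} (M : Matroid n) (C D : Subset n) (disjoint : ∀ x → x ∈ C → x ∉ D) where

  open Rank M

  G : Subset n
  G = ∁ (C ∪ D)

  φ : Fin ∣ G ∣ → Fin n
  φ = enum G

  image : Subset ∣ G ∣ → Subset n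
  image X = select (λ x → any? (λ y → (y ∈? X) ×-dec (φ y ≟ᶠ x)))

  ∈-image⁺ : ∀ {X y} → y ∈ X → φ y ∈ image X
  ∈-image⁺ {X} y∈ = ∈-select⁺ (λ x → any? (λ y → (y ∈? X) ×-dec (φ y ≟ᶠ x))) (_ , y∈ , refl)

  ∈-image⁻ : ∀ {X x} → x ∈ image X → ∃ λ y → y ∈ X × φ y ≡ x
  ∈-image⁻ {X} = ∈-select⁻ (λ x → any? (λ y → (y ∈? X) ×-dec (φ y ≟ᶠ x)))

  image-mono : ∀ {X Y} → X ⊆ Y → image X ⊆ image Y
  image-mono {X} {Y} X⊆Y x∈ with y , y∈ , refl ← ∈-image⁻ {X} x∈ = ∈-image⁺ {Y} (X⊆Y y∈)

  image-⊆ : ∀ X → image X ⊆ G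
  image-⊆ X x∈ with y , _ , refl ← ∈-image⁻ {X} x∈ = enum-∈ G y

  image-∪ : ∀ X Y → image (X ∪ Y) ⊆ image X ∪ image Y
  image-∪ X Y x∈ with y , y∈ , refl ← ∈-image⁻ {X ∪ Y} x∈ with x∈p∪q⁻ X Y y∈
  ... | inj₁ p = p⊆p∪q _ (∈-image⁺ {X} p)
  ... | inj₂ p = q⊆p∪q (image X) _ (∈-image⁺ {Y} p)

  image-∁ : ∀ X → G ∩ ∁ (image X) ⊆ image (∁ X)
  image-∁ X {x} x∈ with x∈G , x∉ ← x∈p∩q⁻ G _ x∈ = subst (_∈ image (∁ X)) (enum-index G x∈G)
    (∈-image⁺ {∁ X} (x∉p⇒x∈∁p (λ p → x∈∁p⇒x∉p x∉ (subst (_∈ image X) (enum-index G x∈G) (∈-image⁺ {X} p)))))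

  image-⊥ : image ⊥ ≡ ⊥
  image-⊥ = ⊆-antisym (λ x∈ → Empty.⊥-elim (∉⊥ (proj₁ (proj₂ (∈-image⁻ {⊥} x∈))))) (⊆-min _)

  image-⊤ : image ⊤ ≡ G
  image-⊤ = ⊆-antisym (image-⊆ ⊤) (λ x∈ → subst (_∈ image ⊤) (enum-index G x∈) (∈-image⁺ {⊤} ∈⊤))

  image-preimage : ∀ Z → Z ⊆ G → image (preimage φ Z) ≡ Z
  image-preimage Z Z⊆G = ⊆-antisym sub sup
    where
    sub : image (preimage φ Z) ⊆ Z
    sub x∈ with y , y∈ , refl ← ∈-image⁻ {preimage φ Z} x∈ =
      lookup⇒[]= _ Z (trans (sym (lookup∘tabulate (λ y → lookup Z (φ y)) y)) ([]=⇒lookup y∈))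
    sup : Z ⊆ image (preimage φ Z)
    sup {x} x∈ = subst (_∈ image (preimage φ Z)) (enum-index G (Z⊆G x∈))
      (∈-image⁺ {preimage φ Z} (lookup⇒[]= _ _ (trans (lookup∘tabulate (λ y → lookup Z (φ y)) _)
        (trans (cong (lookup Z) (enum-index G (Z⊆G x∈))) ([]=⇒lookup x∈)))))

  ∣image∣ : ∀ X → ∣ image X ∣ ≤ ∣ X ∣
  ∣image∣ X = ∣∣-≤ (image X) (λ x x∈ → index X (proj₁ (proj₂ (∈-image⁻ {X} x∈))))
    (λ p p′ eq → trans (sym (proj₂ (proj₂ (∈-image⁻ {X} p))))
      (trans (cong φ (index-injective X _ _ eq)) (proj₂ (proj₂ (∈-image⁻ {X} p′)))))

  image-step : ∀ {X Y} → Step X Y → Step (image X) (image Y)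
  image-step {X} {Y} s = step (image-mono (grows s)) unique
    where
    unique : ∀ {x y} → x ∈ image Y → x ∉ image X → y ∈ image Y → y ∉ image X → x ≡ y
    unique x∈ x∉ y∈ y∉ with a , a∈ , refl ← ∈-image⁻ {Y} x∈ | b , b∈ , refl ← ∈-image⁻ {Y} y∈ =
      cong φ (new-unique s a∈ (x∉ ∘ ∈-image⁺ {X}) b∈ (y∉ ∘ ∈-image⁺ {X}))

  rank : Subset ∣ G ∣ → ℕ
  rank X = rk (image X ∪ C) ∸ rk C

  rank+ : ∀ X → rank X + rk C ≡ rk (image X ∪ C)
  rank+ X = m∸n+n≡m (r-mono M (q⊆p∪q (image X) C))

  minor : Matroid ∣ G ∣
  minor = record
    { r = rank
    ; r-bounded = λ X → linear (rank X ∷ rk C ∷ rk (image X ∪ C) ∷ rk (C ∪ image X) ∷ ∣ image X ∣ ∷ ∣ X ∣ ∷ [])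
        (λ { (a ∷ c ∷ ic ∷ ci ∷ i ∷ x ∷ []) → (1 , a +ₑ c ≤ₑ ic) ∷ (1 , ic ≤ₑ ci) ∷ (1 , ci ≤ₑ c +ₑ i) ∷
          (1 , i ≤ₑ x) ∷ [] , a ≤ₑ x })
        (≤-reflexive (rank+ X) ∷ ≤-reflexive (cong rk (∪-comm (image X) C)) ∷ rk-∪-≤ C (image X) ∷ ∣image∣ X ∷ [])
    ; r-mono = λ {X} {Y} X⊆Y → ∸-monoˡ-≤ (rk C) (r-mono M
        (decide-⊆ (image X ∷ image Y ∷ C ∷ []) (λ { (x ∷ y ∷ c ∷ []) → (x ⊆ₑ y) ∷ [] , x ∪ₑ c ⊆ₑ y ∪ₑ c })
          (image-mono X⊆Y ∷ [])))
    ; r-submod = λ X Y → linear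
        (rank (X ∪ Y) ∷ rank (X ∩ Y) ∷ rank X ∷ rank Y ∷ rk C ∷ rk (image (X ∪ Y) ∪ C) ∷ rk (image (X ∩ Y) ∪ C) ∷ rk
          (image X ∪ C) ∷ rk (image Y ∪ C) ∷ [])
        (λ { (u ∷ i ∷ x ∷ y ∷ c ∷ u′ ∷ i′ ∷ x′ ∷ y′ ∷ []) →
          (1 , u +ₑ c ≤ₑ u′) ∷ (1 , i +ₑ c ≤ₑ i′) ∷ (1 , x′ ≤ₑ x +ₑ c) ∷ (1 , y′ ≤ₑ y +ₑ c) ∷
            (1 , u′ +ₑ i′ ≤ₑ x′ +ₑ y′) ∷ [] , u +ₑ i ≤ₑ x +ₑ y })
        (≤-reflexive (rank+ (X ∪ Y)) ∷ ≤-reflexive (rank+ (X ∩ Y)) ∷ ≤-reflexive (sym (rank+ X)) ∷ ≤-reflexive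
          (sym (rank+ Y)) ∷
         submod (image X ∪ C) (image Y ∪ C) (image (X ∪ Y) ∪ C) (image (X ∩ Y) ∪ C)
           (decide-⊆ (image (X ∪ Y) ∷ image X ∷ image Y ∷ C ∷ [])
             (λ { (u ∷ x ∷ y ∷ c ∷ []) → (u ⊆ₑ x ∪ₑ y) ∷ [] , u ∪ₑ c ⊆ₑ (x ∪ₑ c) ∪ₑ (y ∪ₑ c) }) (image-∪ X Y ∷ []))
           (decide-⊆ (image (X ∩ Y) ∷ image X ∷ image Y ∷ C ∷ [])
             (λ { (i ∷ x ∷ y ∷ c ∷ []) → (i ⊆ₑ x) ∷ (i ⊆ₑ y) ∷ [] , i ∪ₑ c ⊆ₑ (x ∪ₑ c) ∩ₑ (y ∪ₑ c) })
             (image-mono (p∩q⊆p X Y) ∷ image-mono (p∩q⊆q X Y) ∷ [])) ∷ [])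
    }

  minorVia : MinorVia M minor C D φ
  minorVia = record
    { disjoint = disjoint
    ; φ-inj = enum-injective G
    ; φ-avoidsC = λ y y∈ → x∈∁p⇒x∉p (enum-∈ G y) (p⊆p∪q D y∈)
    ; φ-avoidsD = λ y y∈ → x∈∁p⇒x∉p (enum-∈ G y) (q⊆p∪q C D y∈)
    ; φ-onto = λ x x∉C x∉D → let x∈G = x∉p⇒x∈∁p ([ x∉C , x∉D ]′ ∘ x∈p∪q⁻ C D) in index G x∈G , enum-index G x∈G
    ; rank-eq = λ Z Z⊆G → cong (λ X → rk (X ∪ C) ∸ rk C) (image-preimage Z Z⊆G)
    }

  -- Width at most k in the minor, expressed in the ground set of M so that sets from different
  -- minors can be combined. Adding the rank of C twice on both sides removes the subtractions.
  Separates : ℕ → Subset n → Set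
  Separates k Z = Z ⊆ G × rk (Z ∪ C) + rk ((G ∩ ∁ Z) ∪ C) ≤ k + rk C + rk (G ∪ C)

  minor-chain : ∀ {k} → PathWidth≤ minor k → Chain (Separates k) ⊥ G
  minor-chain {k} pw = subst₂ (Chain (Separates k)) image-⊥ image-⊤
    (chain-map image image-step separates (pathWidth⇒chain minor pw))
    where
    separates : ∀ {X} → Rank.cut minor X ≤ k + rank ⊤ → Separates k (image X)
    separates {X} h = image-⊆ X , linear
      (rank X ∷ rank (∁ X) ∷ rank ⊤ ∷ rk C ∷ k ∷ rk (image X ∪ C) ∷ rk (image (∁ X) ∪ C) ∷ rk (image ⊤ ∪ C) ∷ rk
        ((G ∩ ∁ (image X)) ∪ C) ∷ rk (G ∪ C) ∷ [])
      (λ { (x ∷ x̅ ∷ e ∷ c ∷ k ∷ xc ∷ x̅c ∷ ec ∷ x̅c′ ∷ gc ∷ []) →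
        (1 , x +ₑ x̅ ≤ₑ k +ₑ e) ∷ (1 , xc ≤ₑ x +ₑ c) ∷ (1 , x̅c ≤ₑ x̅ +ₑ c) ∷ (1 , e +ₑ c ≤ₑ ec) ∷
          (1 , x̅c′ ≤ₑ x̅c) ∷ (1 , ec ≤ₑ gc) ∷ [] ,
        xc +ₑ x̅c′ ≤ₑ k +ₑ c +ₑ gc })
      (h ∷ ≤-reflexive (sym (rank+ X)) ∷ ≤-reflexive (sym (rank+ (∁ X))) ∷ ≤-reflexive (rank+ ⊤) ∷
       r-mono M (decide-⊆ (G ∩ ∁ (image X) ∷ image (∁ X) ∷ C ∷ [])
         (λ { (x ∷ y ∷ c ∷ []) → (x ⊆ₑ y) ∷ [] , x ∪ₑ c ⊆ₑ y ∪ₑ c }) (image-∁ X ∷ [])) ∷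
       ≤-reflexive (cong (λ X → rk (X ∪ C)) image-⊤) ∷ [])

excluded⇒minor-chain : ∀ {n} (M : Matroid n) {k} → ExcludedMinorPW M k →
                       ∀ C D (disjoint : ∀ x → x ∈ C → x ∉ D) → Nonempty (C ∪ D) →
                       Chain (MinorOf.Separates M C D disjoint k) ⊥ (∁ (C ∪ D))
excluded⇒minor-chain M (_ , minors) C D disjoint ne = minor-chain (minors _ minor (C , D , φ , minorVia , ne))
  where open MinorOf M C D disjoint

chain-snoc : ∀ {n} {P : Subset n → Set} {X Y Z} → Chain P X Y → Step Y Z → P Z → Chain P X Z
chain-snoc [ p ] s q = p ∷⟨ s ⟩ [ q ]
chain-snoc (p ∷⟨ s′ ⟩ c) s q = p ∷⟨ s′ ⟩ chain-snoc c s q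

excluded⇒chain : ∀ {n} (M : Matroid (suc n)) {k} → ExcludedMinorPW M k →
                 Chain (λ Z → Rank.cut M Z ≤ suc k + r M ⊤) ⊥ ⊤
excluded⇒chain {n} M {k} ex = chain-snoc
  (chain-map {P = MinorOf.Separates M ⊥ e disj k} (λ Z → Z) (λ s → s) (λ {Z} → narrow Z)
    (excluded⇒minor-chain M ex ⊥ e disj (zero , q⊆p∪q ⊥ e (x∈⁅x⁆ zero))))
  (step (⊆-max _) (λ {x} {y} _ x∉ _ y∉ → trans (only x∉) (sym (only y∉))))
  (≤-trans (cut-⊤ M) (m≤n+m _ (suc k)))
  where
  open Rank M
  e : Subset (suc n)
  e = ⁅ zero ⁆
  disj : ∀ x → x ∈ ⊥ → x ∉ e
  disj x x∈ = Empty.⊥-elim (∉⊥ x∈)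
  G = ∁ (⊥ ∪ e)
  only : ∀ {x} → x ∉ G → x ≡ zero
  only {x} x∉ = x∈⁅y⁆⇒x≡y zero ([ (λ x∈ → Empty.⊥-elim (∉⊥ x∈)) , (λ z → z) ]′ (x∈p∪q⁻ ⊥ e (x∉∁p⇒x∈p x∉)))
  narrow : ∀ Z → MinorOf.Separates M ⊥ e disj k Z → cut Z ≤ suc k + rk ⊤
  narrow Z (Z⊆G , h) = linear
    (rk Z ∷ rk (∁ Z) ∷ rk ⊤ ∷ k ∷ rk (Z ∪ ⊥) ∷ rk ((G ∩ ∁ Z) ∪ ⊥) ∷ rk (((G ∩ ∁ Z) ∪ ⊥) ∪ e) ∷ rk ⊥ ∷ rk (G ∪ ⊥) ∷
      [])
    (λ { (z ∷ z̅ ∷ f ∷ k ∷ z⊥ ∷ g ∷ ge ∷ b ∷ g⊥ ∷ []) →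
      (1 , z⊥ +ₑ g ≤ₑ k +ₑ b +ₑ g⊥) ∷ (1 , b ≤ₑ con 0) ∷ (1 , g⊥ ≤ₑ f) ∷ (1 , z ≤ₑ z⊥) ∷ (1 , z̅ ≤ₑ ge) ∷
        (1 , ge ≤ₑ g +ₑ con 1) ∷ [] ,
      z +ₑ z̅ ≤ₑ con 1 +ₑ k +ₑ f })
    (h ∷ ≤-reflexive rk-⊥ ∷ r-mono M (⊆-max _) ∷ r-mono M (p⊆p∪q ⊥) ∷
     r-mono M (decide-⊆ (Z ∷ e ∷ []) (λ { (z ∷ e ∷ []) → [] , ∁ₑ z ⊆ₑ ((∁ₑ (⊥ₑ ∪ₑ e) ∩ₑ ∁ₑ z) ∪ₑ ⊥ₑ) ∪ₑ e }) []) ∷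
       rk-∪⁅⁆-≤ _ zero ∷ [])

-- Chains as merges, and words

module _ {A A′ B B′ : Set} {ok : A → B → Set} {ok′ : A′ → B′ → Set} (f : A → A′) (g : B → B′) where

  path-map : (∀ {a b} → ok a b → ok′ (f a) (g b)) → ∀ {as bs} → Path ok as bs → Path ok′ (map f as) (map g bs)
  path-map h (stop o refl) = stop (h o) refl
  path-map h (goˡ o p) = goˡ (h o) (path-map h p)
  path-map h (goʳ o p) = goʳ (h o) (path-map h p)

-- The image under `g` forgets the original state, so the side conditions needed to recover `ok′`
-- are supplied along the two lists.
path-unmap : ∀ {A B B′ : Set} {ok : A → B → Set} {ok′ : A → B′ → Set} {P : A → Set} {P′ : B′ → Set} (g : B′ → B) →
             (∀ {a b} → P a → P′ b → ok a (g b) → ok′ a b) → ∀ {as bs} → All P as → All P′ bs →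
             Path ok as (map g bs) → Path ok′ as bs
path-unmap g h {as = _ ∷ _} {bs = _ ∷ []} (pa ∷ _) (pb ∷ _) (stop o _) = stop (h pa pb o) refl
path-unmap g h {bs = _ ∷ _} (pa ∷ pas) (pb ∷ pbs) (goˡ o p) = goˡ (h pa pb o) (path-unmap g h pas (pb ∷ pbs) p)
path-unmap g h {bs = _ ∷ _} (pa ∷ pas) (pb ∷ pbs) (goʳ o p) = goʳ (h pa pb o) (path-unmap g h (pa ∷ pas) pbs p)

path-all : ∀ {A B : Set} {ok : A → B → Set} {P : B → Set} → (∀ {a b} → ok a b → P b) → ∀ {as bs} → Path ok as bs →
  All P bs
path-all h (stop o refl) = h o ∷ []
path-all h (goˡ o p) = path-all h p
path-all h (goʳ o p) = h o ∷ path-all h p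

sets : ∀ {n} {P : Subset n → Set} {X Y} → Chain P X Y → List (Subset n)
sets {X = X} [ _ ] = X ∷ []
sets {X = X} (_ ∷⟨ _ ⟩ c) = X ∷ sets c

sets-all : ∀ {n} {P : Subset n → Set} {X Y} (c : Chain P X Y) → All P (sets c)
sets-all [ p ] = p ∷ []
sets-all (p ∷⟨ _ ⟩ c) = p ∷ sets-all c

module _ {n} {R : Subset n → Subset n → Set} (⊆⇒R : ∀ X Y → X ⊆ Y → R X Y) where

  sets-above : ∀ {P : Subset n → Set} {W X Y} → W ⊆ X → (c : Chain P X Y) → All (R W) (sets c)
  sets-above W⊆X [ _ ] = ⊆⇒R _ _ W⊆X ∷ []
  sets-above W⊆X (_ ∷⟨ s ⟩ c) = ⊆⇒R _ _ W⊆X ∷ sets-above (⊆-trans W⊆X (grows s)) c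

  sets-nested : ∀ {P : Subset n → Set} {X Y} (c : Chain P X Y) → AllPairs R (sets c)
  sets-nested [ _ ] = [] ∷ []
  sets-nested (_ ∷⟨ s ⟩ c) = sets-above (grows s) c ∷ sets-nested c

sets-map : ∀ {m n} {P : Subset m → Set} {P′ : Subset n → Set} (f : Subset m → Subset n)
           (s : ∀ {X Y} → Step X Y → Step (f X) (f Y)) (g : ∀ {X} → P X → P′ (f X)) {X Y} (c : Chain P X Y) →
           sets (chain-map {P′ = P′} f s g c) ≡ map f (sets c)
sets-map f s g [ _ ] = refl
sets-map f s g (_ ∷⟨ _ ⟩ c) = cong (f _ ∷_) (sets-map f s g c)

one-side : ∀ {n} {A B : Subset n} → (∀ {x} → x ∈ A → x ∉ B) → ∀ {Z Z′} → Step Z Z′ → Z′ ∩ A ≡ Z ∩ A ⊎ Z′ ∩ B ≡ Z ∩ B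
one-side {A = A} {B} disj {Z} {Z′} s with nonempty? ((Z′ ∩ A) ∩ ∁ Z)
... | no ¬new = inj₁ (⊆-antisym sub (λ x∈ → let a , b = x∈p∩q⁻ Z A x∈ in x∈p∩q⁺ (grows s a , b)))
  where
  sub : Z′ ∩ A ⊆ Z ∩ A
  sub {x} x∈ with x ∈? Z
  ... | yes p = x∈p∩q⁺ (p , p∩q⊆q Z′ A x∈)
  ... | no p = Empty.⊥-elim (¬new (x , x∈p∩q⁺ (x∈ , x∉p⇒x∈∁p p)))
... | yes (x , x∈) = inj₂ (⊆-antisym sub (λ y∈ → let a , b = x∈p∩q⁻ Z B y∈ in x∈p∩q⁺ (grows s a , b)))
  where
  x∈Z′A = p∩q⊆p (Z′ ∩ A) (∁ Z) x∈
  sub : Z′ ∩ B ⊆ Z ∩ B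
  sub {y} y∈ with y ∈? Z
  ... | yes p = x∈p∩q⁺ (p , p∩q⊆q Z′ B y∈)
  ... | no p = Empty.⊥-elim (disj (subst (_∈ A) x≡y (p∩q⊆q Z′ A x∈Z′A)) (p∩q⊆q Z′ B y∈))
    where
    x≡y : x ≡ y
    x≡y = new-unique s (p∩q⊆p Z′ A x∈Z′A) (x∈∁p⇒x∉p (p∩q⊆q (Z′ ∩ A) (∁ Z) x∈)) (p∩q⊆p Z′ B y∈) p

-- A step of a chain becomes a move to the left state followed by a move to the right state. As only
-- one of the two traces changes, the intermediate pair is the old or the new pair and needs no
-- check of its own.
corner : ∀ {A B : Set} {ok : A → B → Set} {a a′ b b′} → a′ ≡ a ⊎ b′ ≡ b → ok a b → ok a′ b′ → ok a′ b
corner {ok = ok} {b = b} (inj₁ eq) o _ = subst (λ a → ok a b) (sym eq) o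
corner {ok = ok} {a′ = a′} (inj₂ eq) _ o = subst (ok a′) eq o

chain⇒path : ∀ {n} {P : Subset n → Set} {ok : Subset n → Subset n → Set} {A B : Subset n} →
  (∀ {x} → x ∈ A → x ∉ B) →
             (∀ {Z} → P Z → ok (Z ∩ A) (Z ∩ B)) → ∀ {X Y} (c : Chain P X Y) → Path ok (map (_∩ A) (sets c))
               (map (_∩ B) (sets c))
chain⇒path disj h [ p ] = stop (h p) refl
chain⇒path {ok = ok} disj h (p ∷⟨ s ⟩ [ p′ ]) =
  goˡ (h p) (goʳ (corner {ok = ok} (one-side disj s) (h p) (h p′)) (stop (h p′) refl))
chain⇒path {ok = ok} disj h (p ∷⟨ s ⟩ c@(p′ ∷⟨ _ ⟩ _)) =
  goˡ (h p) (goʳ (corner {ok = ok} (one-side disj s) (h p) (h p′)) (chain⇒path disj h c))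

step-∪ʳ : ∀ {n} {X Y : Subset n} W → Step X Y → Step (W ∪ X) (W ∪ Y)
step-∪ʳ {X = X} {Y} W s = subst₂ Step (∪-comm X W) (∪-comm Y W) (step-∪ W s)

path⇒chain : ∀ {n} {P P₁ P₂ : Subset n → Set} {ok : Subset n → Subset n → Set} → (∀ {X Y} → ok X Y → P (X ∪ Y)) →
             ∀ {X X′ Y Y′} (c : Chain P₁ X X′) (d : Chain P₂ Y Y′) → Path ok (sets c) (sets d) → Chain P (X ∪ Y)
               (X′ ∪ Y′)
path⇒chain h [ _ ] [ _ ] (stop o _) = [ h o ]
path⇒chain h [ _ ] (_ ∷⟨ _ ⟩ [ _ ]) (stop o ())
path⇒chain h [ _ ] (_ ∷⟨ _ ⟩ (_ ∷⟨ _ ⟩ _)) (stop o ())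
path⇒chain h [ _ ] [ _ ] (goˡ o ())
path⇒chain h [ _ ] (_ ∷⟨ _ ⟩ _) (goˡ o ())
path⇒chain {P₁ = P₁} h (_ ∷⟨ s ⟩ [ p ]) d@([ _ ]) (goˡ o q) = h o ∷⟨ step-∪ _ s ⟩ path⇒chain {P₁ = P₁} h [ p ] d q
path⇒chain {P₁ = P₁} h (_ ∷⟨ s ⟩ [ p ]) d@(_ ∷⟨ _ ⟩ _) (goˡ o q) =
  h o ∷⟨ step-∪ _ s ⟩ path⇒chain {P₁ = P₁} h [ p ] d q
path⇒chain h (_ ∷⟨ s ⟩ c@(_ ∷⟨ _ ⟩ _)) d@([ _ ]) (goˡ o q) = h o ∷⟨ step-∪ _ s ⟩ path⇒chain h c d q
path⇒chain h (_ ∷⟨ s ⟩ c@(_ ∷⟨ _ ⟩ _)) d@(_ ∷⟨ _ ⟩ _) (goˡ o q) = h o ∷⟨ step-∪ _ s ⟩ path⇒chain h c d q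
path⇒chain h c@([ _ ]) [ _ ] (goʳ o ())
path⇒chain h c@(_ ∷⟨ _ ⟩ _) [ _ ] (goʳ o ())
path⇒chain h c@([ _ ]) (_ ∷⟨ s ⟩ d) (goʳ o q) = h o ∷⟨ step-∪ʳ _ s ⟩ path⇒chain h c d q
path⇒chain h c@(_ ∷⟨ _ ⟩ _) (_ ∷⟨ s ⟩ d) (goʳ o q) = h o ∷⟨ step-∪ʳ _ s ⟩ path⇒chain h c d q

subsetCode : ∀ {m} → Subset m → Fin (2 ^ m)
subsetCode [] = zero
subsetCode (true ∷ S) = combine {2} zero (subsetCode S)
subsetCode (false ∷ S) = combine {2} (suc zero) (subsetCode S)

subsetCode-injective : ∀ {m} {S T : Subset m} → subsetCode S ≡ subsetCode T → S ≡ T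
subsetCode-injective {S = []} {[]} _ = refl
subsetCode-injective {suc m} {true ∷ S} {true ∷ T} eq = cong (true ∷_)
  (subsetCode-injective (proj₂ (combine-injective {2} zero (subsetCode S) zero (subsetCode T) eq)))
subsetCode-injective {suc m} {true ∷ S} {false ∷ T} eq with () ← proj₁
  (combine-injective {2} zero (subsetCode S) (suc zero) (subsetCode T) eq)
subsetCode-injective {suc m} {false ∷ S} {true ∷ T} eq with () ← proj₁
  (combine-injective {2} (suc zero) (subsetCode S) zero (subsetCode T) eq)
subsetCode-injective {suc m} {false ∷ S} {false ∷ T} eq = cong (false ∷_)
  (subsetCode-injective (proj₂ (combine-injective {2} (suc zero) (subsetCode S) (suc zero) (subsetCode T) eq)))

Letter : ℕ → Set
Letter Q = (Subset Q × Subset Q) × ℕ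

module WordCode (Q Q′ G : ℕ) (Q≤Q′ : Q ≤ Q′) where

  -- The number of points Q depends on t, which comes out of the extraction. The count of words must
  -- be fixed beforehand and uses the bound `Q′` instead.
  paddedCode : Subset Q → Fin (2 ^ Q′)
  paddedCode S = inject≤ (subsetCode S) (^-monoʳ-≤ 2 Q≤Q′)

  paddedCode-injective : ∀ {S T} → paddedCode S ≡ paddedCode T → S ≡ T
  paddedCode-injective eq = subsetCode-injective (inject≤-injective _ _ _ _ eq)

  alphabet : ℕ
  alphabet = 2 ^ Q′ * 2 ^ Q′ * G

  Small : Letter Q → Set
  Small b = proj₂ b < G

  letterCode : ∀ b → Small b → Fin alphabet
  letterCode ((R , S) , g) g<G = combine (combine (paddedCode R) (paddedCode S)) (fromℕ< g<G)

  letterCode-injective : ∀ {b c} h h′ → letterCode b h ≡ letterCode c h′ → b ≡ c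
  letterCode-injective h h′ eq with e₁ , e₂ ← combine-injective _ _ _ _ eq with e₃ ,
    e₄ ← combine-injective _ _ _ _ e₁ =
    cong₂ _,_ (cong₂ _,_ (paddedCode-injective e₃) (paddedCode-injective e₄)) (fromℕ<-injective _ _ h h′ e₂)

  -- The additional symbol zero fills a word up to length ℓ; being no letter code, it keeps words of
  -- different lengths apart.
  wordCode : ∀ ℓ w → All Small w → Fin (suc alphabet ^ ℓ)
  wordCode zero w _ = zero
  wordCode (suc ℓ) [] _ = combine {suc alphabet} zero (wordCode ℓ [] [])
  wordCode (suc ℓ) (b ∷ w) (h ∷ hs) = combine (suc (letterCode b h)) (wordCode ℓ w hs)

  wordCode-injective : ∀ ℓ {u w} (h : All Small u) (h′ : All Small w) → length u ≤ ℓ → length w ≤ ℓ →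
                       wordCode ℓ u h ≡ wordCode ℓ w h′ → u ≡ w
  wordCode-injective zero {[]} {[]} _ _ _ _ _ = refl
  wordCode-injective (suc ℓ) {[]} {[]} _ _ _ _ _ = refl
  wordCode-injective (suc ℓ) {[]} {b ∷ w} _ (h ∷ hs) _ _ eq with () ← proj₁
    (combine-injective {suc alphabet} zero (wordCode ℓ [] []) (suc (letterCode b h)) (wordCode ℓ w hs) eq)
  wordCode-injective (suc ℓ) {b ∷ w} {[]} (h ∷ hs) _ _ _ eq with () ← proj₁
    (combine-injective {suc alphabet} (suc (letterCode b h)) (wordCode ℓ w hs) zero (wordCode ℓ [] []) eq)
  wordCode-injective (suc ℓ) {b ∷ u} {c ∷ w} (h ∷ hs) (h′ ∷ hs′) (s≤s l) (s≤s l′) eq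
    with e₁ , e₂ ← combine-injective (suc (letterCode b h)) (wordCode ℓ u hs) (suc (letterCode c h′))
      (wordCode ℓ w hs′) eq =
    cong₂ _∷_ (letterCode-injective h h′ (suc-injective e₁)) (wordCode-injective ℓ hs hs′ l l′ e₂)

-- The value of an admissible letter is at most k + t: the traces have dimension at most t, and
-- `letterOk-small` combines this with `t ≤ suc k`.
maxValue : ℕ → ℕ
maxValue k = suc k + suc k

maxLength : ℕ → ℕ → ℕ
maxLength q k = suc (q ^ suc k + q ^ suc k) * 4 ^ maxValue k

numWords : ℕ → ℕ → ℕ
numWords q k = suc (2 ^ (q ^ suc k) * 2 ^ (q ^ suc k) * maxValue k) ^ maxLength q k

-- Exchanging the left sides of two minors

module Core {n} {M : Matroid n} {q} (1<q : 1 < q) (Sp : SpanSystem M q) {t p} (ch : LinkedChain M t p) (k : ℕ)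
  (t≤ : t ≤ suc k) where

  open Frames 1<q Sp ch
  open Rank M

  B : ℕ → Subset n
  B m = ∁ (A m)

  -- X and Y are the two parts of a prefix of width at most k in the minor joining A j and B m.
  record SetOk (j m : ℕ) (X Y : Subset n) : Set where
    field
      X⊆A   : X ⊆ A j
      Y⊆B   : Y ⊆ B m
      bound : rk (X ∪ (Y ∪ C j m)) + rk ((A j ∩ ∁ X) ∪ ((B m ∩ ∁ Y) ∪ C j m)) ≤ k + rk (C j m) + rk
        (A j ∪ (B m ∪ C j m))

  -- The bound of `SetOk` after the ranks of the unions are replaced by the dimensions d₁ and d₂ of
  -- common traces, and the connectivity of the joined minor by t. Neither the right index nor the
  -- contracted set is left, so a letter from any right side can be tested against `A j`.
  record LetterOk (j : ℕ) (X : Subset n) (b : Letter Q) : Set where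
    field
      d₁ d₂ : ℕ
      card₁ : ∣ L j X ∩ proj₁ (proj₁ b) ∣ ≡ q ^ d₁
      card₂ : ∣ L j (A j ∩ ∁ X) ∩ proj₂ (proj₁ b) ∣ ≡ q ^ d₂
      bound : rk X + rk (A j ∩ ∁ X) + proj₂ b + t ≤ k + rk (A j) + d₁ + d₂

  letter : ℕ → Subset n → Letter Q
  letter m Y = (L m Y , L m (B m ∩ ∁ Y)) , rk Y + rk (B m ∩ ∁ Y) ∸ rk (B m)

  rk-split : ∀ A X → rk A ≤ rk X + rk (A ∩ ∁ X)
  rk-split A X = ≤-trans (m≤m+n _ _) (submod X (A ∩ ∁ X) A ⊥
    (decide-⊆ (A ∷ X ∷ []) (λ { (a ∷ x ∷ []) → [] , a ⊆ₑ x ∪ₑ (a ∩ₑ ∁ₑ x) }) []) (⊆-min _))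

  module _ {j m} (j≤m : j ≤ m) {X Y : Subset n} (X⊆A : X ⊆ A j) (Y⊆B : Y ⊆ B m) where

    private
      X̅ = A j ∩ ∁ X
      Y̅ = B m ∩ ∁ Y
      g = rk Y + rk Y̅ ∸ rk (B m)
      g-eq : g + rk (B m) ≡ rk Y + rk Y̅
      g-eq = m∸n+n≡m (rk-split (B m) Y)
      e₁ = ∣L∩L∣ j≤m X Y X⊆A Y⊆B
      e₂ = ∣L∩L∣ j≤m X̅ Y̅ (p∩q⊆p _ _) (p∩q⊆p _ _)

    setOk⇒letterOk : SetOk j m X Y → LetterOk j X (letter m Y)
    setOk⇒letterOk o = record { d₁ = proj₁ e₁ ; d₂ = proj₁ e₂ ; card₁ = proj₁ (proj₂ e₁) ; card₂ = proj₁ (proj₂ e₂)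
      ; bound = linear
      (rk X ∷ rk X̅ ∷ rk Y ∷ rk Y̅ ∷ g ∷ t ∷ k ∷ rk (A j) ∷ rk (B m) ∷ rk (C j m) ∷ proj₁ e₁ ∷ proj₁ e₂
        ∷ rk (X ∪ (Y ∪ C j m)) ∷ rk (X̅ ∪ (Y̅ ∪ C j m)) ∷ rk (A j ∪ (B m ∪ C j m)) ∷ [])
      (λ { (x ∷ x̅ ∷ y ∷ y̅ ∷ g ∷ t ∷ k ∷ a ∷ b ∷ c ∷ d₁ ∷ d₂ ∷ u ∷ v ∷ w ∷ []) →
        (1 , g +ₑ b ≤ₑ y +ₑ y̅) ∷ (1 , x +ₑ y +ₑ c ≤ₑ d₁ +ₑ u) ∷ (1 , x̅ +ₑ y̅ +ₑ c ≤ₑ d₂ +ₑ v) ∷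
          (1 , t +ₑ w ≤ₑ a +ₑ b +ₑ c) ∷ (1 , u +ₑ v ≤ₑ k +ₑ c +ₑ w) ∷ [] ,
        x +ₑ x̅ +ₑ g +ₑ t ≤ₑ k +ₑ a +ₑ d₁ +ₑ d₂ })
      (≤-reflexive g-eq ∷ ≤-reflexive (sym (proj₂ (proj₂ e₁))) ∷ ≤-reflexive (sym (proj₂ (proj₂ e₂))) ∷ ≤-reflexive
        (rk-total j≤m) ∷ SetOk.bound o ∷ []) }

    letterOk⇒setOk : LetterOk j X (letter m Y) → SetOk j m X Y
    letterOk⇒setOk o = record { X⊆A = X⊆A ; Y⊆B = Y⊆B ; bound = linear
      (rk X ∷ rk X̅ ∷ rk Y ∷ rk Y̅ ∷ g ∷ t ∷ k ∷ rk (A j) ∷ rk (B m) ∷ rk (C j m) ∷ d₁ ∷ d₂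
        ∷ rk (X ∪ (Y ∪ C j m)) ∷ rk (X̅ ∪ (Y̅ ∪ C j m)) ∷ rk (A j ∪ (B m ∪ C j m)) ∷ proj₁ e₁ ∷ proj₁ e₂ ∷ [])
      (λ { (x ∷ x̅ ∷ y ∷ y̅ ∷ g ∷ t ∷ k ∷ a ∷ b ∷ c ∷ d₁ ∷ d₂ ∷ u ∷ v ∷ w ∷ d₁′ ∷ d₂′ ∷ []) →
        (1 , y +ₑ y̅ ≤ₑ g +ₑ b) ∷ (1 , d₁′ +ₑ u ≤ₑ x +ₑ y +ₑ c) ∷ (1 , d₂′ +ₑ v ≤ₑ x̅ +ₑ y̅ +ₑ c) ∷
          (1 , a +ₑ b +ₑ c ≤ₑ t +ₑ w) ∷
        (1 , x +ₑ x̅ +ₑ g +ₑ t ≤ₑ k +ₑ a +ₑ d₁ +ₑ d₂) ∷ (1 , d₁ ≤ₑ d₁′) ∷ (1 , d₂ ≤ₑ d₂′) ∷ [] ,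
        u +ₑ v ≤ₑ k +ₑ c +ₑ w })
      (≤-reflexive (sym g-eq) ∷ ≤-reflexive (proj₂ (proj₂ e₁)) ∷ ≤-reflexive (proj₂ (proj₂ e₂)) ∷ ≤-reflexive
        (sym (rk-total j≤m)) ∷ bound ∷
       ≤-reflexive (^-injectiveʳ 1<q (trans (sym card₁) (proj₁ (proj₂ e₁)))) ∷ ≤-reflexive
         (^-injectiveʳ 1<q (trans (sym card₂) (proj₁ (proj₂ e₂)))) ∷ []) }
      where open LetterOk o

  letterOk-mono : ∀ {j X b c} → proj₁ b ≡ proj₁ c → proj₂ b ≤ proj₂ c → LetterOk j X c → LetterOk j X b
  letterOk-mono {j} {X} {b} {c} refl b≤c o = record { d₁ = d₁ ; d₂ = d₂ ; card₁ = card₁ ; card₂ = card₂ ; bound =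
    ≤-trans (+-monoˡ-≤ t (+-monoʳ-≤ (rk X + rk (A j ∩ ∁ X)) b≤c)) bound }
    where open LetterOk o

  exponent-≤ : ∀ {d} (S : Subset Q) → ∣ S ∣ ≡ q ^ d → d ≤ t
  exponent-≤ {d} S eq = ≮⇒≥ (λ t<d → <⇒≱ (^-monoʳ-< q 1<q t<d)
    (≤-trans (≤-reflexive (sym eq)) (≤-trans (∣p∣≤n S) (≤-reflexive Q≡q^t))))

  letterOk-small : ∀ {j X b} → LetterOk j X b → proj₂ b < maxValue k
  letterOk-small {j} {X} {b} o = linear
    (rk X ∷ rk (A j ∩ ∁ X) ∷ proj₂ b ∷ t ∷ k ∷ rk (A j) ∷ d₁ ∷ d₂ ∷ [])
    (λ { (x ∷ x̅ ∷ g ∷ t ∷ k ∷ a ∷ d₁ ∷ d₂ ∷ []) →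
      (1 , x +ₑ x̅ +ₑ g +ₑ t ≤ₑ k +ₑ a +ₑ d₁ +ₑ d₂) ∷ (1 , a ≤ₑ x +ₑ x̅) ∷ (1 , d₁ ≤ₑ t) ∷ (1 , d₂ ≤ₑ t) ∷
        (1 , t ≤ₑ con 1 +ₑ k) ∷ [] ,
      con 1 +ₑ g ≤ₑ (con 1 +ₑ k) +ₑ (con 1 +ₑ k) })
    (bound ∷ rk-split (A j) X ∷ exponent-≤ (L j X ∩ proj₁ (proj₁ b)) card₁ ∷ exponent-≤
      (L j (A j ∩ ∁ X) ∩ proj₂ (proj₁ b)) card₂ ∷ t≤ ∷ [])
    where open LetterOk o

  -- The minor on `A i` and `B m` arises from the one on `A j` and `B m` by contracting the elements
  -- of `contracted` in `A j ∩ ∁ (A i)` and deleting the others. By `minor-mono` the connectivities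
  -- do not increase.
  restrict : ∀ {i j m X Y} → i ≤ j → j ≤ m → SetOk j m X Y → SetOk i m (X ∩ A i) Y
  restrict {i} {j} {m} {X} {Y} i≤j j≤m o = record { X⊆A = p∩q⊆q X (A i) ; Y⊆B = Y⊆B ; bound = linear
    (rk P ∷ rk R ∷ rk (C j m) ∷ rk (C i m) ∷ rk P′ ∷ rk R′ ∷ rk (P ∩ R) ∷ rk (P ∪ R) ∷ rk (P′ ∪ R′) ∷ k ∷ rk
      (A j ∪ (B m ∪ C j m)) ∷ rk (A i ∪ (B m ∪ C i m)) ∷ [])
    (λ { (p ∷ q ∷ c ∷ c′ ∷ p′ ∷ q′ ∷ pq ∷ p∪q ∷ u ∷ k ∷ w ∷ w′ ∷ []) →
      (1 , p +ₑ q ≤ₑ k +ₑ c +ₑ w) ∷ (1 , p′ +ₑ q′ +ₑ pq +ₑ p∪q ≤ₑ p +ₑ q +ₑ c′ +ₑ u) ∷ (1 , c ≤ₑ pq) ∷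
        (1 , w ≤ₑ p∪q) ∷ (1 , u ≤ₑ w′) ∷ [] ,
      p′ +ₑ q′ ≤ₑ k +ₑ c′ +ₑ w′ })
    (bound ∷
     minor-mono P R (C i m) P′ R′
       (incl (λ { (z ∷ ai ∷ aj ∷ am ∷ x ∷ y ∷ []) → pₑ z aj am x y ∩ₑ rₑ z aj am x y ⊆ₑ cₑ z ai am }))
       (incl (λ { (z ∷ ai ∷ aj ∷ am ∷ x ∷ y ∷ []) → cₑ z ai am ⊆ₑ pₑ z aj am x y ∪ₑ rₑ z aj am x y }))
       (incl (λ { (z ∷ ai ∷ aj ∷ am ∷ x ∷ y ∷ []) → cₑ z ai am ⊆ₑ pₑ z ai am (x ∩ₑ ai) y }))
       (incl (λ { (z ∷ ai ∷ aj ∷ am ∷ x ∷ y ∷ []) → pₑ z ai am (x ∩ₑ ai) y ⊆ₑ pₑ z aj am x y ∪ₑ cₑ z ai am }))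
       (incl (λ { (z ∷ ai ∷ aj ∷ am ∷ x ∷ y ∷ []) → cₑ z ai am ⊆ₑ rₑ z ai am (x ∩ₑ ai) y }))
       (incl (λ { (z ∷ ai ∷ aj ∷ am ∷ x ∷ y ∷ []) → rₑ z ai am (x ∩ₑ ai) y ⊆ₑ rₑ z aj am x y ∪ₑ cₑ z ai am })) ∷
     r-mono M (incl (λ { (z ∷ ai ∷ aj ∷ am ∷ x ∷ y ∷ []) → cₑ z aj am ⊆ₑ pₑ z aj am x y ∩ₑ rₑ z aj am x y })) ∷
     r-mono M (incl (λ { (z ∷ ai ∷ aj ∷ am ∷ x ∷ y ∷ []) → aj ∪ₑ
       (∁ₑ am ∪ₑ cₑ z aj am) ⊆ₑ pₑ z aj am x y ∪ₑ rₑ z aj am x y })) ∷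
     r-mono M (incl (λ { (z ∷ ai ∷ aj ∷ am ∷ x ∷ y ∷ []) → pₑ z ai am (x ∩ₑ ai) y ∪ₑ rₑ z ai am (x ∩ₑ ai) y ⊆ₑ ai ∪ₑ
       (∁ₑ am ∪ₑ cₑ z ai am) })) ∷ []) }
    where
    open SetOk o
    P = X ∪ (Y ∪ C j m)
    R = (A j ∩ ∁ X) ∪ ((B m ∩ ∁ Y) ∪ C j m)
    P′ = (X ∩ A i) ∪ (Y ∪ C i m)
    R′ = (A i ∩ ∁ (X ∩ A i)) ∪ ((B m ∩ ∁ Y) ∪ C i m)
    cₑ : ∀ {l} → (z a am : SetSolver.Expr l) → SetSolver.Expr l
    cₑ z a am = z ∩ₑ am ∩ₑ ∁ₑ a
    pₑ rₑ : ∀ {l} → (z a am x y : SetSolver.Expr l) → SetSolver.Expr l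
    pₑ z a am x y = x ∪ₑ (y ∪ₑ cₑ z a am)
    rₑ z a am x y = (a ∩ₑ ∁ₑ x) ∪ₑ ((∁ₑ am ∩ₑ ∁ₑ y) ∪ₑ cₑ z a am)
    incl = decide-⊆-under (contracted ∷ A i ∷ A j ∷ A m ∷ X ∷ Y ∷ [])
      (λ { (z ∷ ai ∷ aj ∷ am ∷ x ∷ y ∷ []) → (ai ⊆ₑ aj) ∷ (aj ⊆ₑ am) ∷ (x ⊆ₑ aj) ∷ (y ⊆ₑ ∁ₑ am) ∷ [] })
      (A-mono i≤j ∷ A-mono j≤m ∷ X⊆A ∷ Y⊆B ∷ [])

  -- For equal indices nothing is contracted and `A m`, `B m` are complementary, so the joined minor
  -- is M itself.
  setOk⇒cut : ∀ {m X Y} → SetOk m m X Y → cut (X ∪ Y) ≤ k + rk ⊤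
  setOk⇒cut {m} {X} {Y} o = linear
    (rk (X ∪ Y) ∷ rk (∁ (X ∪ Y)) ∷ rk (X ∪ (Y ∪ C m m)) ∷ rk ((A m ∩ ∁ X) ∪ ((B m ∩ ∁ Y) ∪ C m m)) ∷ k ∷ rk
      (C m m) ∷ rk (A m ∪ (B m ∪ C m m)) ∷ rk ⊤ ∷ rk ⊥ ∷ [])
    (λ { (u ∷ u̅ ∷ v ∷ v̅ ∷ k ∷ c ∷ w ∷ e ∷ b ∷ []) →
      (1 , v +ₑ v̅ ≤ₑ k +ₑ c +ₑ w) ∷ (1 , u ≤ₑ v) ∷ (1 , u̅ ≤ₑ v̅) ∷ (1 , c ≤ₑ b) ∷ (1 , b ≤ₑ con 0) ∷
        (1 , w ≤ₑ e) ∷ [] , u +ₑ u̅ ≤ₑ k +ₑ e })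
    (SetOk.bound o ∷
     r-mono M (decide-⊆ (X ∷ Y ∷ C m m ∷ []) (λ { (x ∷ y ∷ c ∷ []) → [] , x ∪ₑ y ⊆ₑ x ∪ₑ (y ∪ₑ c) }) []) ∷
     r-mono M (decide-⊆ (X ∷ Y ∷ C m m ∷ A m ∷ [])
       (λ { (x ∷ y ∷ c ∷ a ∷ []) → [] , ∁ₑ (x ∪ₑ y) ⊆ₑ (a ∩ₑ ∁ₑ x) ∪ₑ ((∁ₑ a ∩ₑ ∁ₑ y) ∪ₑ c) }) []) ∷
     r-mono M (decide-⊆ (contracted ∷ A m ∷ []) (λ { (z ∷ a ∷ []) → [] , z ∩ₑ a ∩ₑ ∁ₑ a ⊆ₑ ⊥ₑ }) []) ∷
     ≤-reflexive rk-⊥ ∷ r-mono M (⊆-max _) ∷ [])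

  open Compression LetterOk proj₁ proj₂ letterOk-mono

  level : Subset Q × Subset Q → ℕ
  level (R , S) = ∣ R ∣ + ∣ ∁ S ∣

  -- As Y grows, its trace grows and the trace of the rest shrinks, so both summands of `level`
  -- increase. If the sum stays the same, both sets keep their size and hence do not change. Levels
  -- range from 0 to `Q + Q`.
  letter-ordered : ∀ m {Y Y′} → Y ⊆ Y′ → Ordered level (letter m Y) (letter m Y′)
  letter-ordered m {Y} {Y′} Y⊆Y′ = +-mono-≤ ∣R∣≤ ∣S∣≤ , λ eq → cong₂ _,_
    (⊆-antisym R⊆ (⊆∧∣∣≥⇒⊇ R⊆ (+-cancelʳ-≤ _ _ _ (≤-trans (≤-reflexive (sym eq)) (+-monoʳ-≤ ∣ R ∣ ∣S∣≤)))))
    (⊆-antisym (λ {x} x∈ → x∉∁p⇒x∈p (λ x∈∁ → x∈∁p⇒x∉p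
      (⊆∧∣∣≥⇒⊇ S⊆ (+-cancelˡ-≤ ∣ R ∣ _ _ (≤-trans (+-monoˡ-≤ _ ∣R∣≤) (≤-reflexive (sym eq)))) x∈∁) x∈)) S′⊆S)
    where
    R = L m Y
    R′ = L m Y′
    S = L m (B m ∩ ∁ Y)
    S′ = L m (B m ∩ ∁ Y′)
    R⊆ : R ⊆ R′
    R⊆ = L-mono m Y⊆Y′
    S′⊆S : S′ ⊆ S
    S′⊆S = L-mono m (decide-⊆ (B m ∷ Y ∷ Y′ ∷ [])
      (λ { (b ∷ y ∷ y′ ∷ []) → (y ⊆ₑ y′) ∷ [] , b ∩ₑ ∁ₑ y′ ⊆ₑ b ∩ₑ ∁ₑ y }) (Y⊆Y′ ∷ []))
    S⊆ : ∁ S ⊆ ∁ S′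
    S⊆ = p⊆q⇒∁p⊇∁q S′⊆S
    ∣R∣≤ : ∣ R ∣ ≤ ∣ R′ ∣
    ∣R∣≤ = p⊆q⇒∣p∣≤∣q∣ R⊆
    ∣S∣≤ : ∣ ∁ S ∣ ≤ ∣ ∁ S′ ∣
    ∣S∣≤ = p⊆q⇒∣p∣≤∣q∣ S⊆

  module MinorAt (ex : ExcludedMinorPW M k) {i} (i<p : i < p) where

    -- The elements of `A (suc i)` outside `A i` are either contracted or in D, so `A i` and
    -- `B (suc i)` remain. Strictness of the chain makes this minor proper.
    D : Subset n
    D = A (suc i) ∩ ∁ (A i) ∩ ∁ contracted

    private
      C′ = C i (suc i)

      disjoint : ∀ x → x ∈ C′ → x ∉ D
      disjoint x x∈C x∈D = x∈∁p⇒x∉p (p∩q⊆q _ _ (p∩q⊆q _ _ x∈D)) (p∩q⊆p _ _ x∈C)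

      nonempty : Nonempty (C′ ∪ D)
      nonempty with nonempty? (C′ ∪ D)
      ... | yes ne = ne
      ... | no empty = Empty.⊥-elim (A-strict i<p
        (⊆-antisym (A-step i) (λ {x} x∈ → [ (λ p → p) , (λ x∉ → Empty.⊥-elim (empty (x ,
              decide-⊆ (contracted ∷ A i ∷ A (suc i) ∷ [])
                (λ { (z ∷ a ∷ a′ ∷ []) → [] , a′ ∩ₑ ∁ₑ a ⊆ₑ (z ∩ₑ a′ ∩ₑ ∁ₑ a) ∪ₑ (a′ ∩ₑ ∁ₑ a ∩ₑ ∁ₑ z) }) []
                (x∈p∩q⁺ (x∈ , x∉))))) ]′
              (x∈p∪q⁻ (A i) (∁ (A i)) (subst (x ∈_) (sym (p∪∁p≡⊤ (A i))) ∈⊤)))))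

    G : Subset n
    G = ∁ (C′ ∪ D)

    open MinorOf M C′ D disjoint using (Separates)

    layout : Chain (Separates k) ⊥ G
    layout = excluded⇒minor-chain M ex C′ D disjoint nonempty

    separates⇒setOk : ∀ {Z} → Separates k Z → SetOk i (suc i) (Z ∩ A i) (Z ∩ B (suc i))
    separates⇒setOk {Z} (Z⊆G , h) = record { X⊆A = p∩q⊆q Z _ ; Y⊆B = p∩q⊆q Z _ ; bound =
      ≤-trans (+-mono-≤
        (r-mono M (incl (λ { (z ∷ a ∷ a′ ∷ s ∷ []) → (s ∩ₑ a) ∪ₑ ((s ∩ₑ ∁ₑ a′) ∪ₑ cₑ z a a′) ⊆ₑ s ∪ₑ cₑ z a a′ })))
        (r-mono M (incl (λ { (z ∷ a ∷ a′ ∷ s ∷ []) → (a ∩ₑ ∁ₑ (s ∩ₑ a)) ∪ₑ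
          ((∁ₑ a′ ∩ₑ ∁ₑ (s ∩ₑ ∁ₑ a′)) ∪ₑ cₑ z a a′) ⊆ₑ (gₑ z a a′ ∩ₑ ∁ₑ s) ∪ₑ cₑ z a a′ }))))
        (≤-trans h (+-monoʳ-≤ (k + rk C′)
        (r-mono M (incl (λ { (z ∷ a ∷ a′ ∷ s ∷ []) → gₑ z a a′ ∪ₑ cₑ z a a′ ⊆ₑ a ∪ₑ (∁ₑ a′ ∪ₑ cₑ z a a′) }))))) }
      where
      cₑ gₑ : ∀ {l} → (z a a′ : SetSolver.Expr l) → SetSolver.Expr l
      cₑ z a a′ = z ∩ₑ a′ ∩ₑ ∁ₑ a
      gₑ z a a′ = ∁ₑ (cₑ z a a′ ∪ₑ (a′ ∩ₑ ∁ₑ a ∩ₑ ∁ₑ z))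
      incl = decide-⊆-under (contracted ∷ A i ∷ A (suc i) ∷ Z ∷ [])
        (λ { (z ∷ a ∷ a′ ∷ s ∷ []) → (a ⊆ₑ a′) ∷ [] }) (A-step i ∷ [])

    A-disjoint-B : ∀ {x} → x ∈ A i → x ∉ B (suc i)
    A-disjoint-B x∈A x∈B = x∈∁p⇒x∉p x∈B (A-step i x∈A)

    lefts rights : List (Subset n)
    lefts = map (_∩ A i) (sets layout)
    rights = map (_∩ B (suc i)) (sets layout)

    path : Path (SetOk i (suc i)) lefts rights
    path = chain⇒path A-disjoint-B separates⇒setOk layout

    letters : List (Letter Q)
    letters = map (letter (suc i)) rights

    letter-path : Path (LetterOk i) lefts letters
    letter-path = subst (λ as → Path (LetterOk i) as letters) (map-id lefts)
      (path-map (λ X → X) (letter (suc i)) (λ o → setOk⇒letterOk (n≤1+n i) (SetOk.X⊆A o) (SetOk.Y⊆B o) o) path)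

    small : All (λ b → proj₂ b < maxValue k) letters
    small = path-all (λ {a} {b} o → letterOk-small {b = b} o) letter-path

    ordered : AllPairs (Ordered level) letters
    ordered = AllPairs.map⁺ (AllPairs.map⁺ (sets-nested
      (λ X Y X⊆Y → letter-ordered (suc i) (mono {X} {Y} X⊆Y)) layout))
      where
      mono : ∀ {X Y} → X ⊆ Y → X ∩ B (suc i) ⊆ Y ∩ B (suc i)
      mono {X} {Y} X⊆Y x∈ = let a , b = x∈p∩q⁻ X _ x∈ in x∈p∩q⁺ (X⊆Y a , b)

    compressed : Compressed letters (suc (suc (Q + Q) * 4 ^ maxValue k))
    compressed = compress level (suc (Q + Q)) (maxValue k) 0 letters (All.universal (λ _ → z≤n) letters)
      (All.universal (λ b → s≤s (+-mono-≤ (∣p∣≤n (proj₁ (proj₁ b))) (∣p∣≤n (∁ (proj₂ (proj₁ b)))))) letters) ordered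
        small

    open Compressed compressed public renaming (letters to letters′)

  Q≤ : Q ≤ q ^ suc k
  Q≤ = ≤-trans (≤-reflexive Q≡q^t) (^-monoʳ-≤ q {{>-nonZero (<-trans (s≤s z≤n) 1<q)}} t≤)

  -- If the minors at i < j have the same compressed word, the layout of A (suc i) inherited from the
  -- second one can be merged with the layout of B (suc i) used in the first.
  replace : (ex : ExcludedMinorPW M k) → ∀ {i j} (i<p : i < p) (j<p : j < p) → i < j →
            MinorAt.word ex i<p ≡ MinorAt.word ex j<p → PathWidth≤ M k
  replace ex {i} {j} i<p j<p i<j eq = chain⇒pathWidth M (subst₂ (Chain _) start end merged)
    where
    module I = MinorAt ex i<p
    module J = MinorAt ex j<p
    A⁺ = A (suc i)
    lefts′ : List (Subset n)
    lefts′ = map (_∩ A⁺) J.lefts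
    p₁ : Path (LetterOk (suc i)) lefts′ J.letters
    p₁ = path-map (_∩ A⁺) (letter (suc j))
      (λ o → let o′ = restrict i<j (n≤1+n j) o in setOk⇒letterOk (≤-trans i<j (n≤1+n j)) (SetOk.X⊆A o′) (SetOk.Y⊆B o′) o′) J.path
    -- The two compressions were made for the left sides `A j` and `A i`. The equivalences hold for
    -- every left side, here `A (suc i)`, so the letters of the minor at j can be exchanged for
    -- those of the minor at i through the common word.
    p₂ : Path (LetterOk (suc i)) lefts′ I.letters
    p₂ = subst (Path _ lefts′) (++-identityʳ I.letters) (_≈_.from I.equiv [] []
      (subst (λ w → Path (LetterOk (suc i)) lefts′ (w ++ [])) (sym eq) (_≈_.to J.equiv [] []
        (subst (Path _ lefts′) (sym (++-identityʳ J.letters)) p₁))))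
    cA : Chain (λ X → X ⊆ A⁺) ((⊥ ∩ A j) ∩ A⁺) ((J.G ∩ A j) ∩ A⁺)
    cA = chain-map {P′ = λ X → X ⊆ A⁺} (λ Z → (Z ∩ A j) ∩ A⁺) (step-∩ A⁺ ∘ step-∩ (A j))
      (λ {Z} _ → p∩q⊆q (Z ∩ A j) A⁺) J.layout
    cB : Chain (λ Y → Y ⊆ B (suc i)) (⊥ ∩ B (suc i)) (I.G ∩ B (suc i))
    cB = chain-map {P′ = λ Y → Y ⊆ B (suc i)} (_∩ B (suc i)) (step-∩ (B (suc i)))
      (λ {Z} _ → p∩q⊆q Z (B (suc i))) I.layout
    sets-cA : sets cA ≡ lefts′
    sets-cA = trans (sets-map {P′ = λ X → X ⊆ A⁺} (λ Z → (Z ∩ A j) ∩ A⁺) (step-∩ A⁺ ∘ step-∩ (A j))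
      (λ {Z} _ → p∩q⊆q (Z ∩ A j) A⁺) J.layout) (map-∘ (sets J.layout))
    sets-cB : sets cB ≡ I.rights
    sets-cB = sets-map {P′ = λ Y → Y ⊆ B (suc i)} (_∩ B (suc i)) (step-∩ (B (suc i)))
      (λ {Z} _ → p∩q⊆q Z (B (suc i))) I.layout
    -- Both indices are now `suc i`, the case in which `setOk⇒cut` turns the bound into one on M.
    p₃ : Path (SetOk (suc i) (suc i)) (sets cA) (sets cB)
    p₃ = path-unmap {P = λ X → X ⊆ A⁺} {P′ = λ Y → Y ⊆ B (suc i)} (letter (suc i))
      (λ {X} {Y} X⊆ Y⊆ o → letterOk⇒setOk ≤-refl {X} {Y} X⊆ Y⊆ o) (sets-all cA) (sets-all cB)
      (subst₂ (Path (LetterOk (suc i))) (sym sets-cA) (cong (map (letter (suc i))) (sym sets-cB)) p₂)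
    merged : Chain (λ Z → cut Z ≤ k + rk ⊤) (((⊥ ∩ A j) ∩ A⁺) ∪ (⊥ ∩ B (suc i)))
      (((J.G ∩ A j) ∩ A⁺) ∪ (I.G ∩ B (suc i)))
    merged = path⇒chain setOk⇒cut cA cB p₃
    start : ((⊥ ∩ A j) ∩ A⁺) ∪ (⊥ ∩ B (suc i)) ≡ ⊥
    start = ⊆-antisym (decide-⊆ (A j ∷ A⁺ ∷ [])
      (λ { (a ∷ a⁺ ∷ []) → [] , ((⊥ₑ ∩ₑ a) ∩ₑ a⁺) ∪ₑ (⊥ₑ ∩ₑ ∁ₑ a⁺) ⊆ₑ ⊥ₑ }) []) (⊆-min _)
    end : ((J.G ∩ A j) ∩ A⁺) ∪ (I.G ∩ B (suc i)) ≡ ⊤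
    end = ⊆-antisym (⊆-max _) (decide-⊆ (contracted ∷ A i ∷ A⁺ ∷ A j ∷ A (suc j) ∷ [])
      (λ { (z ∷ a ∷ a⁺ ∷ b ∷ b⁺ ∷ []) → (a⁺ ⊆ₑ b) ∷ [] ,
        ⊤ₑ ⊆ₑ ((∁ₑ ((z ∩ₑ b⁺ ∩ₑ ∁ₑ b) ∪ₑ (b⁺ ∩ₑ ∁ₑ b ∩ₑ ∁ₑ z)) ∩ₑ b) ∩ₑ a⁺) ∪ₑ
          (∁ₑ ((z ∩ₑ a⁺ ∩ₑ ∁ₑ a) ∪ₑ (a⁺ ∩ₑ ∁ₑ a ∩ₑ ∁ₑ z)) ∩ₑ ∁ₑ a⁺) })
      (A-mono i<j ∷ []))

  module _ (ex : ExcludedMinorPW M k) (numWords<p : numWords q k < p) where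

    private
      open WordCode Q (q ^ suc k) (maxValue k) Q≤

      word : Fin p → List (Letter Q)
      word i = MinorAt.word ex (toℕ<n i)

      small-word : ∀ i → All Small (word i)
      small-word i = MinorAt.letters′ ex (toℕ<n i) (MinorAt.small ex (toℕ<n i))

      short-word : ∀ i → length (word i) ≤ maxLength q k
      short-word i = ≤-trans (≤-pred (MinorAt.short ex (toℕ<n i)))
        (*-monoˡ-≤ (4 ^ maxValue k) (s≤s (+-mono-≤ Q≤ Q≤)))

      code : Fin p → Fin (numWords q k)
      code i = wordCode (maxLength q k) (word i) (small-word i)

      collision : (∃ λ i → ∃ λ j → toℕ i < toℕ j × code i ≡ code j) → PathWidth≤ M k
      collision (i , j , i<j , eq) = replace ex (toℕ<n i) (toℕ<n j) i<j
        (wordCode-injective (maxLength q k) (small-word i) (small-word j) (short-word i) (short-word j) eq)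

    too-long : Empty.⊥
    too-long = proj₁ ex (collision (pigeonhole numWords<p code))

-- The numerical bound

n<2^n : ∀ n → n < 2 ^ n
n<2^n zero = s≤s z≤n
n<2^n (suc n) = linear (n ∷ 2 ^ n ∷ []) (λ { (n ∷ p ∷ []) → (2 , con 1 +ₑ n ≤ₑ p) ∷ [] , con 2 +ₑ n ≤ₑ p +ₑ
  (p +ₑ con 0) }) (n<2^n n ∷ [])

module _ {q : ℕ} (1<q : 1 < q) (k : ℕ) where

  private
    Q = q ^ suc k

    q≢0 : NonZero q
    q≢0 = >-nonZero (<-trans (s≤s z≤n) 1<q)

  2+k≤Q : suc (suc k) ≤ Q
  2+k≤Q = ≤-trans (n<2^n (suc k)) (^-monoˡ-≤ (suc k) 1<q)

  private
    Q≢0 : NonZero Q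
    Q≢0 = >-nonZero (≤-trans (s≤s z≤n) 2+k≤Q)

    2≤Q : 2 ≤ Q
    2≤Q = ≤-trans (s≤s (s≤s z≤n)) 2+k≤Q

    4^maxValue : 4 ^ maxValue k ≤ Q ^ 4
    4^maxValue = begin
      4 ^ (suc k + suc k) ≡⟨ ^-*-assoc 2 2 (suc k + suc k) ⟩
      2 ^ (2 * (suc k + suc k)) ≤⟨ ^-monoˡ-≤ (2 * (suc k + suc k)) 1<q ⟩
      q ^ (2 * (suc k + suc k)) ≡⟨ cong (q ^_) (reorder (suc k)) ⟩
      q ^ (suc k * 4) ≡⟨ ^-*-assoc q (suc k) 4 ⟨
      Q ^ 4 ∎
      where
      open ≤-Reasoning
      reorder : ∀ x → 2 * (x + x) ≡ x * 4
      reorder x = trans (cong (2 *_) (trans (cong (x +_) (sym (+-identityʳ x))) (*-comm 2 x)))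
        (trans (*-comm 2 (x * 2)) (*-assoc x 2 2))

    small-factor : ∀ c a → c ≤ 2 ^ a → c ≤ Q ^ a
    small-factor c a h = ≤-trans h (^-monoˡ-≤ a 2≤Q)

    length≤ : maxLength q k ≤ Q ^ 7
    length≤ = begin
      suc (Q + Q) * 4 ^ maxValue k ≤⟨ *-mono-≤ lem 4^maxValue ⟩
      Q ^ 3 * Q ^ 4 ≡⟨ ^-distribˡ-+-* Q 3 4 ⟨
      Q ^ 7 ∎
      where
      open ≤-Reasoning
      lem : suc (Q + Q) ≤ Q ^ 3
      lem = begin
        suc (Q + Q) ≤⟨ linear (Q ∷ []) (λ { (q ∷ []) → (1 , con 2 ≤ₑ q) ∷ [] , con 1 +ₑ (q +ₑ q) ≤ₑ q +ₑ
          (q +ₑ (q +ₑ (q +ₑ con 0))) }) (2≤Q ∷ []) ⟩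
        4 * Q ≤⟨ *-monoˡ-≤ Q (small-factor 4 2 ≤-refl) ⟩
        Q ^ 2 * Q ≡⟨ *-comm (Q ^ 2) Q ⟩
        Q ^ 3 ∎

    alphabet≤ : suc (2 ^ Q * 2 ^ Q * maxValue k) ≤ 2 ^ Q ^ 3
    alphabet≤ = begin
      suc (2 ^ Q * 2 ^ Q * maxValue k) ≤⟨ n<2^n′ ⟩
      2 ^ (Q + Q) * 2 ^ maxValue k ≡⟨ ^-distribˡ-+-* 2 (Q + Q) (maxValue k) ⟨
      2 ^ (Q + Q + maxValue k) ≤⟨ ^-monoʳ-≤ 2 exponent ⟩
      2 ^ Q ^ 3 ∎
      where
      open ≤-Reasoning
      n<2^n′ : suc (2 ^ Q * 2 ^ Q * maxValue k) ≤ 2 ^ (Q + Q) * 2 ^ maxValue k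
      n<2^n′ = begin
        suc (2 ^ Q * 2 ^ Q * maxValue k) ≡⟨ cong (λ z → suc (z * maxValue k)) (^-distribˡ-+-* 2 Q Q) ⟨
        suc (2 ^ (Q + Q) * maxValue k) ≤⟨ +-monoˡ-≤ (2 ^ (Q + Q) * maxValue k) (m^n>0 2 (Q + Q)) ⟩
        2 ^ (Q + Q) + 2 ^ (Q + Q) * maxValue k ≡⟨ *-suc (2 ^ (Q + Q)) (maxValue k) ⟨
        2 ^ (Q + Q) * suc (maxValue k) ≤⟨ *-monoʳ-≤ (2 ^ (Q + Q)) (n<2^n (maxValue k)) ⟩
        2 ^ (Q + Q) * 2 ^ maxValue k ∎
      exponent : Q + Q + maxValue k ≤ Q ^ 3
      exponent = begin
        Q + Q + (suc k + suc k) ≤⟨ linear (Q ∷ k ∷ [])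
          (λ { (q ∷ k ∷ []) → (2 , con 2 +ₑ k ≤ₑ q) ∷ [] , q +ₑ q +ₑ ((con 1 +ₑ k) +ₑ (con 1 +ₑ k)) ≤ₑ q +ₑ
          (q +ₑ (q +ₑ (q +ₑ con 0))) }) (2+k≤Q ∷ []) ⟩
        4 * Q ≤⟨ *-monoˡ-≤ Q (small-factor 4 2 ≤-refl) ⟩
        Q ^ 2 * Q ≡⟨ *-comm (Q ^ 2) Q ⟩
        Q ^ 3 ∎

  numWords≤ : numWords q k ≤ 2 ^ Q ^ 10
  numWords≤ = begin
    suc (2 ^ Q * 2 ^ Q * maxValue k) ^ maxLength q k ≤⟨ ^-monoˡ-≤ (maxLength q k) alphabet≤ ⟩
    (2 ^ Q ^ 3) ^ maxLength q k ≤⟨ ^-monoʳ-≤ (2 ^ Q ^ 3) {{m^n≢0 2 (Q ^ 3)}} length≤ ⟩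
    (2 ^ Q ^ 3) ^ Q ^ 7 ≡⟨ ^-*-assoc 2 (Q ^ 3) (Q ^ 7) ⟩
    2 ^ (Q ^ 3 * Q ^ 7) ≡⟨ cong (2 ^_) (^-distribˡ-+-* Q 3 7) ⟨
    2 ^ Q ^ 10 ∎
    where open ≤-Reasoning

  module _ {n} (M : Matroid n) (K : ℕ) where

    open Extraction M K (suc (numWords q k))

    private
      -- Bounds the growth from one level of `longEnough` to the next: `numWords q k + 2` gaps, and
      -- 3 more for the additive constant.
      W = 2 ^ Q ^ 11

      first≤ : ∀ s p → longEnough (suc s) p ≡ suc p * (longEnough s (suc (numWords q k)) + 3)
      first≤ s zero = sym (*-identityˡ _)
      first≤ s (suc p) = cong (longEnough s (suc (numWords q k)) + 3 +_) (first≤ s p)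

      factor≤ : suc (suc (numWords q k)) + 3 ≤ W
      factor≤ = begin
        suc (suc (numWords q k)) + 3 ≤⟨ +-monoˡ-≤ 3 (s≤s (s≤s numWords≤)) ⟩
        suc (suc (2 ^ Q ^ 10)) + 3 ≤⟨ lem (2 ^ Q ^ 10) (^-monoʳ-≤ 2 big) ⟩
        2 ^ Q ^ 10 * 2 ^ Q ^ 10 ≡⟨ ^-distribˡ-+-* 2 (Q ^ 10) (Q ^ 10) ⟨
        2 ^ (Q ^ 10 + Q ^ 10) ≤⟨ ^-monoʳ-≤ 2 (≤-trans (≤-reflexive (cong (Q ^ 10 +_) (sym (+-identityʳ (Q ^ 10)))))
          (*-monoˡ-≤ (Q ^ 10) 2≤Q)) ⟩
        2 ^ Q ^ 11 ∎
        where
        open ≤-Reasoning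
        big : 3 ≤ Q ^ 10
        big = ≤-trans (≤-trans (s≤s (s≤s (s≤s z≤n))) (small-factor 4 2 ≤-refl))
          (^-monoʳ-≤ Q {{Q≢0}} (s≤s (s≤s (z≤n {8}))))
        lem : ∀ x → 8 ≤ x → suc (suc x) + 3 ≤ x * x
        lem x 8≤x = ≤-trans (linear (x ∷ []) (λ { (x ∷ []) → (1 , con 8 ≤ₑ x) ∷ [] , con 2 +ₑ x +ₑ con 3 ≤ₑ x +ₑ
          (x +ₑ con 0) }) (8≤x ∷ []))
          (*-monoˡ-≤ x (≤-trans (s≤s (s≤s z≤n)) 8≤x))

    -- Carrying the summand 3 on the left makes the recurrence multiplicative, with a factor of at
    -- most W for each level.
    longEnough≤ : ∀ s → longEnough s (suc (numWords q k)) + 3 ≤ 3 * W ^ s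
    longEnough≤ zero = ≤-refl
    longEnough≤ (suc s) = begin
      longEnough (suc s) N + 3 ≡⟨ cong (_+ 3) (first≤ s N) ⟩
      suc N * x + 3 ≤⟨ +-monoʳ-≤ (suc N * x) (m≤m*n 3 x
        {{>-nonZero (≤-trans (s≤s z≤n) (m≤n+m 3 (longEnough s N)))}}) ⟩
      suc N * x + 3 * x ≡⟨ *-distribʳ-+ x (suc N) 3 ⟨
      (suc N + 3) * x ≤⟨ *-mono-≤ factor≤ (longEnough≤ s) ⟩
      W * (3 * W ^ s) ≡⟨ *-assoc W 3 (W ^ s) ⟨
      W * 3 * W ^ s ≡⟨ cong (_* W ^ s) (*-comm W 3) ⟩
      3 * W * W ^ s ≡⟨ *-assoc 3 W (W ^ s) ⟩
      3 * W ^ suc s ∎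
      where
      open ≤-Reasoning
      N = suc (numWords q k)
      x = longEnough s N + 3

    -- There are k + 2 levels, and the factor 3 is absorbed by another W. Since k + 3 is at most
    -- `Q ^ 2`, the exponent 11 becomes 13. This gives the exponent `13 * suc k` of q, and the
    -- square enters only in the last estimate.
    longEnough-bound : longEnough (suc (suc k)) (suc (numWords q k)) ≤ 2 ^ q ^ (13 * (suc k * suc k))
    longEnough-bound = begin
      longEnough (suc (suc k)) (suc (numWords q k)) ≤⟨ ≤-trans (m≤m+n _ 3) (longEnough≤ (suc (suc k))) ⟩
      3 * W ^ suc (suc k) ≤⟨ *-monoˡ-≤ (W ^ suc (suc k)) 3≤W ⟩
      W * W ^ suc (suc k) ≡⟨ ^-*-assoc 2 (Q ^ 11) (suc (suc (suc k))) ⟩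
      2 ^ (Q ^ 11 * suc (suc (suc k))) ≤⟨ ^-monoʳ-≤ 2 (*-monoʳ-≤ (Q ^ 11) 3+k≤) ⟩
      2 ^ (Q ^ 11 * Q ^ 2) ≡⟨ cong (2 ^_) (^-distribˡ-+-* Q 11 2) ⟨
      2 ^ Q ^ 13 ≡⟨ cong (2 ^_) (^-*-assoc q (suc k) 13) ⟩
      2 ^ q ^ (suc k * 13) ≤⟨ ^-monoʳ-≤ 2 (^-monoʳ-≤ q {{q≢0}} exponent) ⟩
      2 ^ q ^ (13 * (suc k * suc k)) ∎
      where
      open ≤-Reasoning
      3≤W : 3 ≤ W
      3≤W = ≤-trans (m≤n+m 3 (suc (suc (numWords q k)))) factor≤
      3+k≤ : suc (suc (suc k)) ≤ Q ^ 2
      3+k≤ = begin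
        suc (suc (suc k)) ≤⟨ s≤s 2+k≤Q ⟩
        suc Q ≤⟨ linear (Q ∷ []) (λ { (q ∷ []) → (1 , con 2 ≤ₑ q) ∷ [] , con 1 +ₑ q ≤ₑ q +ₑ (q +ₑ con 0) })
          (2≤Q ∷ []) ⟩
        2 * Q ≤⟨ *-mono-≤ 2≤Q (≤-reflexive (sym (*-identityʳ Q))) ⟩
        Q ^ 2 ∎
      exponent : suc k * 13 ≤ 13 * (suc k * suc k)
      exponent = ≤-trans (≤-reflexive (*-comm (suc k) 13)) (*-monoʳ-≤ 13 (m≤m*n (suc k) (suc k)))

1<∣F∣ : ∀ {q} → FiniteField q → 1 < q
1<∣F∣ {zero} F with () ← FiniteField.enc F (FiniteField.0# F)
1<∣F∣ {suc zero} F = Empty.⊥-elim (FiniteField.0≉1 F (FiniteField.enc-inj F (unique _ _)))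
  where
  unique : (i j : Fin 1) → i ≡ j
  unique zero zero = refl
1<∣F∣ {suc (suc q)} F = s≤s (s≤s z≤n)

-- The empty matroid is separate because the initial layout is obtained by deleting an element. The
-- extraction starts at t = 0, a lower bound for every connectivity; as prefixes have connectivity
-- at most k + 1, it needs k + 2 levels.
excluded⇒short : ∀ {q} (F : FiniteField q) k {n} (M : Matroid n) → Representable F M → ExcludedMinorPW M k →
                 n ≤ Extraction.longEnough M (suc k) (suc (numWords q k)) (suc (suc k)) (suc (numWords q k))
excluded⇒short F k {zero} M rep ex = z≤n
excluded⇒short {q} F k {suc n} M (_ , A , rank) ex = ≮⇒≥
  (λ long → contradict (extract (suc (suc k)) 0 ⊥ ⊤ (excluded⇒chain M ex)
    (λ Z _ _ → rk≤cut Z) (enough long) (s≤s (≤-reflexive (sym (+-identityʳ (suc k)))))))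
  where
  open Extraction M (suc k) (suc (numWords q k))
  open Rank M
  rk≤cut : ∀ Z → 0 + rk ⊤ ≤ cut Z
  rk≤cut Z = ≤-trans (r-mono M (λ {x} _ → subst (x ∈_) (sym (p∪∁p≡⊤ Z)) ∈⊤))
    (≤-trans (m≤m+n _ _) (r-submod M Z (∁ Z)))
  enough : ∀ {l} → l < suc n → l + ∣ ⊥ {n = suc n} ∣ ≤ ∣ ⊤ {n = suc n} ∣
  enough {l} l<n = ≤-trans (≤-reflexive (trans (cong (l +_) (∣⊥∣≡0 (suc n))) (+-identityʳ l)))
    (≤-trans (<⇒≤ l<n) (≤-reflexive (sym (∣⊤∣≡n (suc n)))))
  contradict : Good → Empty.⊥
  contradict (t , t≤ , ch) = Core.too-long (1<∣F∣ F) (ColumnSpace.spanSystem F A M rank) ch k t≤ ex ≤-refl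

theorem1p1 : ∃ λ (c : ℕ) → 0 < c ×
    (∀ (q : ℕ) (F : FiniteField q) (k : ℕ) (n : ℕ) (M : Matroid n) →
    Representable F M → ExcludedMinorPW M k →
    n ≤ 2 ^ (q ^ (c * (suc k * suc k))))
theorem1p1 = 13 , s≤s z≤n , λ q F k n M rep ex →
  ≤-trans (excluded⇒short F k M rep ex) (longEnough-bound (1<∣F∣ F) k M (suc k))
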